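{- There exists an absolute constant $c$ such that for every odd prime power $q$ and every set $S$ of $q+2$ points in $\mathrm{PG}(2,q)$, the number of odd secants of $S$ satisfies $o(S)\geqslant 2q-c$.
   Context: $\mathrm{PG}(2,q)$ denotes the projective plane over the finite field $\mathbb{F}_q$ with $q$ elements. For a set $S$ of points of $\mathrm{PG}(2,q)$, an odd secant of $S$ is a line of $\mathrm{PG}(2,q)$ incident with an odd number of points of $S$, and $o(S)$ denotes the number of odd secants of $S$. -}

module Defs where

open import Data.Nat using (ℕ; zero; suc; _+_; _%_; _≡ᵇ_)
open import Data.Fin using (Fin)
open import Data.Fin.Properties using (_≟_)
open import Data.Bool using (Bool; true; false; _∧_; _∨_; if_then_else_)
open import Data.Product using (_×_; _,_; ∃)
open import Data.List using (List; []; _∷_; concatMap; length)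
open import Data.List.Base using (allFin)
open import Relation.Binary.PropositionalEquality using (_≡_; _≢_)
open import Relation.Nullary.Decidable using (⌊_⌋)
open import Algebra.Structures using (IsCommutativeRing)

record FiniteField (q : ℕ) : Set where
  field
    _+F_ _*F_ : Fin q → Fin q → Fin q
    -F_       : Fin q → Fin q
    0F 1F     : Fin q
    isCommutativeRing : IsCommutativeRing _≡_ _+F_ _*F_ -F_ 0F 1F
    0≢1       : 0F ≢ 1F
    inverse   : ∀ x → x ≢ 0F → ∃ λ y → x *F y ≡ 1F

Triple : ℕ → Set
Triple q = Fin q × Fin q × Fin q

allTriples : ∀ q → List (Triple q)
allTriples q = concatMap (λ x → concatMap (λ y → concatMap (λ z → (x , y , z) ∷ []) (allFin q)) (allFin q)) (allFin q)

module _ {q : ℕ} (F : FiniteField q) where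
  open FiniteField F

  eqB : Fin q → Fin q → Bool
  eqB a b = ⌊ a ≟ b ⌋

  -- canonical representative of a projective point: first nonzero coordinate is 1
  normalizedB : Triple q → Bool
  normalizedB (x , y , z) =
    eqB x 1F ∨ (eqB x 0F ∧ eqB y 1F) ∨ (eqB x 0F ∧ eqB y 0F ∧ eqB z 1F)

  Normalized : Triple q → Set
  Normalized v = normalizedB v ≡ true

  filterB : {A : Set} → (A → Bool) → List A → List A
  filterB p [] = []
  filterB p (a ∷ as) = if p a then a ∷ filterB p as else filterB p as

  -- points of PG(2,q) (canonical representatives); lines are the same set (dual coordinates)
  projPoints : List (Triple q)
  projPoints = filterB normalizedB (allTriples q)

  incidentB : Triple q → Triple q → Bool
  incidentB (a , b , c) (x , y , z) = eqB ((a *F x) +F ((b *F y) +F (c *F z))) 0F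

  countB : {A : Set} → (A → Bool) → List A → ℕ
  countB p [] = 0
  countB p (a ∷ as) = if p a then suc (countB p as) else countB p as

  oddB : ℕ → Bool
  oddB n = (n % 2) ≡ᵇ 1

  oddSecants : List (Triple q) → ℕ
  oddSecants S = countB (λ L → oddB (countB (incidentB L) S)) projPoints

{-# OPTIONS --safe #-}
module Submission where

-- Let n(L) be the number of points of S on the line L.  Summing n(L) − 2 over the q + 1 lines through a
-- point x of S gives 0, so x is on at least as many tangents as trisecants; if x is on no tangent then all
-- its lines are bisecants, and if it is on one tangent g then all its other lines are bisecants except for
-- one trisecant f.  Call x good in the latter case.  Since every tangent and every trisecant is odd, o(S) is
-- at least the number of tangents plus the number of trisecants, and the bound 2q − c can only fail through
-- points without tangents and through trisecants with two or three good points.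
--
-- Segre's product argument (take the product over S of the slopes seen from the three vertices of a
-- triangle, using Wilson's theorem in each pencil) shows that at most two points have no tangent, and gives
-- the relation  g_x(z)f_x(y) g_y(x)f_y(z) g_z(y)f_z(x) = − f_x(z)g_x(y) f_y(x)g_y(z) f_z(y)g_z(x)
-- between three good points, with a variant when two of them share a trisecant.
--
-- Fix a trisecant with good points x, y and third point w.  In coordinates adapted to it, any other
-- trisecant with two good points that misses w is a chord determined by a slope φ, a midpoint (μ , κ) and a
-- half-length τ, and two such chords satisfy four polynomial relations.  Three chords of the same slope are
-- impossible.  For distinct slopes the relations force κ = c − bφ and μ = 2b + aφ + bφ² with common a, b, c;
-- six slopes give b = 0, then a(a − c) = 0 and τ² = ac, and then either τ = 0 or an endpoint of the chord
-- lies on the tangent at x.  So at most ten such trisecants miss w, while those through w are paid for by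
-- the tangents at w.

-- Tangents alone give only about `q`, since a good point is on a single one. The other `q` must
-- come from trisecants, and so trisecants shared by several good points are the obstacle. Every
-- point is to contribute 2, by two tangents or by one tangent and its trisecant. The exempted
-- points cost 6: two for `w` and two for each of at most two points without tangents. Each of the
-- at most ten shared trisecants missing `w` may be charged three times but counts once, which costs
-- 20. As `2 (q + 2)` exceeds `2 q` by 4, the constant is 20 + 6 - 4 = 22. The chord coordinates
-- give the directions of `x` and `y` the slopes 1 and -1 and that of `w` the slope infinity, so
-- missing `w` is exactly what makes the slope of a chord finite. The bound ten is five slopes with
-- two chords each, six different slopes being contradictory. The only integers ever cancelled are
-- powers of two, so characteristic three is not a special case.

open import Defs
open import Algebra.Bundles using (CommutativeMonoid; CommutativeRing)
open import Algebra.Structures using (IsCommutativeMonoid; IsCommutativeRing)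
open import Data.Bool as Bool using (Bool; true; false; _∧_; _∨_; T)
open import Data.Bool.Properties using (∨-zeroʳ)
open import Data.Empty using (⊥)
open import Data.Fin using (Fin; zero; suc)
open import Data.Fin.Properties as Fin using (_≟_)
open import Data.List using (List; []; _∷_; length; map; filter; allFin; concatMap)
open import Data.List.Membership.Propositional using (_∈_)
open import Data.List.Membership.Propositional.Properties using (∈-allFin; ∈-concatMap⁺; ∈-concatMap⁻; ∈-filter⁺; ∈-filter⁻)
open import Data.List.Properties using (length-map; length-tabulate)
open import Data.List.Relation.Unary.All as All using (All; []; _∷_)
import Data.List.Relation.Unary.All.Properties as All
open import Data.List.Relation.Unary.AllPairs as AllPairs using (AllPairs; []; _∷_)
import Data.List.Relation.Unary.AllPairs.Properties as AllPairs
open import Data.List.Relation.Unary.Any as Any using (here; there; satisfied)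
open import Data.List.Relation.Unary.Unique.Propositional using (Unique)
open import Data.List.Relation.Unary.Unique.Propositional.Properties using (allFin⁺; concat⁺; filter⁺)
open import Data.Nat as ℕ using (ℕ; zero; suc; _+_; _*_; _≤_; _%_; _≡ᵇ_; z≤n; s≤s)
import Data.Nat.DivMod as ℕ
import Data.Nat.Properties as ℕ
open import Data.Nat.Solver using (module +-*-Solver)
open import Data.Product using (_×_; _,_; proj₁; proj₂; ∃)
open import Data.Product.Properties using (≡-dec)
open import Data.Sum using (_⊎_; inj₁; inj₂)
open import Data.Unit using (tt)
open import Data.Vec using (Vec; []; _∷_; lookup)
open import Relation.Binary.Definitions using (DecidableEquality; tri<; tri≈; tri>)
open import Relation.Binary.PropositionalEquality
open import Relation.Nullary using (Dec; yes; no; ¬_; contradiction)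
open import Relation.Nullary.Decidable using (_×-dec_; ¬?)

-- A certificate-checking solver for polynomial identities

data Expr (n : ℕ) : Set where
  var : Fin n → Expr n
  𝟘 𝟙 : Expr n
  _:+_ _:*_ : Expr n → Expr n → Expr n
  :-_ : Expr n → Expr n

infixl 6 _:+_ _:-_
infixl 7 _:*_
infix 8 :-_

_:-_ : ∀ {n} → Expr n → Expr n → Expr n
a :- b = a :+ (:- b)

-- A constant (a , b) stands for the integer a − b; other polynomials are lists of coefficients in their
-- first variable, constant term first, and need not be trimmed.
Poly : ℕ → Set
Poly zero    = ℕ × ℕ
Poly (suc n) = List (Poly n)

zeroP : ∀ n → Poly n
zeroP zero    = 0 , 0
zeroP (suc n) = []

oneP : ∀ n → Poly n
oneP zero    = 1 , 0
oneP (suc n) = oneP n ∷ []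

varP : ∀ {n} → Fin n → Poly n
varP {suc n} zero    = zeroP n ∷ oneP n ∷ []
varP {suc n} (suc i) = varP i ∷ []

addP : ∀ n → Poly n → Poly n → Poly n
addP zero    (a , b) (c , d) = a ℕ.+ c , b ℕ.+ d
addP (suc n) []      q       = q
addP (suc n) (x ∷ p) []      = x ∷ p
addP (suc n) (x ∷ p) (y ∷ q) = addP n x y ∷ addP (suc n) p q

negP : ∀ n → Poly n → Poly n
negP zero    (a , b) = b , a
negP (suc n) []      = []
negP (suc n) (x ∷ p) = negP n x ∷ negP (suc n) p

mutual
  mulP : ∀ n → Poly n → Poly n → Poly n
  mulP zero    (a , b) (c , d) = a ℕ.* c ℕ.+ b ℕ.* d , a ℕ.* d ℕ.+ b ℕ.* c
  mulP (suc n) []      q       = []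
  mulP (suc n) (x ∷ p) q       = addP (suc n) (scaleP n x q) (zeroP n ∷ mulP (suc n) p q)

  scaleP : ∀ n → Poly n → List (Poly n) → List (Poly n)
  scaleP n x []      = []
  scaleP n x (y ∷ q) = mulP n x y ∷ scaleP n x q

isZero : ∀ n → Poly n → Bool
isZero zero    (a , b) = a ≡ᵇ b
isZero (suc n) []      = true
isZero (suc n) (x ∷ p) = isZero n x ∧ isZero (suc n) p

norm : ∀ {n} → Expr n → Poly n
norm (var i)  = varP i
norm 𝟘        = zeroP _
norm 𝟙        = oneP _
norm (a :+ b) = addP _ (norm a) (norm b)
norm (a :* b) = mulP _ (norm a) (norm b)
norm (:- a)   = negP _ (norm a)

record Equation (n : ℕ) : Set where
  constructor _≔_
  field lhs rhs : Expr n
infix 4 _≔_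

-- The goal is certified when  lhs − rhs  is the sum of the given multiples of the differences of the hypotheses.
record Problem (n : ℕ) : Set where
  constructor _by_
  field
    goal : Equation n
    certificate : List (Expr n × Equation n)
infix 3 _by_

Curried : ℕ → ℕ → Set → Set
Curried n zero    B = B
Curried n (suc k) B = Expr n → Curried n k B

applyTo : ∀ {n} k {B} → Curried n k B → (Fin k → Expr n) → B
applyTo zero    f e = f
applyTo (suc k) f e = applyTo k (f (e zero)) (λ i → e (suc i))

problem : ∀ n → Curried n n (Problem n) → Problem n
problem n f = applyTo n f var

-- At a point where the hypotheses hold, each subtracted multiple evaluates to zero. Vanishing of
-- the residual as an integer polynomial therefore forces the goal there: ideal membership is
-- checked, not searched for.
residualOf : ∀ {n} → Expr n → List (Expr n × Equation n) → Expr n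
residualOf e []                   = e
residualOf e ((c , (a ≔ b)) ∷ hs) = residualOf (e :- c :* (a :- b)) hs

residual : ∀ {n} → Problem n → Expr n
residual ((l ≔ r) by hs) = residualOf (l :- r) hs

-- Finite sums, products and counts

module Fold {M : Set} {_∙_ : M → M → M} {ε : M} (isCM : IsCommutativeMonoid _≡_ _∙_ ε) where
  private
    commutativeMonoid : CommutativeMonoid _ _
    commutativeMonoid = record { isCommutativeMonoid = isCM }
  open IsCommutativeMonoid isCM using (identityˡ; identityʳ)
  open import Algebra.Properties.CommutativeSemigroup (CommutativeMonoid.commutativeSemigroup commutativeMonoid)
    using (interchange)

  fold : {A : Set} → List A → (A → M) → M
  fold []       f = ε
  fold (a ∷ as) f = f a ∙ fold as f

  module _ {A : Set} where
    fold-cong : ∀ (as : List A) {f g} → (∀ {a} → a ∈ as → f a ≡ g a) → fold as f ≡ fold as g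
    fold-cong []       h = refl
    fold-cong (a ∷ as) h = cong₂ _∙_ (h (here refl)) (fold-cong as (λ i → h (there i)))

    fold-ε : ∀ (as : List A) {f} → (∀ {a} → a ∈ as → f a ≡ ε) → fold as f ≡ ε
    fold-ε []       h = refl
    fold-ε (a ∷ as) h = trans (cong₂ _∙_ (h (here refl)) (fold-ε as (λ i → h (there i)))) (identityˡ ε)

    fold-∙ : ∀ (as : List A) f g → fold as (λ a → f a ∙ g a) ≡ fold as f ∙ fold as g
    fold-∙ []       f g = sym (identityˡ ε)
    fold-∙ (a ∷ as) f g = trans (cong ((f a ∙ g a) ∙_) (fold-∙ as f g)) (interchange _ _ _ _)

    fold-single : ∀ {as : List A} {b f} → Unique as → b ∈ as → (∀ {a} → a ∈ as → a ≢ b → f a ≡ ε) → fold as f ≡ f b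
    fold-single {a ∷ as} {f = f} (a∉as ∷ _) (here refl) h =
      trans (cong (f a ∙_) (fold-ε as (λ i → h (there i) (λ e → All.lookup a∉as i (sym e))))) (identityʳ _)
    fold-single {a ∷ as} (a∉as ∷ u) (there i) h =
      trans (cong₂ _∙_ (h (here refl) (All.lookup a∉as i)) (fold-single u i (λ j → h (there j)))) (identityˡ _)

  fold-swap : ∀ {A B : Set} (as : List A) (bs : List B) (f : A → B → M) →
    fold as (λ a → fold bs (f a)) ≡ fold bs (λ b → fold as (λ a → f a b))
  fold-swap []       bs f = sym (fold-ε bs (λ _ → refl))
  fold-swap (a ∷ as) bs f = trans (cong (fold bs (f a) ∙_) (fold-swap as bs f)) (sym (fold-∙ bs _ _))

  select : {P : Set} → Dec P → M → M
  select (yes _) m = m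
  select (no _)  m = ε

  select-yes : ∀ {P} (d : Dec P) m → P → select d m ≡ m
  select-yes (yes _) m p = refl
  select-yes (no ¬p) m p = contradiction p ¬p

  select-no : ∀ {P} (d : Dec P) m → ¬ P → select d m ≡ ε
  select-no (yes p) m ¬p = contradiction p ¬p
  select-no (no _)  m ¬p = refl

  fold-select : ∀ {A : Set} {as : List A} (_≟_ : DecidableEquality A) {b} (f : A → M) → Unique as → b ∈ as →
    fold as (λ a → select (a ≟ b) (f a)) ≡ f b
  fold-select _≟_ {b} f u i =
    trans (fold-single u i (λ {a} _ a≢b → select-no (a ≟ b) (f a) a≢b)) (select-yes (b ≟ b) (f b) refl)

  module _ {q : ℕ} (ι : Fin q → Fin q) (ι-involutive : ∀ x → ι (ι x) ≡ x) where

    -- `f (ι x)` is spread out as a fold over all `y` that keeps only `y ≡ ι x`; after exchanging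
    -- the two folds, each `y` is reached from the single `x ≡ ι y`.
    fold-reindex : ∀ f → fold (allFin q) (λ x → f (ι x)) ≡ fold (allFin q) f
    fold-reindex f = begin
      fold (allFin q) (λ x → f (ι x))
        ≡⟨ fold-cong (allFin q) (λ {x} _ → sym (fold-select Fin._≟_ f (allFin⁺ q) (∈-allFin (ι x)))) ⟩
      fold (allFin q) (λ x → fold (allFin q) (λ y → select (y Fin.≟ ι x) (f y)))
        ≡⟨ fold-swap (allFin q) (allFin q) _ ⟩
      fold (allFin q) (λ y → fold (allFin q) (λ x → select (y Fin.≟ ι x) (f y)))
        ≡⟨ fold-cong (allFin q) (λ {y} _ → trans
             (fold-single (allFin⁺ q) (∈-allFin (ι y)) (λ {x} _ x≢ιy →
               select-no (y Fin.≟ ι x) (f y) (λ e → x≢ιy (trans (sym (ι-involutive x)) (cong ι (sym e))))))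
             (select-yes (y Fin.≟ ι (ι y)) (f y) (sym (ι-involutive y)))) ⟩
      fold (allFin q) f ∎
      where open ≡-Reasoning

    -- The orbits are fixed points and pairs, and the order of `Fin q` selects the smaller element
    -- of each pair. Wilson's theorem applies this to inversion, the parity of `q` to translation by
    -- one.
    fold-involution : ∀ f → fold (allFin q) f ≡
      fold (allFin q) (λ x → select (ι x Fin.≟ x) (f x)) ∙ fold (allFin q) (λ x → select (x Fin.<? ι x) (f x ∙ f (ι x)))
    fold-involution f = begin
      fold (allFin q) f
        ≡⟨ fold-cong (allFin q) (λ {x} _ → trichotomy x) ⟩
      fold (allFin q) (λ x → fixed x ∙ (below x ∙ above x))
        ≡⟨ fold-∙ (allFin q) fixed _ ⟩
      fold (allFin q) fixed ∙ fold (allFin q) (λ x → below x ∙ above x)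
        -- Reindexing by `ι` moves the larger element of each pair onto its smaller partner.
        ≡⟨ cong (fold (allFin q) fixed ∙_) (trans (fold-∙ (allFin q) below above) (trans
             (cong (fold (allFin q) below ∙_) (sym (fold-reindex above))) (sym (fold-∙ (allFin q) below (λ x → above (ι x)))))) ⟩
      fold (allFin q) fixed ∙ fold (allFin q) (λ x → below x ∙ above (ι x))
        ≡⟨ cong (fold (allFin q) fixed ∙_) (fold-cong (allFin q) (λ {x} _ → join x)) ⟩
      _ ∎
      where
      open ≡-Reasoning
      fixed below above : Fin q → M
      fixed x = select (ι x Fin.≟ x) (f x)
      below x = select (x Fin.<? ι x) (f x)
      above x = select (ι x Fin.<? x) (f x)
      trichotomy : ∀ x → f x ≡ fixed x ∙ (below x ∙ above x)
      trichotomy x with Fin.<-cmp x (ι x)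
      ... | tri< lt ne gt = sym (trans (cong₂ _∙_ (select-no (ι x Fin.≟ x) (f x) (λ e → ne (sym e)))
              (cong₂ _∙_ (select-yes (x Fin.<? ι x) (f x) lt) (select-no (ι x Fin.<? x) (f x) gt)))
              (trans (identityˡ _) (identityʳ _)))
      ... | tri≈ lt eq gt = sym (trans (cong₂ _∙_ (select-yes (ι x Fin.≟ x) (f x) (sym eq))
              (cong₂ _∙_ (select-no (x Fin.<? ι x) (f x) lt) (select-no (ι x Fin.<? x) (f x) gt)))
              (trans (cong (f x ∙_) (identityˡ ε)) (identityʳ _)))
      ... | tri> lt ne gt = sym (trans (cong₂ _∙_ (select-no (ι x Fin.≟ x) (f x) (λ e → ne (sym e)))
              (cong₂ _∙_ (select-no (x Fin.<? ι x) (f x) lt) (select-yes (ι x Fin.<? x) (f x) gt)))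
              (trans (identityˡ _) (identityˡ _)))
      join : ∀ x → below x ∙ above (ι x) ≡ select (x Fin.<? ι x) (f x ∙ f (ι x))
      join x rewrite ι-involutive x with x Fin.<? ι x
      ... | yes _ = refl
      ... | no _  = identityˡ ε

open Fold ℕ.+-0-isCommutativeMonoid public
  renaming (fold to ∑; fold-cong to ∑-cong; fold-ε to ∑-zero; fold-∙ to ∑-+; fold-single to ∑-single; fold-swap to ∑-swap; fold-involution to ∑-involution; select to select-ℕ)
  using ()

𝟏 : {P : Set} → Dec P → ℕ
𝟏 (yes _) = 1
𝟏 (no _)  = 0

𝟏-yes : ∀ {P} (d : Dec P) → P → 𝟏 d ≡ 1
𝟏-yes (yes _) p = refl
𝟏-yes (no ¬p) p = contradiction p ¬p

𝟏-no : ∀ {P} (d : Dec P) → ¬ P → 𝟏 d ≡ 0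
𝟏-no (yes p) ¬p = contradiction p ¬p
𝟏-no (no _)  ¬p = refl

module _ {A : Set} where

  ∑-mono : ∀ (as : List A) {f g} → (∀ {a} → a ∈ as → f a ≤ g a) → ∑ as f ≤ ∑ as g
  ∑-mono []       h = z≤n
  ∑-mono (a ∷ as) h = ℕ.+-mono-≤ (h (here refl)) (∑-mono as (λ i → h (there i)))

  ∑-const : ∀ (as : List A) k → ∑ as (λ _ → k) ≡ length as * k
  ∑-const []       k = refl
  ∑-const (a ∷ as) k = cong (k +_) (∑-const as k)

  ∑-*ˡ : ∀ (as : List A) k f → ∑ as (λ a → k * f a) ≡ k * ∑ as f
  ∑-*ˡ []       k f = sym (ℕ.*-zeroʳ k)
  ∑-*ˡ (a ∷ as) k f = trans (cong (k * f a +_) (∑-*ˡ as k f)) (sym (ℕ.*-distribˡ-+ k (f a) _))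

  ∑-≡0 : ∀ (as : List A) {f} → ∑ as f ≡ 0 → ∀ {a} → a ∈ as → f a ≡ 0
  ∑-≡0 (a ∷ as) {f} h (here refl) = ℕ.m+n≡0⇒m≡0 (f a) h
  ∑-≡0 (a ∷ as) {f} h (there i)   = ∑-≡0 as (ℕ.m+n≡0⇒n≡0 (f a) h) i

  count : (as : List A) {P : A → Set} → (∀ a → Dec (P a)) → ℕ
  count as P? = ∑ as (λ a → 𝟏 (P? a))

  count-∃ : ∀ (as : List A) {P : A → Set} (P? : ∀ a → Dec (P a)) → 1 ≤ count as P? → ∃ λ a → a ∈ as × P a
  count-∃ (a ∷ as) P? h with P? a
  ... | yes p = a , here refl , p
  ... | no _ with count-∃ as P? h
  ...   | b , i , p = b , there i , p

  count-none : ∀ (as : List A) {P : A → Set} (P? : ∀ a → Dec (P a)) → count as P? ≡ 0 → ∀ {a} → a ∈ as → ¬ P a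
  count-none as P? h {a} i p with trans (sym (𝟏-yes (P? a) p)) (∑-≡0 as h i)
  ... | ()

  module _ (_≟_ : DecidableEquality A) where

    count-≡ : ∀ {as : List A} {b} → Unique as → b ∈ as → count as (_≟ b) ≡ 1
    count-≡ {b = b} u i = trans (∑-single u i (λ {a} _ ne → 𝟏-no (a ≟ b) ne)) (𝟏-yes (b ≟ b) refl)

    count-unique : ∀ {as : List A} {P : A → Set} (P? : ∀ a → Dec (P a)) {b} → Unique as → b ∈ as → P b →
      (∀ {a} → a ∈ as → P a → a ≡ b) → count as P? ≡ 1
    count-unique P? {b} u i pb only =
      trans (∑-single u i (λ {a} j ne → 𝟏-no (P? a) (λ pa → ne (only j pa)))) (𝟏-yes (P? b) pb)

    without? : ∀ {P : A → Set} (P? : ∀ a → Dec (P a)) b a → Dec (P a × a ≢ b)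
    without? P? b a = P? a ×-dec ¬? (a ≟ b)

    count-remove : ∀ {as : List A} {P : A → Set} (P? : ∀ a → Dec (P a)) {b} → Unique as → b ∈ as → P b →
      count as P? ≡ suc (count as (without? P? b))
    count-remove {as} P? {b} u i pb =
      trans (∑-cong as (λ {a} _ → split a)) (trans (∑-+ as _ _) (cong (_+ count as (without? P? b)) (count-≡ u i)))
      where
      split : ∀ a → 𝟏 (P? a) ≡ 𝟏 (a ≟ b) + 𝟏 (without? P? b a)
      split a with P? a | a ≟ b
      ... | yes _ | yes _ = refl
      ... | yes _ | no _  = refl
      ... | no ¬p | yes e = contradiction (subst _ (sym e) pb) ¬p
      ... | no _  | no _  = refl

    count-≥2 : ∀ {as : List A} {P : A → Set} (P? : ∀ a → Dec (P a)) → Unique as → 2 ≤ count as P? →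
      ∃ λ a → ∃ λ b → a ∈ as × b ∈ as × P a × P b × a ≢ b
    count-≥2 {as} P? u h with count-∃ as P? (ℕ.≤-trans (s≤s z≤n) h)
    ... | a , i , pa with count-∃ as (without? P? a) (ℕ.≤-pred (subst (2 ≤_) (count-remove P? u i pa) h))
    ...   | b , j , pb , b≢a = a , b , i , j , pa , pb , (λ e → b≢a (sym e))

    count-remove₂ : ∀ {as : List A} {P : A → Set} (P? : ∀ a → Dec (P a)) {b c} → Unique as → b ∈ as → c ∈ as →
      P b → P c → b ≢ c → count as P? ≡ 2 + count as (without? (without? P? b) c)
    count-remove₂ P? {b} u i j pb pc b≢c =
      trans (count-remove P? u i pb) (cong suc (count-remove (without? P? b) u j (pc , λ e → b≢c (sym e))))

    count-2 : ∀ {as : List A} {P : A → Set} (P? : ∀ a → Dec (P a)) {b c} → Unique as → b ∈ as → c ∈ as →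
      P b → P c → b ≢ c → count as P? ≡ 2 → ∀ {a} → a ∈ as → P a → a ≡ b ⊎ a ≡ c
    count-2 {as} P? {b} {c} u i j pb pc b≢c h {a} k pa with a ≟ b | a ≟ c
    ... | yes e | _     = inj₁ e
    ... | no _  | yes e = inj₂ e
    ... | no a≢b | no a≢c = contradiction ((pa , a≢b) , a≢c)
      (count-none as (without? (without? P? b) c)
        (ℕ.suc-injective (ℕ.suc-injective (trans (sym (count-remove₂ P? u i j pb pc b≢c)) h))) k)

    count-3 : ∀ {as : List A} {P : A → Set} (P? : ∀ a → Dec (P a)) {b c} → Unique as → b ∈ as → c ∈ as →
      P b → P c → b ≢ c → count as P? ≡ 3 →
      ∃ λ d → d ∈ as × P d × d ≢ b × d ≢ c × (∀ {a} → a ∈ as → P a → a ≡ b ⊎ a ≡ c ⊎ a ≡ d)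
    count-3 {as} {P} P? {b} {c} u i j pb pc b≢c h = third (count-∃ as Q? (ℕ.≤-reflexive (sym one)))
      where
      Q? = without? (without? P? b) c
      one : count as Q? ≡ 1
      one = ℕ.suc-injective (ℕ.suc-injective (trans (sym (count-remove₂ P? u i j pb pc b≢c)) h))
      third : (∃ λ d → d ∈ as × (P d × d ≢ b) × d ≢ c) →
        ∃ λ d → d ∈ as × P d × d ≢ b × d ≢ c × (∀ {a} → a ∈ as → P a → a ≡ b ⊎ a ≡ c ⊎ a ≡ d)
      third (d , k , (pd , d≢b) , d≢c) = d , k , pd , d≢b , d≢c , only
        where
        only : ∀ {a} → a ∈ as → P a → a ≡ b ⊎ a ≡ c ⊎ a ≡ d
        only {a} l pa with a ≟ b | a ≟ c | a ≟ d
        ... | yes e | _ | _ = inj₁ e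
        ... | no _ | yes e | _ = inj₂ (inj₁ e)
        ... | no _ | no _ | yes e = inj₂ (inj₂ e)
        ... | no a≢b | no a≢c | no a≢d = contradiction (((pa , a≢b) , a≢c) , a≢d)
          (count-none as (without? Q? d) (ℕ.suc-injective (trans (sym (count-remove Q? u k ((pd , d≢b) , d≢c))) one)) l)

-- The polynomials of the chord argument, to be read both in the field and as expressions for the solver.
module Forms {A : Set} (add mul : A → A → A) (neg : A → A) (one : A) where
  infixl 6 _⊕_ _⊝_
  infixl 7 _⊗_
  _⊕_ _⊗_ _⊝_ : A → A → A
  _⊕_ = add
  _⊗_ = mul
  a ⊝ b = a ⊕ neg b

  two : A
  two = one ⊕ one

  -- Vanishes when z and w are good points whose trisecants have slopes φ and ψ in the coordinates (p , s).
  conj : (φ zp zs ψ wp ws : A) → A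
  conj φ zp zs ψ wp ws =
    (vs ⊗ (φ ⊗ zs ⊕ zp) ⊝ vp ⊗ (φ ⊗ zp ⊕ zs)) ⊗ (vs ⊝ ψ ⊗ vp)
      ⊕ (vs ⊝ φ ⊗ vp) ⊗ (vs ⊗ (ψ ⊗ ws ⊕ wp) ⊝ vp ⊗ (ψ ⊗ wp ⊕ ws))
    where
    vp = zp ⊝ wp
    vs = zs ⊝ ws

  -- The two letters are the signs of `τ` and `θ`: they choose one end of each of two chords.
  conjpp conjpm conjmp conjmm : (φ μ κ τ ψ ν l θ : A) → A
  conjpp φ μ κ τ ψ ν l θ = conj φ (μ ⊕ τ) (κ ⊕ (φ ⊗ τ)) ψ (ν ⊕ θ) (l ⊕ (ψ ⊗ θ))
  conjpm φ μ κ τ ψ ν l θ = conj φ (μ ⊕ τ) (κ ⊕ (φ ⊗ τ)) ψ (ν ⊝ θ) (l ⊝ (ψ ⊗ θ))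
  conjmp φ μ κ τ ψ ν l θ = conj φ (μ ⊝ τ) (κ ⊝ (φ ⊗ τ)) ψ (ν ⊕ θ) (l ⊕ (ψ ⊗ θ))
  conjmm φ μ κ τ ψ ν l θ = conj φ (μ ⊝ τ) (κ ⊝ (φ ⊗ τ)) ψ (ν ⊝ θ) (l ⊝ (ψ ⊗ θ))

  -- The coefficient of τθ in the four relations, up to the factor 2 (φ − ψ).
  mixed : (φ μ κ ψ ν l : A) → A
  mixed φ μ κ ψ ν l = ((two ⊝ φ ⊗ ψ) ⊗ (κ ⊝ l)) ⊝ (ψ ⊗ μ ⊝ φ ⊗ ν)

  -- Midpoints as functions of the slope: the common form that the `mixed` relations impose on
  -- chords once two slopes differ.
  midp mids : A → A → A → A
  midp a b φ = two ⊗ b ⊕ a ⊗ φ ⊕ b ⊗ φ ⊗ φ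
  mids b c φ = c ⊝ b ⊗ φ

  sq : A → A
  sq x = x ⊗ x

  -- The sum of the coefficients of τ and of θ, up to the factor (φ − ψ)², splits into a contribution of
  -- each chord (where w = τ²) and a cross term.
  ownTerm : (a b c φ w : A) → A
  ownTerm a b c φ w = (one ⊕ sq φ) ⊗ w ⊝ sq b ⊗ sq (sq φ) ⊝ two ⊗ a ⊗ b ⊗ sq φ ⊗ φ ⊝ sq a ⊗ sq φ
     ⊕ sq b ⊗ sq φ ⊝ two ⊗ a ⊗ b ⊗ φ ⊝ two ⊗ two ⊗ b ⊗ c ⊗ φ ⊝ a ⊗ c ⊝ (two ⊕ one) ⊗ sq b

  crossTerm : (a b c φ ψ : A) → A
  crossTerm a b c φ ψ = two ⊗ (φ ⊗ ψ) ⊗ (two ⊗ sq b ⊗ (sq φ ⊕ sq ψ) ⊕ (two ⊗ two ⊕ one) ⊗ sq b ⊗ φ ⊗ ψ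
     ⊕ ((two ⊕ one) ⊗ a ⊗ b ⊝ b ⊗ c) ⊗ (φ ⊕ ψ) ⊕ sq a ⊝ a ⊗ c)

  sumRel : (a b c φ ψ w w′ : A) → A
  sumRel a b c φ ψ w w′ = ownTerm a b c φ w ⊕ ownTerm a b c ψ w′ ⊕ crossTerm a b c φ ψ

  -- The mixed second difference of crossTerm in f₁, f₂ and f₃, f₄.
  quad : (a b c f₁ f₂ f₃ f₄ : A) → A
  quad a b c f₁ f₂ f₃ f₄ = two ⊗ sq b ⊗ ((sq f₁ ⊕ f₁ ⊗ f₂ ⊕ sq f₂) ⊕ (sq f₃ ⊕ f₃ ⊗ f₄ ⊕ sq f₄))
     ⊕ (two ⊗ two ⊕ one) ⊗ sq b ⊗ (f₁ ⊕ f₂) ⊗ (f₃ ⊕ f₄)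
     ⊕ ((two ⊕ one) ⊗ a ⊗ b ⊝ b ⊗ c) ⊗ (f₁ ⊕ f₂ ⊕ f₃ ⊕ f₄) ⊕ sq a ⊝ a ⊗ c

  -- conj in the coordinates (ξ , υ) with p = ξ − υ and s = ξ + υ, the trisecants having directions d and e.
  affineConj : (z₁ z₂ d₁ d₂ t₁ t₂ e₁ e₂ : A) → A
  affineConj z₁ z₂ d₁ d₂ t₁ t₂ e₁ e₂ =
    (z₁ ⊗ d₁ ⊗ v₂ ⊕ z₂ ⊗ d₂ ⊗ v₁) ⊗ (e₁ ⊗ v₂ ⊝ e₂ ⊗ v₁) ⊕ (d₁ ⊗ v₂ ⊝ d₂ ⊗ v₁) ⊗ (t₁ ⊗ e₁ ⊗ v₂ ⊕ t₂ ⊗ e₂ ⊗ v₁)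
    where
    v₁ = t₁ ⊝ z₁
    v₂ = t₂ ⊝ z₂

module E {n} = Forms {Expr n} _:+_ _:*_ :-_ 𝟙

module Plane {q : ℕ} (F : FiniteField q) where

  open FiniteField F
  open IsCommutativeRing isCommutativeRing using (+-assoc; +-comm; +-identityˡ; +-identityʳ; -‿inverseˡ; -‿inverseʳ; *-assoc; *-comm; *-identityˡ; *-identityʳ; distribˡ; distribʳ; zeroˡ; zeroʳ)

  commutativeRing : CommutativeRing _ _
  commutativeRing = record { isCommutativeRing = isCommutativeRing }
  open import Algebra.Properties.Ring (CommutativeRing.ring commutativeRing)
    using (-‿involutive; -‿+-comm; -‿distribˡ-*; -‿distribʳ-*)
  open import Algebra.Properties.CommutativeSemigroup (CommutativeRing.+-commutativeSemigroup commutativeRing)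
    using (interchange)
  open import Algebra.Properties.CommutativeSemigroup (CommutativeRing.*-commutativeSemigroup commutativeRing)
    using (x∙yz≈y∙xz)
  open import Algebra.Properties.Semiring.Mult (CommutativeRing.semiring commutativeRing)
    using (×-homo-+; ×1-homo-*) renaming (_×_ to _×ᵣ_)

  open import Algebra.Properties.Ring (CommutativeRing.ring commutativeRing) public using (-0#≈0#)

  -- Soundness of the certificate checker in the field

  private module Soundness where
    open ≡-Reasoning

    ⟦_⟧ : ∀ {n} → Expr n → Vec (Fin q) n → Fin q
    ⟦ var i ⟧ ρ  = lookup ρ i
    ⟦ 𝟘 ⟧ ρ      = 0F
    ⟦ 𝟙 ⟧ ρ      = 1F
    ⟦ a :+ b ⟧ ρ = ⟦ a ⟧ ρ +F ⟦ b ⟧ ρ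
    ⟦ a :* b ⟧ ρ = ⟦ a ⟧ ρ *F ⟦ b ⟧ ρ
    ⟦ :- a ⟧ ρ   = -F (⟦ a ⟧ ρ)

    eval : ∀ n → Poly n → Vec (Fin q) n → Fin q
    eval zero    (a , b) ρ       = (a ×ᵣ 1F) +F (-F (b ×ᵣ 1F))
    eval (suc n) []      ρ       = 0F
    eval (suc n) (x ∷ p) (r ∷ ρ) = eval n x ρ +F (r *F eval (suc n) p (r ∷ ρ))

    eval-zero : ∀ n ρ → eval n (zeroP n) ρ ≡ 0F
    eval-zero zero    ρ = -‿inverseʳ 0F
    eval-zero (suc n) ρ = refl

    eval-one : ∀ n ρ → eval n (oneP n) ρ ≡ 1F
    eval-one zero    ρ       = trans (cong₂ _+F_ (+-identityʳ 1F) -0#≈0#) (+-identityʳ 1F)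
    eval-one (suc n) (r ∷ ρ) = trans (cong₂ _+F_ (eval-one n ρ) (zeroʳ r)) (+-identityʳ 1F)

    eval-var : ∀ {n} (i : Fin n) ρ → eval n (varP i) ρ ≡ lookup ρ i
    eval-var {suc n} zero (r ∷ ρ) = begin
      eval n (zeroP n) ρ +F (r *F eval (suc n) (oneP (suc n)) (r ∷ ρ))
        ≡⟨ cong₂ (λ a b → a +F (r *F b)) (eval-zero n ρ) (eval-one (suc n) (r ∷ ρ)) ⟩
      0F +F (r *F 1F)  ≡⟨ +-identityˡ _ ⟩
      r *F 1F          ≡⟨ *-identityʳ r ⟩
      r ∎
    eval-var {suc n} (suc i) (r ∷ ρ) = trans (cong₂ _+F_ (eval-var i ρ) (zeroʳ r)) (+-identityʳ _)

    eval-add : ∀ n a b ρ → eval n (addP n a b) ρ ≡ eval n a ρ +F eval n b ρ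
    eval-add zero (a , b) (c , d) ρ = begin
      ((a ℕ.+ c) ×ᵣ 1F) +F (-F ((b ℕ.+ d) ×ᵣ 1F))
        ≡⟨ cong₂ (λ x y → x +F (-F y)) (×-homo-+ 1F a c) (×-homo-+ 1F b d) ⟩
      ((a ×ᵣ 1F) +F (c ×ᵣ 1F)) +F (-F ((b ×ᵣ 1F) +F (d ×ᵣ 1F)))
        ≡⟨ cong (((a ×ᵣ 1F) +F (c ×ᵣ 1F)) +F_) (sym (-‿+-comm _ _)) ⟩
      ((a ×ᵣ 1F) +F (c ×ᵣ 1F)) +F ((-F (b ×ᵣ 1F)) +F (-F (d ×ᵣ 1F)))
        ≡⟨ interchange _ _ _ _ ⟩
      ((a ×ᵣ 1F) +F (-F (b ×ᵣ 1F))) +F ((c ×ᵣ 1F) +F (-F (d ×ᵣ 1F))) ∎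
    eval-add (suc n) []      b       ρ       = sym (+-identityˡ _)
    eval-add (suc n) (x ∷ p) []      (r ∷ ρ) = sym (+-identityʳ _)
    eval-add (suc n) (x ∷ p) (y ∷ b) (r ∷ ρ) = begin
      eval n (addP n x y) ρ +F (r *F eval (suc n) (addP (suc n) p b) (r ∷ ρ))
        ≡⟨ cong₂ (λ u v → u +F (r *F v)) (eval-add n x y ρ) (eval-add (suc n) p b (r ∷ ρ)) ⟩
      (eval n x ρ +F eval n y ρ) +F (r *F (eval (suc n) p (r ∷ ρ) +F eval (suc n) b (r ∷ ρ)))
        ≡⟨ cong ((eval n x ρ +F eval n y ρ) +F_) (distribˡ r _ _) ⟩
      (eval n x ρ +F eval n y ρ) +F ((r *F eval (suc n) p (r ∷ ρ)) +F (r *F eval (suc n) b (r ∷ ρ)))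
        ≡⟨ interchange _ _ _ _ ⟩
      _ ∎

    eval-neg : ∀ n a ρ → eval n (negP n a) ρ ≡ -F (eval n a ρ)
    eval-neg zero (a , b) ρ = begin
      (b ×ᵣ 1F) +F (-F (a ×ᵣ 1F))           ≡⟨ cong (_+F (-F (a ×ᵣ 1F))) (sym (-‿involutive _)) ⟩
      (-F (-F (b ×ᵣ 1F))) +F (-F (a ×ᵣ 1F)) ≡⟨ -‿+-comm _ _ ⟩
      -F ((-F (b ×ᵣ 1F)) +F (a ×ᵣ 1F))      ≡⟨ cong -F_ (+-comm _ _) ⟩
      -F ((a ×ᵣ 1F) +F (-F (b ×ᵣ 1F))) ∎
    eval-neg (suc n) []      ρ       = sym -0#≈0#
    eval-neg (suc n) (x ∷ p) (r ∷ ρ) = begin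
      eval n (negP n x) ρ +F (r *F eval (suc n) (negP (suc n) p) (r ∷ ρ))
        ≡⟨ cong₂ (λ u v → u +F (r *F v)) (eval-neg n x ρ) (eval-neg (suc n) p (r ∷ ρ)) ⟩
      (-F (eval n x ρ)) +F (r *F (-F (eval (suc n) p (r ∷ ρ))))
        ≡⟨ cong ((-F (eval n x ρ)) +F_) (sym (-‿distribʳ-* r _)) ⟩
      (-F (eval n x ρ)) +F (-F (r *F eval (suc n) p (r ∷ ρ)))
        ≡⟨ -‿+-comm _ _ ⟩
      _ ∎

    mul-diff : ∀ a b c d → (a +F (-F b)) *F (c +F (-F d)) ≡ ((a *F c) +F (b *F d)) +F (-F ((a *F d) +F (b *F c)))
    mul-diff a b c d = begin
      (a +F (-F b)) *F (c +F (-F d))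
        ≡⟨ distribʳ _ a (-F b) ⟩
      (a *F (c +F (-F d))) +F ((-F b) *F (c +F (-F d)))
        ≡⟨ cong₂ _+F_ (distribˡ a c (-F d)) (distribˡ (-F b) c (-F d)) ⟩
      ((a *F c) +F (a *F (-F d))) +F (((-F b) *F c) +F ((-F b) *F (-F d)))
        ≡⟨ cong₂ (λ u v → ((a *F c) +F u) +F v) (sym (-‿distribʳ-* a d)) (+-comm _ _) ⟩
      ((a *F c) +F (-F (a *F d))) +F (((-F b) *F (-F d)) +F ((-F b) *F c))
        ≡⟨ interchange _ _ _ _ ⟩
      ((a *F c) +F ((-F b) *F (-F d))) +F ((-F (a *F d)) +F ((-F b) *F c))
        ≡⟨ cong₂ (λ u v → ((a *F c) +F u) +F ((-F (a *F d)) +F v)) neg² (sym (-‿distribˡ-* b c)) ⟩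
      ((a *F c) +F (b *F d)) +F ((-F (a *F d)) +F (-F (b *F c)))
        ≡⟨ cong (((a *F c) +F (b *F d)) +F_) (-‿+-comm _ _) ⟩
      _ ∎
      where
      neg² : (-F b) *F (-F d) ≡ b *F d
      neg² = trans (sym (-‿distribˡ-* b (-F d))) (trans (cong -F_ (sym (-‿distribʳ-* b d))) (-‿involutive _))

    mutual
      eval-mul : ∀ n a b ρ → eval n (mulP n a b) ρ ≡ eval n a ρ *F eval n b ρ
      eval-mul zero (a , b) (c , d) ρ = begin
        ((a ℕ.* c ℕ.+ b ℕ.* d) ×ᵣ 1F) +F (-F ((a ℕ.* d ℕ.+ b ℕ.* c) ×ᵣ 1F))
          ≡⟨ cong₂ (λ x y → x +F (-F y)) (pair a c b d) (pair a d b c) ⟩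
        (((a ×ᵣ 1F) *F (c ×ᵣ 1F)) +F ((b ×ᵣ 1F) *F (d ×ᵣ 1F))) +F (-F (((a ×ᵣ 1F) *F (d ×ᵣ 1F)) +F ((b ×ᵣ 1F) *F (c ×ᵣ 1F))))
          ≡⟨ sym (mul-diff _ _ _ _) ⟩
        _ ∎
        where
        pair : ∀ i j k l → ((i ℕ.* j ℕ.+ k ℕ.* l) ×ᵣ 1F) ≡ ((i ×ᵣ 1F) *F (j ×ᵣ 1F)) +F ((k ×ᵣ 1F) *F (l ×ᵣ 1F))
        pair i j k l = trans (×-homo-+ 1F (i ℕ.* j) (k ℕ.* l)) (cong₂ _+F_ (×1-homo-* i j) (×1-homo-* k l))
      eval-mul (suc n) []      b ρ       = sym (zeroˡ _)
      eval-mul (suc n) (x ∷ p) b (r ∷ ρ) = begin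
        eval (suc n) (addP (suc n) (scaleP n x b) (zeroP n ∷ mulP (suc n) p b)) (r ∷ ρ)
          ≡⟨ eval-add (suc n) (scaleP n x b) (zeroP n ∷ mulP (suc n) p b) (r ∷ ρ) ⟩
        eval (suc n) (scaleP n x b) (r ∷ ρ) +F (eval n (zeroP n) ρ +F (r *F eval (suc n) (mulP (suc n) p b) (r ∷ ρ)))
          ≡⟨ cong₂ _+F_ (eval-scale n x b r ρ) (trans (cong₂ (λ u v → u +F (r *F v)) (eval-zero n ρ) (eval-mul (suc n) p b (r ∷ ρ))) (+-identityˡ _)) ⟩
        (eval n x ρ *F B) +F (r *F (eval (suc n) p (r ∷ ρ) *F B))
          ≡⟨ cong ((eval n x ρ *F B) +F_) (sym (*-assoc r _ B)) ⟩
        (eval n x ρ *F B) +F ((r *F eval (suc n) p (r ∷ ρ)) *F B)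
          ≡⟨ sym (distribʳ B _ _) ⟩
        _ ∎
        where B = eval (suc n) b (r ∷ ρ)

      eval-scale : ∀ n x b r ρ → eval (suc n) (scaleP n x b) (r ∷ ρ) ≡ eval n x ρ *F eval (suc n) b (r ∷ ρ)
      eval-scale n x []      r ρ = sym (zeroʳ _)
      eval-scale n x (y ∷ b) r ρ = begin
        eval n (mulP n x y) ρ +F (r *F eval (suc n) (scaleP n x b) (r ∷ ρ))
          ≡⟨ cong₂ (λ u v → u +F (r *F v)) (eval-mul n x y ρ) (eval-scale n x b r ρ) ⟩
        (eval n x ρ *F eval n y ρ) +F (r *F (eval n x ρ *F eval (suc n) b (r ∷ ρ)))
          ≡⟨ cong ((eval n x ρ *F eval n y ρ) +F_) (x∙yz≈y∙xz r _ _) ⟩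
        (eval n x ρ *F eval n y ρ) +F (eval n x ρ *F (r *F eval (suc n) b (r ∷ ρ)))
          ≡⟨ sym (distribˡ _ _ _) ⟩
        _ ∎

    eval-norm : ∀ {n} (e : Expr n) ρ → eval n (norm e) ρ ≡ ⟦ e ⟧ ρ
    eval-norm (var i)  ρ = eval-var i ρ
    eval-norm 𝟘        ρ = eval-zero _ ρ
    eval-norm 𝟙        ρ = eval-one _ ρ
    eval-norm (a :+ b) ρ = trans (eval-add _ (norm a) (norm b) ρ) (cong₂ _+F_ (eval-norm a ρ) (eval-norm b ρ))
    eval-norm (a :* b) ρ = trans (eval-mul _ (norm a) (norm b) ρ) (cong₂ _*F_ (eval-norm a ρ) (eval-norm b ρ))
    eval-norm (:- a)   ρ = trans (eval-neg _ (norm a) ρ) (cong -F_ (eval-norm a ρ))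

    ∧-split : ∀ {a b} → a ∧ b ≡ true → (a ≡ true) × (b ≡ true)
    ∧-split {true} e = refl , e

    eval-isZero : ∀ n p ρ → isZero n p ≡ true → eval n p ρ ≡ 0F
    eval-isZero zero (a , b) ρ e
      rewrite ℕ.≡ᵇ⇒≡ a b (subst T (sym e) tt) = -‿inverseʳ _
    eval-isZero (suc n) []      ρ       e = refl
    eval-isZero (suc n) (x ∷ p) (r ∷ ρ) e with ∧-split {isZero n x} e
    ... | ex , ep = trans (cong₂ (λ u v → u +F (r *F v)) (eval-isZero n x ρ ex) (eval-isZero (suc n) p (r ∷ ρ) ep))
                          (trans (+-identityˡ _) (zeroʳ r))

    x-y≡0⇒x≡y : ∀ {x y} → x +F (-F y) ≡ 0F → x ≡ y
    x-y≡0⇒x≡y {x} {y} e = begin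
      x                        ≡⟨ sym (+-identityʳ x) ⟩
      x +F 0F                  ≡⟨ cong (x +F_) (sym (-‿inverseˡ y)) ⟩
      x +F ((-F y) +F y)       ≡⟨ sym (+-assoc x _ y) ⟩
      (x +F (-F y)) +F y       ≡⟨ cong (_+F y) e ⟩
      0F +F y                  ≡⟨ +-identityˡ y ⟩
      y ∎

    Holds : ∀ {n} → Vec (Fin q) n → Equation n → Set
    Holds ρ (a ≔ b) = ⟦ a ⟧ ρ ≡ ⟦ b ⟧ ρ

    Hyps : ∀ {n} → Vec (Fin q) n → List (Expr n × Equation n) → Set → Set
    Hyps ρ []             G = G
    Hyps ρ ((_ , h) ∷ hs) G = Holds ρ h → Hyps ρ hs G

    -- The continuation holds what follows from vanishing of the current expression; every
    -- hypothesis changes the expression, and `drop` shows that its value stays the same.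
    residual-zero : ∀ {n} ρ (e : Expr n) hs {G : Set} → (⟦ e ⟧ ρ ≡ 0F → G) → ⟦ residualOf e hs ⟧ ρ ≡ 0F → Hyps ρ hs G
    residual-zero ρ e [] k z = k z
    residual-zero ρ e ((c , (a ≔ b)) ∷ hs) k z h = residual-zero ρ (e :- c :* (a :- b)) hs (λ z′ → k (trans (sym drop) z′)) z
      where
      drop : ⟦ e :- c :* (a :- b) ⟧ ρ ≡ ⟦ e ⟧ ρ
      drop = begin
        ⟦ e ⟧ ρ +F (-F (⟦ c ⟧ ρ *F (⟦ a ⟧ ρ +F (-F (⟦ b ⟧ ρ)))))
          ≡⟨ cong (λ u → ⟦ e ⟧ ρ +F (-F (⟦ c ⟧ ρ *F (u +F (-F (⟦ b ⟧ ρ)))))) h ⟩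
        ⟦ e ⟧ ρ +F (-F (⟦ c ⟧ ρ *F (⟦ b ⟧ ρ +F (-F (⟦ b ⟧ ρ)))))
          ≡⟨ cong (λ u → ⟦ e ⟧ ρ +F (-F (⟦ c ⟧ ρ *F u))) (-‿inverseʳ _) ⟩
        ⟦ e ⟧ ρ +F (-F (⟦ c ⟧ ρ *F 0F))
          ≡⟨ cong (λ u → ⟦ e ⟧ ρ +F (-F u)) (zeroʳ _) ⟩
        ⟦ e ⟧ ρ +F (-F 0F)  ≡⟨ cong (⟦ e ⟧ ρ +F_) -0#≈0# ⟩
        ⟦ e ⟧ ρ +F 0F       ≡⟨ +-identityʳ _ ⟩
        ⟦ e ⟧ ρ ∎

    Solved : ∀ {n} → Problem n → Vec (Fin q) n → Set
    Solved (g by hs) ρ = Hyps ρ hs (Holds ρ g)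

    Closed : ∀ k → (Vec (Fin q) k → Set) → Set
    Closed zero    P = P []
    Closed (suc k) P = (x : Fin q) → Closed k (λ ρ → P (x ∷ ρ))

    close : ∀ k {P : Vec (Fin q) k → Set} → (∀ ρ → P ρ) → Closed k P
    close zero    f   = f []
    close (suc k) f x = close k (λ ρ → f (x ∷ ρ))

    -- The check is a Boolean that computes, so callers discharge it by `refl`; then they pass the
    -- values of the variables and the proofs of the hypotheses in order.
    solve : ∀ n (f : Curried n n (Problem n)) → isZero n (norm (residual (problem n f))) ≡ true →
            Closed n (Solved (problem n f))
    solve n f e = close n (λ ρ → go (problem n f) e ρ)
      where
      go : ∀ p → isZero n (norm (residual p)) ≡ true → ∀ ρ → Solved p ρ
      go ((l ≔ r) by hs) e ρ = residual-zero ρ (l :- r) hs x-y≡0⇒x≡y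
        (trans (sym (eval-norm (residualOf (l :- r) hs) ρ)) (eval-isZero n (norm (residualOf (l :- r) hs)) ρ e))

  open Soundness public using (solve; x-y≡0⇒x≡y)

  -- Inverses, the parity of `q` and Wilson's theorem

  infixl 6 _-F_
  _-F_ : Fin q → Fin q → Fin q
  a -F b = a +F (-F b)

  abstract
    -- The value 0 at 0 makes this an involution of all of `Fin q`, as `fold-involution` requires.
    inv : Fin q → Fin q
    inv a with a ≟ 0F
    ... | yes _  = 0F
    ... | no a≢0 = proj₁ (inverse a a≢0)

    inv-right : ∀ {a} → a ≢ 0F → a *F inv a ≡ 1F
    inv-right {a} a≢0 with a ≟ 0F
    ... | yes a≡0 = contradiction a≡0 a≢0
    ... | no a≢0′ = proj₂ (inverse a a≢0′)

    inv-0 : inv 0F ≡ 0F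
    inv-0 with 0F ≟ 0F
    ... | yes _ = refl
    ... | no ne = contradiction refl ne

  cancelˡ : ∀ {a b} → a ≢ 0F → a *F b ≡ 0F → b ≡ 0F
  cancelˡ {a} {b} a≢0 ab≡0 =
    solve 3 (λ a b c → b ≔ 𝟘 by (c , (a :* b ≔ 𝟘)) ∷ (:- b , (a :* c ≔ 𝟙)) ∷ []) refl a b (inv a) ab≡0 (inv-right a≢0)

  *-nonzero : ∀ {a b} → a ≢ 0F → b ≢ 0F → a *F b ≢ 0F
  *-nonzero a≢0 b≢0 ab≡0 = b≢0 (cancelˡ a≢0 ab≡0)

  x≢y⇒x-y≢0 : ∀ {a b} → a ≢ b → a -F b ≢ 0F
  x≢y⇒x-y≢0 a≢b e = a≢b (x-y≡0⇒x≡y e)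

  inv-nonzero : ∀ {a} → a ≢ 0F → inv a ≢ 0F
  inv-nonzero {a} a≢0 e = 0≢1 (trans (sym (zeroʳ a)) (trans (cong (a *F_) (sym e)) (inv-right a≢0)))

  inv-involutive : ∀ x → inv (inv x) ≡ x
  inv-involutive x with x ≟ 0F
  ... | yes refl = trans (cong inv inv-0) inv-0
  ... | no x≢0 = solve 3 (λ x i j → j ≔ x by (:- j , (x :* i ≔ 𝟙)) ∷ (x , (i :* j ≔ 𝟙)) ∷ []) refl
                   x (inv x) (inv (inv x)) (inv-right x≢0) (inv-right (inv-nonzero x≢0))

  module Prod = Fold (IsCommutativeRing.*-isCommutativeMonoid isCommutativeRing)
  open Prod public using (select; select-yes; select-no)
    renaming (fold to ∏; fold-cong to ∏-cong; fold-ε to ∏-one; fold-∙ to ∏-*; fold-single to ∏-single; fold-swap to ∏-swap; fold-select to ∏-select)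

  -- If `1 + 1` were 0, then adding 1 would be an involution without fixed points, and `Fin q` would
  -- split into pairs.
  odd⇒2≢0 : q % 2 ≡ 1 → 1F +F 1F ≢ 0F
  odd⇒2≢0 odd 2≡0 = contradiction (trans (sym odd) (trans (cong (_% 2) (trans q≡2h (ℕ.*-comm 2 h))) (ℕ.m*n%n≡0 h 2))) λ ()
    where
    ι : Fin q → Fin q
    ι x = x +F 1F
    ι-involutive : ∀ x → ι (ι x) ≡ x
    ι-involutive x = solve 1 (λ x → (x :+ 𝟙) :+ 𝟙 ≔ x by (𝟙 , (𝟙 :+ 𝟙 ≔ 𝟘)) ∷ []) refl x 2≡0
    moves : ∀ x → ι x ≢ x
    moves x e = 0≢1 (sym (solve 1 (λ x → 𝟙 ≔ 𝟘 by (𝟙 , (x :+ 𝟙 ≔ x)) ∷ []) refl x e))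
    h = ∑ (allFin q) (λ x → 𝟏 (x Fin.<? ι x))
    q≡2h : q ≡ 2 ℕ.* h
    q≡2h = begin
      q                                        ≡⟨ sym (ℕ.*-identityʳ q) ⟩
      q ℕ.* 1                                  ≡⟨ cong (ℕ._* 1) (sym (length-tabulate {n = q} (λ x → x))) ⟩
      length (allFin q) ℕ.* 1                  ≡⟨ sym (∑-const (allFin q) 1) ⟩
      ∑ (allFin q) (λ _ → 1)                   ≡⟨ ∑-involution ι ι-involutive (λ _ → 1) ⟩
      ∑ (allFin q) (λ x → select-ℕ (ι x ≟ x) 1) ℕ.+ ∑ (allFin q) (λ x → select-ℕ (x Fin.<? ι x) 2)
        ≡⟨ cong₂ ℕ._+_ (∑-zero (allFin q) (λ {x} _ → no-fixed x)) (∑-cong (allFin q) (λ {x} _ → double x)) ⟩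
      ∑ (allFin q) (λ x → 2 ℕ.* 𝟏 (x Fin.<? ι x)) ≡⟨ ∑-*ˡ (allFin q) 2 _ ⟩
      2 ℕ.* h ∎
      where
      open ≡-Reasoning
      no-fixed : ∀ x → select-ℕ (ι x ≟ x) 1 ≡ 0
      no-fixed x with ι x ≟ x
      ... | yes e = contradiction e (moves x)
      ... | no _  = refl
      double : ∀ x → select-ℕ (x Fin.<? ι x) 2 ≡ 2 ℕ.* 𝟏 (x Fin.<? ι x)
      double x with x Fin.<? ι x
      ... | yes _ = refl
      ... | no _  = refl

  nonzeroOr1 : Fin q → Fin q
  nonzeroOr1 x = select (¬? (x ≟ 0F)) x

  module _ (2≢0 : 1F +F 1F ≢ 0F) where

    -1≢1 : -F 1F ≢ 1F
    -1≢1 e = 2≢0 (trans (cong (1F +F_) (sym e)) (-‿inverseʳ 1F))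

    -1≢0 : -F 1F ≢ 0F
    -1≢0 e = 0≢1 (trans (sym (+-identityʳ 0F)) (solve 0 (𝟘 :+ 𝟘 ≔ 𝟙 by (𝟙 , (:- 𝟙 ≔ 𝟘)) ∷ []) refl e))

    -- Elements that differ from their inverse cancel in pairs, and 0 counts as 1. The remaining
    -- fixed points of `inv` are the roots of `(x − 1)(x + 1)`, which are distinct because 2 is
    -- nonzero.
    wilson : ∏ (allFin q) nonzeroOr1 ≡ -F 1F
    wilson = begin
      ∏ (allFin q) nonzeroOr1
        ≡⟨ Prod.fold-involution inv inv-involutive nonzeroOr1 ⟩
      ∏ (allFin q) (λ x → select (inv x ≟ x) (nonzeroOr1 x)) *F ∏ (allFin q) (λ x → select (x Fin.<? inv x) (nonzeroOr1 x *F nonzeroOr1 (inv x)))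
        ≡⟨ cong₂ _*F_ (∏-cong (allFin q) (λ {x} _ → fixed x)) (∏-one (allFin q) (λ {x} _ → moved x)) ⟩
      ∏ (allFin q) (λ x → select (x ≟ 1F) x *F select (x ≟ (-F 1F)) x) *F 1F
        ≡⟨ *-identityʳ _ ⟩
      ∏ (allFin q) (λ x → select (x ≟ 1F) x *F select (x ≟ (-F 1F)) x)
        ≡⟨ ∏-* (allFin q) _ _ ⟩
      ∏ (allFin q) (λ x → select (x ≟ 1F) x) *F ∏ (allFin q) (λ x → select (x ≟ (-F 1F)) x)
        ≡⟨ cong₂ _*F_ (∏-select _≟_ (λ x → x) (allFin⁺ q) (∈-allFin 1F)) (∏-select _≟_ (λ x → x) (allFin⁺ q) (∈-allFin (-F 1F))) ⟩
      1F *F (-F 1F)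
        ≡⟨ *-identityˡ _ ⟩
      -F 1F ∎
      where
      open ≡-Reasoning
      moved : ∀ x → select (x Fin.<? inv x) (nonzeroOr1 x *F nonzeroOr1 (inv x)) ≡ 1F
      moved x with x Fin.<? inv x
      ... | no _ = refl
      ... | yes _ with x ≟ 0F
      ...   | yes x≡0 = trans (*-identityˡ _) (select-no (¬? (inv x ≟ 0F)) (inv x) (λ ne → ne (trans (cong inv x≡0) inv-0)))
      ...   | no x≢0 = trans (cong (x *F_) (select-yes (¬? (inv x ≟ 0F)) (inv x) (inv-nonzero x≢0))) (inv-right x≢0)
      fixed : ∀ x → select (inv x ≟ x) (nonzeroOr1 x) ≡ select (x ≟ 1F) x *F select (x ≟ (-F 1F)) x
      fixed x with x ≟ 1F | x ≟ (-F 1F)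
      ... | yes refl | yes e = contradiction (sym e) -1≢1
      ... | yes refl | no _ = trans (select-yes (inv 1F ≟ 1F) _ (trans (sym (*-identityˡ _)) (inv-right (≢-sym 0≢1))))
              (trans (select-yes (¬? (1F ≟ 0F)) 1F (≢-sym 0≢1)) (sym (*-identityʳ 1F)))
      ... | no _ | yes refl = trans (select-yes (inv (-F 1F) ≟ (-F 1F)) _ inv-1)
              (trans (select-yes (¬? ((-F 1F) ≟ 0F)) (-F 1F) -1≢0) (sym (*-identityˡ _)))
        where
        inv-1 : inv (-F 1F) ≡ -F 1F
        inv-1 = solve 1 (λ i → i ≔ :- 𝟙 by (:- 𝟙 , (:- 𝟙 :* i ≔ 𝟙)) ∷ []) refl (inv (-F 1F)) (inv-right -1≢0)
      ... | no x≢1 | no x≢-1 with x ≟ 0F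
      ...   | yes x≡0 = trans (select-one (inv x ≟ x)) (sym (*-identityˡ 1F))
        where
        select-one : ∀ {P} (d : Dec P) → select d 1F ≡ 1F
        select-one (yes _) = refl
        select-one (no _) = refl
      ...   | no x≢0 = trans (select-no (inv x ≟ x) x (λ e → x≢-1 (x-y≡0⇒x≡y
                (cancelˡ (x≢y⇒x-y≢0 x≢1) (solve 2 (λ x i → (x :- 𝟙) :* (x :- :- 𝟙) ≔ 𝟘 by (𝟙 , (x :* i ≔ 𝟙)) ∷ (:- x , (i ≔ x)) ∷ [])
                  refl x (inv x) (inv-right x≢0) e)))))
              (sym (*-identityˡ 1F))

  -- Points and lines of the plane

  V : Set
  V = Triple q

  _≟V_ : DecidableEquality V
  _≟V_ = ≡-dec _≟_ (≡-dec _≟_ _≟_)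

  0V : V
  0V = 0F , 0F , 0F

  infixl 7 _·_ _•_ _⨯_
  infixl 6 _+V_ _-V_

  _·_ : V → V → Fin q
  (a , b , c) · (x , y , z) = (a *F x) +F ((b *F y) +F (c *F z))

  _•_ : Fin q → V → V
  k • (x , y , z) = k *F x , k *F y , k *F z

  _+V_ _-V_ _⨯_ : V → V → V
  (a , b , c) +V (x , y , z) = a +F x , b +F y , c +F z
  (a , b , c) -V (x , y , z) = a -F x , b -F y , c -F z
  (a , b , c) ⨯ (x , y , z) = (b *F z) -F (c *F y) , (c *F x) -F (a *F z) , (a *F y) -F (b *F x)

  det : V → V → V → Fin q
  det x y z = (x ⨯ y) · z

  ≡V : ∀ {a b c x y z : Fin q} → a ≡ x → b ≡ y → c ≡ z → (a , b , c) ≡ (x , y , z)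
  ≡V refl refl refl = refl

  EV : ℕ → Set
  EV n = Expr n × Expr n × Expr n

  infixl 7 _:·_ _:⨯_
  _:·_ : ∀ {n} → EV n → EV n → Expr n
  (a , b , c) :· (x , y , z) = (a :* x) :+ ((b :* y) :+ (c :* z))

  _:⨯_ : ∀ {n} → EV n → EV n → EV n
  (a , b , c) :⨯ (x , y , z) = (b :* z) :- (c :* y) , (c :* x) :- (a :* z) , (a :* y) :- (b :* x)

  0·  : ∀ s → 0V · s ≡ 0F
  0· (x , y , z) = solve 3 (λ x y z → (𝟘 , 𝟘 , 𝟘) :· (x , y , z) ≔ 𝟘 by []) refl x y z

  ·-•ˡ : ∀ k L s → (k • L) · s ≡ k *F (L · s)
  ·-•ˡ k (a , b , c) (x , y , z) =
    solve 7 (λ k a b c x y z → (k :* a , k :* b , k :* c) :· (x , y , z) ≔ k :* ((a , b , c) :· (x , y , z)) by []) refl k a b c x y z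

  ·-•ʳ : ∀ k L s → L · (k • s) ≡ k *F (L · s)
  ·-•ʳ k (a , b , c) (x , y , z) =
    solve 7 (λ k a b c x y z → (a , b , c) :· (k :* x , k :* y , k :* z) ≔ k :* ((a , b , c) :· (x , y , z)) by []) refl k a b c x y z

  ·-+ʳ : ∀ L s t → L · (s +V t) ≡ (L · s) +F (L · t)
  ·-+ʳ (a , b , c) (x , y , z) (x′ , y′ , z′) =
    solve 9 (λ a b c x y z x′ y′ z′ → (a , b , c) :· (x :+ x′ , y :+ y′ , z :+ z′) ≔ (a , b , c) :· (x , y , z) :+ (a , b , c) :· (x′ , y′ , z′) by [])
      refl a b c x y z x′ y′ z′

  ·--ʳ : ∀ L s t → L · (s -V t) ≡ (L · s) -F (L · t)
  ·--ʳ (a , b , c) (x , y , z) (x′ , y′ , z′) =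
    solve 9 (λ a b c x y z x′ y′ z′ → (a , b , c) :· (x :- x′ , y :- y′ , z :- z′) ≔ (a , b , c) :· (x , y , z) :- (a , b , c) :· (x′ , y′ , z′) by [])
      refl a b c x y z x′ y′ z′

  ·--ˡ : ∀ L M s → (L -V M) · s ≡ (L · s) -F (M · s)
  ·--ˡ (a , b , c) (x , y , z) (x′ , y′ , z′) =
    solve 9 (λ a b c x y z x′ y′ z′ → (a :- x , b :- y , c :- z) :· (x′ , y′ , z′) ≔ (a , b , c) :· (x′ , y′ , z′) :- (x , y , z) :· (x′ , y′ , z′) by [])
      refl a b c x y z x′ y′ z′

  det-xyx : ∀ x y → det x y x ≡ 0F
  det-xyx (a , b , c) (x , y , z) =
    solve 6 (λ a b c x y z → ((a , b , c) :⨯ (x , y , z)) :· (a , b , c) ≔ 𝟘 by []) refl a b c x y z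

  det-xyy : ∀ x y → det x y y ≡ 0F
  det-xyy (a , b , c) (x , y , z) =
    solve 6 (λ a b c x y z → ((a , b , c) :⨯ (x , y , z)) :· (x , y , z) ≔ 𝟘 by []) refl a b c x y z

  det-rotate : ∀ x y z → det y z x ≡ det x y z
  det-rotate (a , b , c) (x , y , z) (x′ , y′ , z′) =
    solve 9 (λ a b c x y z x′ y′ z′ → ((x , y , z) :⨯ (x′ , y′ , z′)) :· (a , b , c) ≔ ((a , b , c) :⨯ (x , y , z)) :· (x′ , y′ , z′) by [])
      refl a b c x y z x′ y′ z′

  det-swap : ∀ x y z → det x z y ≡ -F (det x y z)
  det-swap (a , b , c) (x , y , z) (x′ , y′ , z′) =
    solve 9 (λ a b c x y z x′ y′ z′ → ((a , b , c) :⨯ (x′ , y′ , z′)) :· (x , y , z) ≔ :- (((a , b , c) :⨯ (x , y , z)) :· (x′ , y′ , z′)) by [])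
      refl a b c x y z x′ y′ z′

  -- Cramer's rule for the coordinates of `s` in the basis `x`, `y`, `z`, paired with `L` and
  -- multiplied by the determinant so that nothing is divided.
  cramer : ∀ L x y z s → det x y z *F (L · s) ≡ ((L · x) *F det y z s) +F (((L · y) *F det z x s) +F ((L · z) *F det x y s))
  cramer (l , m , n) (a , b , c) (d , e , f) (g , h , i) (j , k , o) =
    solve 15 (λ l m n a b c d e f g h i j k o →
      let L = (l , m , n) ; x = (a , b , c) ; y = (d , e , f) ; z = (g , h , i) ; s = (j , k , o) in
      ((x :⨯ y) :· z) :* (L :· s) ≔ ((L :· x) :* ((y :⨯ z) :· s)) :+ (((L :· y) :* ((z :⨯ x) :· s)) :+ ((L :· z) :* ((x :⨯ y) :· s))) by [])
      refl l m n a b c d e f g h i j k o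

  binet : ∀ L M y z → (L ⨯ M) · (y ⨯ z) ≡ ((L · y) *F (M · z)) -F ((L · z) *F (M · y))
  binet (l , m , n) (a , b , c) (d , e , f) (g , h , i) =
    solve 12 (λ l m n a b c d e f g h i →
      let L = (l , m , n) ; M = (a , b , c) ; y = (d , e , f) ; z = (g , h , i) in
      (L :⨯ M) :· (y :⨯ z) ≔ ((L :· y) :* (M :· z)) :- ((L :· z) :* (M :· y)) by [])
      refl l m n a b c d e f g h i

  -- The triple product expansion writes `L ⨯ (x ⨯ y)` as a combination of `x` and `y` with
  -- coefficients `L · y` and `− (L · x)`.
  ⨯-⨯ : ∀ k L x y → L · x ≡ 0F → L · y ≡ 0F → L ⨯ (k • (x ⨯ y)) ≡ 0V
  ⨯-⨯ k (l , m , n) (a , b , c) (d , e , f) Lx Ly = ≡V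
    (solve 10 (λ k l m n a b c d e f → let L = (l , m , n) ; x = (a , b , c) ; y = (d , e , f) in
      m :* (k :* (a :* e :- b :* d)) :- n :* (k :* (c :* d :- a :* f)) ≔ 𝟘 by (:- (k :* d) , (L :· x ≔ 𝟘)) ∷ (k :* a , (L :· y ≔ 𝟘)) ∷ [])
      refl k l m n a b c d e f Lx Ly)
    (solve 10 (λ k l m n a b c d e f → let L = (l , m , n) ; x = (a , b , c) ; y = (d , e , f) in
      n :* (k :* (b :* f :- c :* e)) :- l :* (k :* (a :* e :- b :* d)) ≔ 𝟘 by (:- (k :* e) , (L :· x ≔ 𝟘)) ∷ (k :* b , (L :· y ≔ 𝟘)) ∷ [])
      refl k l m n a b c d e f Lx Ly)
    (solve 10 (λ k l m n a b c d e f → let L = (l , m , n) ; x = (a , b , c) ; y = (d , e , f) in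
      l :* (k :* (c :* d :- a :* f)) :- m :* (k :* (b :* f :- c :* e)) ≔ 𝟘 by (:- (k :* f) , (L :· x ≔ 𝟘)) ∷ (k :* c , (L :· y ≔ 𝟘)) ∷ [])
      refl k l m n a b c d e f Lx Ly)

  -- Normal forms and the list of lines

  data NormalForm : V → Set where
    affine   : ∀ y z → NormalForm (1F , y , z)
    infinite : ∀ z → NormalForm (0F , 1F , z)
    vertical : NormalForm (0F , 0F , 1F)

  normalForm : ∀ v → Normalized F v → NormalForm v
  normalForm (x , y , z) h with x ≟ 1F | x ≟ 0F | y ≟ 1F | y ≟ 0F | z ≟ 1F
  ... | yes refl | _        | _        | _        | _        = affine y z
  ... | no _     | yes refl | yes refl | _        | _        = infinite z
  ... | no _     | yes refl | no _     | yes refl | yes refl = vertical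
  normalForm _ () | no _ | yes refl | no _ | yes refl | no _
  normalForm _ () | no _ | yes refl | no _ | no _     | _
  normalForm _ () | no _ | no _     | _    | _        | _

  eqB-refl : ∀ a → eqB F a a ≡ true
  eqB-refl a with a ≟ a
  ... | yes _ = refl
  ... | no ne = contradiction refl ne

  normalForm⁻¹ : ∀ {v} → NormalForm v → Normalized F v
  normalForm⁻¹ (affine y z) rewrite eqB-refl 1F = refl
  normalForm⁻¹ (infinite z) rewrite eqB-refl 0F | eqB-refl 1F = ∨-zeroʳ _
  normalForm⁻¹ vertical rewrite eqB-refl 0F | eqB-refl 1F = trans (cong (eqB F 0F 1F ∨_) (∨-zeroʳ _)) (∨-zeroʳ _)

  normalForm-≢0 : ∀ {v} → NormalForm v → v ≢ 0V
  normalForm-≢0 (affine y z) e = 0≢1 (sym (cong proj₁ e))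
  normalForm-≢0 (infinite z) e = 0≢1 (sym (cong (λ v → proj₁ (proj₂ v)) e))
  normalForm-≢0 vertical     e = 0≢1 (sym (cong (λ v → proj₂ (proj₂ v)) e))

  normalize : ∀ v → v ≢ 0V → ∃ λ k → k ≢ 0F × NormalForm (k • v)
  normalize (x , y , z) v≢0 with x ≟ 0F
  ... | no x≢0 = inv x , inv-nonzero x≢0 ,
          subst (λ t → NormalForm (t , inv x *F y , inv x *F z)) (sym (trans (*-comm _ _) (inv-right x≢0))) (affine _ _)
  ... | yes refl with y ≟ 0F
  ...   | no y≢0 = inv y , inv-nonzero y≢0 ,
            subst₂ (λ s t → NormalForm (s , t , inv y *F z)) (sym (zeroʳ _)) (sym (trans (*-comm _ _) (inv-right y≢0))) (infinite _)
  ...   | yes refl with z ≟ 0F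
  ...     | yes refl = contradiction refl v≢0
  ...     | no z≢0 = inv z , inv-nonzero z≢0 ,
              subst₂ (λ s t → NormalForm (s , s , t)) (sym (zeroʳ _)) (sym (trans (*-comm _ _) (inv-right z≢0))) vertical

  private
    swap-eq : ∀ x y → (1F *F y) -F (x *F 1F) ≡ 0F → x ≡ y
    swap-eq x y = solve 2 (λ x y → x ≔ y by (:- 𝟙 , (𝟙 :* y :- x :* 𝟙 ≔ 𝟘)) ∷ []) refl x y

    swap-eq′ : ∀ x y → (x *F 1F) -F (1F *F y) ≡ 0F → x ≡ y
    swap-eq′ x y = solve 2 (λ x y → x ≔ y by (𝟙 , (x :* 𝟙 :- 𝟙 :* y ≔ 𝟘)) ∷ []) refl x y

    absurd₁ : ∀ x → (1F *F 1F) -F (x *F 0F) ≢ 0F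
    absurd₁ x e = 0≢1 (solve 1 (λ x → 𝟘 ≔ 𝟙 by (:- 𝟙 , (𝟙 :* 𝟙 :- x :* 𝟘 ≔ 𝟘)) ∷ []) refl x e)

    absurd₂ : ∀ x → (x *F 0F) -F (1F *F 1F) ≢ 0F
    absurd₂ x e = 0≢1 (solve 1 (λ x → 𝟘 ≔ 𝟙 by (𝟙 , (x :* 𝟘 :- 𝟙 :* 𝟙 ≔ 𝟘)) ∷ []) refl x e)

    absurd₃ : ∀ x → (0F *F x) -F (1F *F 1F) ≢ 0F
    absurd₃ x e = 0≢1 (solve 1 (λ x → 𝟘 ≔ 𝟙 by (𝟙 , (𝟘 :* x :- 𝟙 :* 𝟙 ≔ 𝟘)) ∷ []) refl x e)

    absurd₄ : ∀ x → (1F *F 1F) -F (0F *F x) ≢ 0F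
    absurd₄ x e = 0≢1 (solve 1 (λ x → 𝟘 ≔ 𝟙 by (:- 𝟙 , (𝟙 :* 𝟙 :- 𝟘 :* x ≔ 𝟘)) ∷ []) refl x e)

  -- A vanishing cross product stands for equality of projective points. Leading ones in different
  -- positions make some component 1 or -1; in equal positions the components compare the remaining
  -- coordinates.
  normalForm-unique : ∀ {a b} → NormalForm a → NormalForm b → a ⨯ b ≡ 0V → a ≡ b
  normalForm-unique (affine y z) (affine y′ z′) e =
    ≡V refl (swap-eq y y′ (cong (λ v → proj₂ (proj₂ v)) e)) (swap-eq′ z z′ (cong (λ v → proj₁ (proj₂ v)) e))
  normalForm-unique (affine y z) (infinite z′) e = contradiction (cong (λ v → proj₂ (proj₂ v)) e) (absurd₁ y)
  normalForm-unique (affine y z) vertical      e = contradiction (cong (λ v → proj₁ (proj₂ v)) e) (absurd₂ z)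
  normalForm-unique (infinite z) (affine y′ z′) e = contradiction (cong (λ v → proj₂ (proj₂ v)) e) (absurd₃ y′)
  normalForm-unique (infinite z) (infinite z′) e = ≡V refl refl (sym (swap-eq′ z′ z (trans (cong₂ (λ s t → s -F t) (*-comm _ _) (*-comm _ _)) (cong proj₁ e))))
  normalForm-unique (infinite z) vertical      e = contradiction (cong proj₁ e) (absurd₁ z)
  normalForm-unique vertical (affine y′ z′) e = contradiction (cong (λ v → proj₁ (proj₂ v)) e) (absurd₄ z′)
  normalForm-unique vertical (infinite z′) e = contradiction (cong proj₁ e) (absurd₃ z′)
  normalForm-unique vertical vertical      e = refl

  module _ {A : Set} where
    ∈-filterB⁺ : ∀ (p : A → Bool) {as a} → a ∈ as → p a ≡ true → a ∈ filterB F p as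
    ∈-filterB⁺ p {b ∷ as} (here refl) h rewrite h = here refl
    ∈-filterB⁺ p {b ∷ as} (there i) h with p b
    ... | true  = there (∈-filterB⁺ p i h)
    ... | false = ∈-filterB⁺ p i h

    ∈-filterB⁻ : ∀ (p : A → Bool) as {a} → a ∈ filterB F p as → a ∈ as × p a ≡ true
    ∈-filterB⁻ p (b ∷ as) i with p b in eq
    ∈-filterB⁻ p (b ∷ as) (here refl) | true = here refl , eq
    ∈-filterB⁻ p (b ∷ as) (there i)   | true = there (proj₁ (∈-filterB⁻ p as i)) , proj₂ (∈-filterB⁻ p as i)
    ... | false = there (proj₁ (∈-filterB⁻ p as i)) , proj₂ (∈-filterB⁻ p as i)

    filterB-unique : ∀ (p : A → Bool) {as} → Unique as → Unique (filterB F p as)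
    filterB-unique p [] = []
    filterB-unique p {b ∷ as} (b∉as ∷ u) with p b
    ... | true  = All.tabulate (λ i → All.lookup b∉as (proj₁ (∈-filterB⁻ p as i))) ∷ filterB-unique p u
    ... | false = filterB-unique p u

  -- `key` recovers the index of the block that contains an element, so different blocks are
  -- disjoint.
  concatMap-unique : ∀ {A B : Set} (f : A → List B) (key : B → A) {as} → Unique as → (∀ a → Unique (f a)) →
    (∀ a {b} → b ∈ f a → key b ≡ a) → Unique (concatMap f as)
  concatMap-unique f key {as} u uf hk = concat⁺ (All.map⁺ (All.universal uf as))
    (AllPairs.map⁺ (AllPairs.map (λ a≢a′ {b} (i , j) → a≢a′ (trans (sym (hk _ i)) (hk _ j))) u))

  ∈-concatMap : ∀ {A B : Set} (f : A → List B) {as a b} → a ∈ as → b ∈ f a → b ∈ concatMap f as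
  ∈-concatMap f i j = ∈-concatMap⁺ f (Any.map (λ { refl → j }) i)

  row : Fin q → Fin q → List V
  row x y = concatMap (λ z → (x , y , z) ∷ []) (allFin q)

  slab : Fin q → List V
  slab x = concatMap (row x) (allFin q)

  allTriples-unique : Unique (allTriples q)
  allTriples-unique = concatMap-unique slab proj₁ (allFin⁺ q) slab-unique (λ x i → slab-x x i)
    where
    row-key : ∀ x y {v} → v ∈ row x y → proj₁ v ≡ x × proj₁ (proj₂ v) ≡ y
    row-key x y i with satisfied (∈-concatMap⁻ (λ z → (x , y , z) ∷ []) {xs = allFin q} i)
    ... | z , here refl = refl , refl
    row-unique : ∀ x y → Unique (row x y)
    row-unique x y = concatMap-unique _ (λ v → proj₂ (proj₂ v)) (allFin⁺ q) (λ _ → All.[] ∷ []) (λ { z (here refl) → refl })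
    slab-unique : ∀ x → Unique (slab x)
    slab-unique x = concatMap-unique (row x) (λ v → proj₁ (proj₂ v)) (allFin⁺ q) (row-unique x) (λ y i → proj₂ (row-key x y i))
    slab-x : ∀ x {v} → v ∈ slab x → proj₁ v ≡ x
    slab-x x i with satisfied (∈-concatMap⁻ (row x) {xs = allFin q} i)
    ... | y , j = proj₁ (row-key x y j)

  ∈-allTriples : ∀ v → v ∈ allTriples q
  ∈-allTriples (x , y , z) = ∈-concatMap slab (∈-allFin x) (∈-concatMap (row x) (∈-allFin y)
    (∈-concatMap (λ z → (x , y , z) ∷ []) (∈-allFin z) (here refl)))

  lines : List V
  lines = projPoints F

  lines-unique : Unique lines
  lines-unique = filterB-unique (normalizedB F) allTriples-unique

  ∈-lines : ∀ {v} → NormalForm v → v ∈ lines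
  ∈-lines {v} h = ∈-filterB⁺ (normalizedB F) (∈-allTriples v) (normalForm⁻¹ h)

  lines-normal : ∀ {v} → v ∈ lines → NormalForm v
  lines-normal {v} i = normalForm v (proj₂ (∈-filterB⁻ (normalizedB F) (allTriples q) i))

  -- Joins and pencils

  on? : ∀ L s → Dec (L · s ≡ 0F)
  on? L s = (L · s) ≟ 0F

  det≢0⇒⨯≢0 : ∀ {x y} z → det x y z ≢ 0F → x ⨯ y ≢ 0V
  det≢0⇒⨯≢0 z d e = d (trans (cong (_· z) e) (0· z))

  -- The join is the normal form of `x ⨯ y`, and by `⨯-⨯` every line through both points is
  -- proportional to it.
  join-unique : ∀ x y → x ⨯ y ≢ 0V → count lines (λ L → on? L x ×-dec on? L y) ≡ 1
  join-unique x y ne with normalize (x ⨯ y) ne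
  ... | k , k≢0 , nf = count-unique _≟V_ _ lines-unique (∈-lines nf)
    (trans (·-•ˡ k (x ⨯ y) x) (trans (cong (k *F_) (det-xyx x y)) (zeroʳ k)) ,
     trans (·-•ˡ k (x ⨯ y) y) (trans (cong (k *F_) (det-xyy x y)) (zeroʳ k)))
    (λ {L} i (Lx , Ly) → normalForm-unique (lines-normal i) nf (⨯-⨯ k L x y Lx Ly))

  complete-basis : ∀ x → x ≢ 0V → ∃ λ a → ∃ λ b → det x a b ≢ 0F
  complete-basis (x , y , z) ne with x ≟ 0F | y ≟ 0F | z ≟ 0F
  ... | no x≢0 | _ | _ = (0F , 1F , 0F) , (0F , 0F , 1F) ,
    λ e → x≢0 (trans (solve 3 (λ x y z → x ≔ ((x , y , z) :⨯ (𝟘 , 𝟙 , 𝟘)) :· (𝟘 , 𝟘 , 𝟙) by []) refl x y z) e)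
  ... | yes _ | no y≢0 | _ = (0F , 0F , 1F) , (1F , 0F , 0F) ,
    λ e → y≢0 (trans (solve 3 (λ x y z → y ≔ ((x , y , z) :⨯ (𝟘 , 𝟘 , 𝟙)) :· (𝟙 , 𝟘 , 𝟘) by []) refl x y z) e)
  ... | yes _ | yes _ | no z≢0 = (1F , 0F , 0F) , (0F , 1F , 0F) ,
    λ e → z≢0 (trans (solve 3 (λ x y z → z ≔ ((x , y , z) :⨯ (𝟙 , 𝟘 , 𝟘)) :· (𝟘 , 𝟙 , 𝟘) by []) refl x y z) e)
  ... | yes refl | yes refl | yes refl = contradiction refl ne

  vanishing-on-basis : ∀ L x y z → det x y z ≢ 0F → L · x ≡ 0F → L · y ≡ 0F → L · z ≡ 0F → L ≡ 0V
  vanishing-on-basis L@(a , b , c) x y z d Lx Ly Lz = ≡V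
    (trans (solve 3 (λ a b c → a ≔ (a , b , c) :· (𝟙 , 𝟘 , 𝟘) by []) refl a b c) (vanish (1F , 0F , 0F)))
    (trans (solve 3 (λ a b c → b ≔ (a , b , c) :· (𝟘 , 𝟙 , 𝟘) by []) refl a b c) (vanish (0F , 1F , 0F)))
    (trans (solve 3 (λ a b c → c ≔ (a , b , c) :· (𝟘 , 𝟘 , 𝟙) by []) refl a b c) (vanish (0F , 0F , 1F)))
    where
    vanish : ∀ s → L · s ≡ 0F
    vanish s = cancelˡ d (trans (cramer L x y z s)
      (solve 6 (λ p q r a b c → (p :* a) :+ ((q :* b) :+ (r :* c)) ≔ 𝟘 by (a , (p ≔ 𝟘)) ∷ (b , (q ≔ 𝟘)) ∷ (c , (r ≔ 𝟘)) ∷ [])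
        refl (L · x) (L · y) (L · z) _ _ _ Lx Ly Lz))

  -- A line through x meets a line missing x, here the line spanned by a and b, in exactly one point.
  pencil-size : ∀ x → x ≢ 0V → count lines (λ L → on? L x) ≡ suc q
  pencil-size x x≢0 with complete-basis x x≢0
  ... | a , b , d = begin
    ∑ lines (λ L → 𝟏 (on? L x))
      ≡⟨ ∑-cong lines (λ {L} i → meets L i) ⟩
    ∑ lines (λ L → 𝟏 (on? L x ×-dec on? L b) ℕ.+ ∑ (allFin q) (λ ρ → 𝟏 (on? L x ×-dec on? L (a +V ρ • b))))
      ≡⟨ ∑-+ lines _ _ ⟩
    count lines (λ L → on? L x ×-dec on? L b) ℕ.+ ∑ lines (λ L → ∑ (allFin q) (λ ρ → 𝟏 (on? L x ×-dec on? L (a +V ρ • b))))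
      ≡⟨ cong₂ ℕ._+_ (join-unique x b x⨯b≢0) (∑-swap lines (allFin q) _) ⟩
    1 ℕ.+ ∑ (allFin q) (λ ρ → count lines (λ L → on? L x ×-dec on? L (a +V ρ • b)))
      ≡⟨ cong suc (∑-cong (allFin q) (λ {ρ} _ → join-unique x (a +V ρ • b) (x⨯aρb≢0 ρ))) ⟩
    1 ℕ.+ ∑ (allFin q) (λ _ → 1)
      ≡⟨ cong suc (trans (∑-const (allFin q) 1) (trans (ℕ.*-identityʳ _) (length-tabulate {n = q} (λ ρ → ρ)))) ⟩
    suc q ∎
    where
    open ≡-Reasoning
    x⨯b≢0 : x ⨯ b ≢ 0V
    x⨯b≢0 = det≢0⇒⨯≢0 a (λ e → d (trans (det-swap x b a) (trans (cong -F_ e) -0#≈0#)))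
    x⨯aρb≢0 : ∀ ρ → x ⨯ (a +V ρ • b) ≢ 0V
    x⨯aρb≢0 ρ = det≢0⇒⨯≢0 b (λ e → d (trans (sym (shear x a b)) e))
      where
      shear : ∀ x a b → det x (a +V ρ • b) b ≡ det x a b
      shear (a , b , c) (d , e , f) (g , h , i) = solve 10 (λ a b c d e f g h i r →
        ((a , b , c) :⨯ (d :+ r :* g , e :+ r :* h , f :+ r :* i)) :· (g , h , i) ≔ ((a , b , c) :⨯ (d , e , f)) :· (g , h , i) by [])
        refl a b c d e f g h i ρ
    at : ∀ L ρ → L · (a +V ρ • b) ≡ (L · a) +F (ρ *F (L · b))
    at L ρ = trans (·-+ʳ L a (ρ • b)) (cong ((L · a) +F_) (·-•ʳ ρ L b))
    meets : ∀ L → L ∈ lines → 𝟏 (on? L x) ≡ 𝟏 (on? L x ×-dec on? L b) ℕ.+ ∑ (allFin q) (λ ρ → 𝟏 (on? L x ×-dec on? L (a +V ρ • b)))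
    meets L i = by-cases (on? L x) (on? L b)
      where
      by-cases : Dec (L · x ≡ 0F) → Dec (L · b ≡ 0F) →
        𝟏 (on? L x) ≡ 𝟏 (on? L x ×-dec on? L b) ℕ.+ ∑ (allFin q) (λ ρ → 𝟏 (on? L x ×-dec on? L (a +V ρ • b)))
      by-cases (no ¬x) _ = trans (𝟏-no (on? L x) ¬x) (sym (cong₂ ℕ._+_ (𝟏-no (on? L x ×-dec on? L b) (λ p → ¬x (proj₁ p)))
        (∑-zero (allFin q) (λ {ρ} _ → 𝟏-no (on? L x ×-dec on? L (a +V ρ • b)) (λ p → ¬x (proj₁ p))))))
      -- A line through `x` and `b` meets no `a + ρ b`: it would contain `a` as well and vanish on a
      -- basis.
      by-cases (yes Lx) (yes Lb) = trans (𝟏-yes (on? L x) Lx) (sym (cong₂ ℕ._+_ (𝟏-yes (on? L x ×-dec on? L b) (Lx , Lb))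
        (∑-zero (allFin q) (λ {ρ} _ → 𝟏-no (on? L x ×-dec on? L (a +V ρ • b)) (λ p →
          normalForm-≢0 (lines-normal i) (vanishing-on-basis L x a b d Lx
            (trans (solve 3 (λ a b r → a ≔ a :+ r :* b by (:- r , (b ≔ 𝟘)) ∷ []) refl (L · a) (L · b) ρ Lb)
              (trans (sym (at L ρ)) (proj₂ p))) Lb))))))
      by-cases (yes Lx) (no ¬b) = trans (𝟏-yes (on? L x) Lx) (sym (cong₂ ℕ._+_ (𝟏-no (on? L x ×-dec on? L b) (λ p → ¬b (proj₂ p)))
        (count-unique _≟_ (λ ρ → on? L x ×-dec on? L (a +V ρ • b)) (allFin⁺ q) (∈-allFin (-F ((L · a) *F inv (L · b))))
          (Lx , trans (at L _) (solve 3 (λ a b i → a :+ (:- (a :* i)) :* b ≔ 𝟘 by (:- a , (b :* i ≔ 𝟙)) ∷ []) refl (L · a) (L · b) _ (inv-right ¬b)))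
          (λ {ρ} _ p → solve 4 (λ a b i r → r ≔ :- (a :* i) by (i , (a :+ r :* b ≔ 𝟘)) ∷ (:- r , (b :* i ≔ 𝟙)) ∷ [])
            refl (L · a) (L · b) _ ρ (trans (sym (at L ρ)) (proj₂ p)) (inv-right ¬b)))))

  module _ {A : Set} (n : A → ℕ) where

    all-two : ∀ as → (∀ {a} → a ∈ as → 2 ≤ n a) → ∑ as n ≤ length as ℕ.* 2 → ∀ {a} → a ∈ as → n a ≡ 2
    all-two (b ∷ as) h le = λ { (here refl) → ℕ.≤-antisym head (h (here refl)) ; (there i) → all-two as (λ j → h (there j)) tail i }
      where
      base : length as ℕ.* 2 ≤ ∑ as n
      base = subst (_≤ ∑ as n) (∑-const as 2) (∑-mono as (λ j → h (there j)))
      head : n b ≤ 2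
      head = ℕ.+-cancelʳ-≤ (∑ as n) _ _ (ℕ.≤-trans le (ℕ.+-monoʳ-≤ 2 base))
      tail : ∑ as n ≤ length as ℕ.* 2
      tail = ℕ.+-cancelˡ-≤ 2 _ _ (ℕ.≤-trans (ℕ.+-monoˡ-≤ (∑ as n) (h (here refl))) le)

    one-three : ∀ as → (∀ {a} → a ∈ as → 2 ≤ n a) → ∑ as n ≡ suc (length as ℕ.* 2) →
      ∃ λ c → c ∈ as × n c ≡ 3 × (∀ {a} → a ∈ as → a ≢ c → n a ≡ 2)
    one-three (b ∷ as) h e with n b ℕ.≟ 2
    ... | yes nb with one-three as (λ j → h (there j)) (ℕ.+-cancelˡ-≡ 2 _ _ (trans (cong (ℕ._+ ∑ as n) (sym nb)) e))
    ...   | c , i , nc , rest = c , there i , nc , λ { (here refl) _ → nb ; (there j) ne → rest j ne }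
    one-three (b ∷ as) h e | no ne = b , here refl ,
        ℕ.+-cancelʳ-≡ (length as ℕ.* 2) _ _ (trans (cong (n b ℕ.+_) (sym tail≡)) e) ,
        λ { (here refl) b≢b → contradiction refl b≢b ; (there j) _ → all-two as (λ j → h (there j)) tail j }
      where
      nb≥3 : 3 ≤ n b
      nb≥3 = ℕ.≤∧≢⇒< (h (here refl)) (λ e → ne (sym e))
      tail : ∑ as n ≤ length as ℕ.* 2
      tail = ℕ.+-cancelˡ-≤ 3 _ _ (ℕ.≤-trans (ℕ.+-monoˡ-≤ (∑ as n) nb≥3) (ℕ.≤-reflexive e))
      tail≡ : ∑ as n ≡ length as ℕ.* 2
      tail≡ = ℕ.≤-antisym tail (subst (_≤ ∑ as n) (∑-const as 2) (∑-mono as (λ j → h (there j))))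

  ∑-filter : ∀ {A : Set} {P : A → Set} (P? : ∀ a → Dec (P a)) as f → ∑ (filter P? as) f ≡ ∑ as (λ a → 𝟏 (P? a) ℕ.* f a)
  ∑-filter P? []       f = refl
  ∑-filter P? (a ∷ as) f with P? a
  ... | yes _ = cong₂ ℕ._+_ (sym (ℕ.+-identityʳ (f a))) (∑-filter P? as f)
  ... | no _  = ∑-filter P? as f

  𝟏-× : ∀ {P Q : Set} (p : Dec P) (r : Dec Q) → 𝟏 p ℕ.* 𝟏 r ≡ 𝟏 (p ×-dec r)
  𝟏-× (yes _) (yes _) = refl
  𝟏-× (yes _) (no _)  = refl
  𝟏-× (no _)  r       = refl

  countB≡count : ∀ {A : Set} (p : A → Bool) as {P : A → Set} (P? : ∀ a → Dec (P a)) → (∀ a → p a ≡ true → P a) → (∀ a → P a → p a ≡ true) →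
    countB F p as ≡ count as P?
  countB≡count p [] P? h₁ h₂ = refl
  countB≡count p (a ∷ as) P? h₁ h₂ with p a in eq | P? a
  ... | true  | yes _ = cong suc (countB≡count p as P? h₁ h₂)
  ... | true  | no ¬P = contradiction (h₁ a eq) ¬P
  ... | false | no _  = countB≡count p as P? h₁ h₂
  ... | false | yes P with trans (sym eq) (h₂ a P)
  ...   | ()

  -- The algebra of chords

  module Chords (2≢0 : 1F +F 1F ≢ 0F) where

    open Forms _+F_ _*F_ (λ a → -F a) 1F public

    -- The signs `+ − − +` isolate the part of the four relations that is odd in both `τ` and `θ`.
    mixed-zero : ∀ φ μ κ τ ψ ν l θ → φ ≢ ψ → τ ≢ 0F → θ ≢ 0F →
      conjpp φ μ κ τ ψ ν l θ ≡ 0F → conjpm φ μ κ τ ψ ν l θ ≡ 0F →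
      conjmp φ μ κ τ ψ ν l θ ≡ 0F → conjmm φ μ κ τ ψ ν l θ ≡ 0F → mixed φ μ κ ψ ν l ≡ 0F
    mixed-zero φ μ κ τ ψ ν l θ φ≢ψ τ≢0 θ≢0 h₁ h₂ h₃ h₄ =
      cancelˡ (*-nonzero (*-nonzero (*-nonzero (*-nonzero (*-nonzero 2≢0 2≢0) 2≢0) τ≢0) θ≢0) (x≢y⇒x-y≢0 φ≢ψ))
        (solve 8 (λ φ μ κ τ ψ ν l θ →
          E.two :* E.two :* E.two :* τ :* θ :* (φ :- ψ) :* E.mixed φ μ κ ψ ν l ≔ 𝟘
          by (𝟙 , (E.conjpp φ μ κ τ ψ ν l θ ≔ 𝟘)) ∷ (:- 𝟙 , (E.conjpm φ μ κ τ ψ ν l θ ≔ 𝟘))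
           ∷ (:- 𝟙 , (E.conjmp φ μ κ τ ψ ν l θ ≔ 𝟘)) ∷ (𝟙 , (E.conjmm φ μ κ τ ψ ν l θ ≔ 𝟘)) ∷ [])
          refl φ μ κ τ ψ ν l θ h₁ h₂ h₃ h₄)

    -- `θ (pp + pm − mp − mm)` is `4τθ` times the coefficient of `τ`, and `τ (pp − pm + mp − mm)` is
    -- `4τθ` times that of `θ`. The certificate adds the two.
    sumRel-zero : ∀ a b c φ τ ψ θ → φ ≢ ψ → τ ≢ 0F → θ ≢ 0F →
      let μ = midp a b φ ; κ = mids b c φ ; ν = midp a b ψ ; l = mids b c ψ in
      conjpp φ μ κ τ ψ ν l θ ≡ 0F → conjpm φ μ κ τ ψ ν l θ ≡ 0F →
      conjmp φ μ κ τ ψ ν l θ ≡ 0F → conjmm φ μ κ τ ψ ν l θ ≡ 0F → sumRel a b c φ ψ (τ *F τ) (θ *F θ) ≡ 0F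
    sumRel-zero a b c φ τ ψ θ φ≢ψ τ≢0 θ≢0 h₁ h₂ h₃ h₄ =
      cancelˡ (*-nonzero (*-nonzero (*-nonzero (*-nonzero 2≢0 2≢0) τ≢0) θ≢0) (*-nonzero (x≢y⇒x-y≢0 φ≢ψ) (x≢y⇒x-y≢0 φ≢ψ)))
        (solve 7 (λ a b c φ τ ψ θ → let μ = E.midp a b φ ; κ = E.mids b c φ ; ν = E.midp a b ψ ; l = E.mids b c ψ in
          E.two :* E.two :* τ :* θ :* ((φ :- ψ) :* (φ :- ψ)) :* E.sumRel a b c φ ψ (τ :* τ) (θ :* θ) ≔ 𝟘
          by (θ :+ τ , (E.conjpp φ μ κ τ ψ ν l θ ≔ 𝟘)) ∷ (θ :- τ , (E.conjpm φ μ κ τ ψ ν l θ ≔ 𝟘))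
           ∷ (τ :- θ , (E.conjmp φ μ κ τ ψ ν l θ ≔ 𝟘)) ∷ (:- (θ :+ τ) , (E.conjmm φ μ κ τ ψ ν l θ ≔ 𝟘)) ∷ [])
          refl a b c φ τ ψ θ h₁ h₂ h₃ h₄)

    -- The same extraction as in `sumRel-zero` with `b ≡ 0F`, but weighting the coefficient of `τ`
    -- by `ψ` and that of `θ` by `φ`. With these weights the cross terms disappear and each chord
    -- contributes `φ (τ² − ac)` of its own.
    sum-zero : ∀ a c φ τ ψ θ → φ ≢ ψ → τ ≢ 0F → θ ≢ 0F →
      let μ = midp a 0F φ ; κ = mids 0F c φ ; ν = midp a 0F ψ ; l = mids 0F c ψ in
      conjpp φ μ κ τ ψ ν l θ ≡ 0F → conjpm φ μ κ τ ψ ν l θ ≡ 0F →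
      conjmp φ μ κ τ ψ ν l θ ≡ 0F → conjmm φ μ κ τ ψ ν l θ ≡ 0F →
      (φ *F (sq τ -F (a *F c))) +F (ψ *F (sq θ -F (a *F c))) ≡ 0F
    sum-zero a c φ τ ψ θ φ≢ψ τ≢0 θ≢0 h₁ h₂ h₃ h₄ =
      cancelˡ (*-nonzero (*-nonzero (*-nonzero (*-nonzero (*-nonzero 2≢0 2≢0) 2≢0) τ≢0) θ≢0) (*-nonzero (x≢y⇒x-y≢0 φ≢ψ) (x≢y⇒x-y≢0 φ≢ψ)))
        (solve 6 (λ a c φ τ ψ θ → let μ = E.midp a 𝟘 φ ; κ = E.mids 𝟘 c φ ; ν = E.midp a 𝟘 ψ ; l = E.mids 𝟘 c ψ in
          E.two :* E.two :* E.two :* τ :* θ :* ((φ :- ψ) :* (φ :- ψ)) :* (φ :* (E.sq τ :- a :* c) :+ ψ :* (E.sq θ :- a :* c)) ≔ 𝟘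
          by (ψ :* θ :+ φ :* τ , (E.conjpp φ μ κ τ ψ ν l θ ≔ 𝟘)) ∷ (ψ :* θ :- φ :* τ , (E.conjpm φ μ κ τ ψ ν l θ ≔ 𝟘))
           ∷ (φ :* τ :- ψ :* θ , (E.conjmp φ μ κ τ ψ ν l θ ≔ 𝟘)) ∷ (:- (ψ :* θ :+ φ :* τ) , (E.conjmm φ μ κ τ ψ ν l θ ≔ 𝟘)) ∷ [])
          refl a c φ τ ψ θ h₁ h₂ h₃ h₄)

    -- In the alternating sum every `ownTerm` occurs with both signs, so the unknown squares `w`
    -- drop out.
    quad-zero : ∀ a b c f₁ f₂ f₃ f₄ w₁ w₂ w₃ w₄ → f₁ ≢ f₂ → f₃ ≢ f₄ →
      sumRel a b c f₁ f₃ w₁ w₃ ≡ 0F → sumRel a b c f₁ f₄ w₁ w₄ ≡ 0F →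
      sumRel a b c f₂ f₃ w₂ w₃ ≡ 0F → sumRel a b c f₂ f₄ w₂ w₄ ≡ 0F → quad a b c f₁ f₂ f₃ f₄ ≡ 0F
    quad-zero a b c f₁ f₂ f₃ f₄ w₁ w₂ w₃ w₄ f₁≢f₂ f₃≢f₄ h₁ h₂ h₃ h₄ =
      cancelˡ (*-nonzero (*-nonzero 2≢0 (x≢y⇒x-y≢0 f₁≢f₂)) (x≢y⇒x-y≢0 f₃≢f₄))
        (solve 11 (λ a b c f₁ f₂ f₃ f₄ w₁ w₂ w₃ w₄ →
          E.two :* (f₁ :- f₂) :* (f₃ :- f₄) :* E.quad a b c f₁ f₂ f₃ f₄ ≔ 𝟘
          by (𝟙 , (E.sumRel a b c f₁ f₃ w₁ w₃ ≔ 𝟘)) ∷ (:- 𝟙 , (E.sumRel a b c f₁ f₄ w₁ w₄ ≔ 𝟘))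
           ∷ (:- 𝟙 , (E.sumRel a b c f₂ f₃ w₂ w₃ ≔ 𝟘)) ∷ (𝟙 , (E.sumRel a b c f₂ f₄ w₂ w₄ ≔ 𝟘)) ∷ [])
          refl a b c f₁ f₂ f₃ f₄ w₁ w₂ w₃ w₄ h₁ h₂ h₃ h₄)

    -- The chord with ends (μ ± τ , κ ± φτ); neither end is on the line p = s, the tangent at x.
    record Chord : Set where
      field
        φ μ κ τ : Fin q
        τ≢0     : τ ≢ 0F
        off₊    : (μ +F τ) -F (κ +F (φ *F τ)) ≢ 0F
        off₋    : (μ -F τ) -F (κ -F (φ *F τ)) ≢ 0F
    open Chord

    -- `apart` keeps one end of `c` off the line that carries `d`. For equal slopes the four
    -- relations contain the offset between the two carrying lines as a factor, which must be
    -- cancelled.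
    record Conjugate (c d : Chord) : Set where
      field
        pp≡0 : conjpp (φ c) (μ c) (κ c) (τ c) (φ d) (μ d) (κ d) (τ d) ≡ 0F
        pm≡0 : conjpm (φ c) (μ c) (κ c) (τ c) (φ d) (μ d) (κ d) (τ d) ≡ 0F
        mp≡0 : conjmp (φ c) (μ c) (κ c) (τ c) (φ d) (μ d) (κ d) (τ d) ≡ 0F
        mm≡0 : conjmm (φ c) (μ c) (κ c) (τ c) (φ d) (μ d) (κ d) (τ d) ≡ 0F
        apart : ((κ c +F (φ c *F τ c)) -F (κ d +F (φ d *F τ d))) -F (φ d *F ((μ c +F τ c) -F (μ d +F τ d))) ≢ 0F
    open Conjugate

    -- `pp + pm − mp − mm` keeps the part odd in `τ`; for equal slopes it factors into the offset of
    -- the two lines and a condition on their midpoints.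
    parallel : ∀ φ μ κ τ ν l θ → τ ≢ 0F → (κ -F l) -F (φ *F (μ -F ν)) ≢ 0F →
      conjpp φ μ κ τ φ ν l θ ≡ 0F → conjpm φ μ κ τ φ ν l θ ≡ 0F →
      conjmp φ μ κ τ φ ν l θ ≡ 0F → conjmm φ μ κ τ φ ν l θ ≡ 0F →
      ((sq φ *F κ) -F (φ *F μ)) -F (l -F (φ *F ν)) ≡ 0F
    parallel φ μ κ τ ν l θ τ≢0 k≢0 h₁ h₂ h₃ h₄ =
      cancelˡ (*-nonzero (*-nonzero (*-nonzero (*-nonzero 2≢0 2≢0) 2≢0) τ≢0) k≢0)
        (solve 7 (λ φ μ κ τ ν l θ →
          E.two :* E.two :* E.two :* τ :* ((κ :- l) :- φ :* (μ :- ν)) :* ((E.sq φ :* κ :- φ :* μ) :- (l :- φ :* ν)) ≔ 𝟘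
          by (𝟙 , (E.conjpp φ μ κ τ φ ν l θ ≔ 𝟘)) ∷ (𝟙 , (E.conjpm φ μ κ τ φ ν l θ ≔ 𝟘))
           ∷ (:- 𝟙 , (E.conjmp φ μ κ τ φ ν l θ ≔ 𝟘)) ∷ (:- 𝟙 , (E.conjmm φ μ κ τ φ ν l θ ≔ 𝟘)) ∷ [])
          refl φ μ κ τ ν l θ h₁ h₂ h₃ h₄)

    apart-parallel : ∀ c d → φ c ≡ φ d → Conjugate c d → (κ c -F κ d) -F (φ c *F (μ c -F μ d)) ≢ 0F
    apart-parallel c d φc≡φd cd e = apart cd
      (solve 8 (λ φ μ κ τ ψ ν l θ →
        ((κ :+ φ :* τ) :- (l :+ ψ :* θ)) :- ψ :* ((μ :+ τ) :- (ν :+ θ)) ≔ 𝟘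
        by (μ :- ν :+ τ , (φ ≔ ψ)) ∷ (𝟙 , ((κ :- l) :- φ :* (μ :- ν) ≔ 𝟘)) ∷ [])
        refl (φ c) (μ c) (κ c) (τ c) (φ d) (μ d) (κ d) (τ d) φc≡φd e)

    parallel-chords : ∀ c d → φ c ≡ φ d → Conjugate c d →
      ((sq (φ c) *F κ c) -F (φ c *F μ c)) -F (κ d -F (φ c *F μ d)) ≡ 0F
    parallel-chords c d e cd = parallel (φ c) (μ c) (κ c) (τ c) (μ d) (κ d) (τ d) (τ≢0 c) (apart-parallel c d e cd)
      (at conjpp (pp≡0 cd)) (at conjpm (pm≡0 cd)) (at conjmp (mp≡0 cd)) (at conjmm (mm≡0 cd))
      where
      at : (K : Fin q → Fin q → Fin q → Fin q → Fin q → Fin q → Fin q → Fin q → Fin q) →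
        K (φ c) (μ c) (κ c) (τ c) (φ d) (μ d) (κ d) (τ d) ≡ 0F → K (φ c) (μ c) (κ c) (τ c) (φ c) (μ d) (κ d) (τ d) ≡ 0F
      at K h rewrite e = h

    -- By `parallel-chords` the intercept `l − φν` of a chord parallel to `c` is determined by `c`.
    -- Both `d` and `e` would lie on that line, against `apart`.
    no-three-parallel : ∀ c d e → φ c ≡ φ d → φ c ≡ φ e → Conjugate c d → Conjugate c e → Conjugate d e → ⊥
    no-three-parallel c d e φcd φce cd ce de = apart-parallel d e (trans (sym φcd) φce) de
      (trans (cong (λ x → (κ d -F κ e) -F (x *F (μ d -F μ e))) (sym φcd))
        (solve 7 (λ φ μ κ ν l ν′ l′ → (l :- l′) :- φ :* (ν :- ν′) ≔ 𝟘
          by (:- 𝟙 , (((E.sq φ :* κ :- φ :* μ) :- (l :- φ :* ν)) ≔ 𝟘)) ∷ (𝟙 , (((E.sq φ :* κ :- φ :* μ) :- (l′ :- φ :* ν′)) ≔ 𝟘)) ∷ [])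
          refl (φ c) (μ c) (κ c) (μ d) (κ d) (μ e) (κ e) (parallel-chords c d φcd cd) (parallel-chords c e φce ce)))

    Mixed : Chord → Chord → Set
    Mixed c d = mixed (φ c) (μ c) (κ c) (φ d) (μ d) (κ d) ≡ 0F

    mixed-conjugate : ∀ c d → φ c ≢ φ d → Conjugate c d → Mixed c d
    mixed-conjugate c d ne h = mixed-zero (φ c) (μ c) (κ c) (τ c) (φ d) (μ d) (κ d) (τ d) ne (τ≢0 c) (τ≢0 d)
      (pp≡0 h) (pm≡0 h) (mp≡0 h) (mm≡0 h)

    mixed-refl : ∀ c → Mixed c c
    mixed-refl c = solve 3 (λ φ μ κ → E.mixed φ μ κ φ μ κ ≔ 𝟘 by []) refl (φ c) (μ c) (κ c)

    mixed-sym : ∀ c d → Mixed c d → Mixed d c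
    mixed-sym c d = solve 6 (λ φ μ κ ψ ν l → E.mixed ψ ν l φ μ κ ≔ 𝟘 by (:- 𝟙 , (E.mixed φ μ κ ψ ν l ≔ 𝟘)) ∷ [])
      refl (φ c) (μ c) (κ c) (φ d) (μ d) (κ d)

    InFamily : (a b c : Fin q) → Chord → Set
    InFamily a b c d = μ d ≡ midp a b (φ d) × κ d ≡ mids b c (φ d)

    -- Eliminating the μ's from three mixed relations makes the points (φ , κ) collinear.
    family-κ : ∀ c d e b → φ c ≢ φ d → b *F (φ c -F φ d) ≡ κ d -F κ c → Mixed c d → Mixed c e → Mixed d e →
      κ e ≡ (κ c +F (b *F φ c)) -F (b *F φ e)
    family-κ c d e b ne hb cd ce de = x-y≡0⇒x≡y (cancelˡ (*-nonzero 2≢0 (x≢y⇒x-y≢0 ne))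
      (solve 10 (λ f₁ m₁ k₁ f₂ m₂ k₂ f₃ m₃ k₃ b →
        E.two :* (f₁ :- f₂) :* (k₃ :- ((k₁ :+ b :* f₁) :- b :* f₃)) ≔ 𝟘
        by (:- (f₃), (E.mixed f₁ m₁ k₁ f₂ m₂ k₂ ≔ 𝟘)) ∷ (f₂ , (E.mixed f₁ m₁ k₁ f₃ m₃ k₃ ≔ 𝟘))
         ∷ (:- f₁ , (E.mixed f₂ m₂ k₂ f₃ m₃ k₃ ≔ 𝟘)) ∷ (E.two :* (f₃ :- f₁) , (b :* (f₁ :- f₂) ≔ k₂ :- k₁)) ∷ [])
        refl (φ c) (μ c) (κ c) (φ d) (μ d) (κ d) (φ e) (μ e) (κ e) b cd ce de hb))

    -- Once the `κ`'s are known, `Mixed r e` is a linear equation for `μ e` with leading coefficient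
    -- `φ r`.
    family-μ : ∀ r e a b c → φ r ≢ 0F → κ r ≡ mids b c (φ r) → κ e ≡ mids b c (φ e) →
      μ r ≡ midp a b (φ r) → Mixed r e → μ e ≡ midp a b (φ e)
    family-μ r e a b c r≢0 hr he mr re = x-y≡0⇒x≡y (cancelˡ r≢0
      (solve 9 (λ f₁ m₁ k₁ f₂ m₂ k₂ a b c → f₁ :* (m₂ :- E.midp a b f₂) ≔ 𝟘
        by (𝟙 , (E.mixed f₁ m₁ k₁ f₂ m₂ k₂ ≔ 𝟘)) ∷ (f₂ , (m₁ ≔ E.midp a b f₁))
         ∷ (:- (E.two :- f₁ :* f₂) , (k₁ ≔ E.mids b c f₁)) ∷ (E.two :- f₁ :* f₂ , (k₂ ≔ E.mids b c f₂)) ∷ [])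
        refl (φ r) (μ r) (κ r) (φ e) (μ e) (κ e) a b c re mr hr he))

    family-a : ∀ r b → φ r ≢ 0F → ∃ λ a → μ r ≡ midp a b (φ r)
    family-a r b r≢0 = inv (φ r) *F (μ r -F (((1F +F 1F) *F b) +F (b *F sq (φ r)))) ,
      solve 4 (λ f m b i → m ≔ E.midp (i :* (m :- (E.two :* b :+ b :* E.sq f))) b f
        by (:- (m :- (E.two :* b :+ b :* E.sq f)) , (f :* i ≔ 𝟙)) ∷ []) refl (φ r) (μ r) b (inv (φ r)) (inv-right r≢0)

    -- Two chords of different slope fix `b` and `k` by interpolating `κ` linearly in the slope.
    -- Solving for `a` divides by a slope, so it is read off at whichever of the two has nonzero
    -- slope.
    family : ∀ c d → φ c ≢ φ d → Mixed c d → ∃ λ a → ∃ λ b → ∃ λ k →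
      ∀ e → Mixed c e → Mixed d e → InFamily a b k e
    family c d ne cd = by-cases (φ c ≟ 0F)
      where
      b = (κ d -F κ c) *F inv (φ c -F φ d)
      k = κ c +F (b *F φ c)
      hb : b *F (φ c -F φ d) ≡ κ d -F κ c
      hb = solve 3 (λ x y i → (x :* i) :* y ≔ x by (x , (y :* i ≔ 𝟙)) ∷ []) refl
        (κ d -F κ c) (φ c -F φ d) _ (inv-right (x≢y⇒x-y≢0 ne))
      κ-of : ∀ e → Mixed c e → Mixed d e → κ e ≡ k -F (b *F φ e)
      κ-of e ce de = family-κ c d e b ne hb cd ce de
      with-reference : ∀ r → φ r ≢ 0F → Mixed c r → Mixed d r → (∀ e → Mixed c e → Mixed d e → Mixed r e) →
        ∃ λ a → ∃ λ b → ∃ λ k → ∀ e → Mixed c e → Mixed d e → InFamily a b k e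
      with-reference r r≢0 cr dr re = a , b , k , λ e ce de →
        family-μ r e a b k r≢0 (κ-of r cr dr) (κ-of e ce de) ha (re e ce de) , κ-of e ce de
        where
        a = proj₁ (family-a r b r≢0)
        ha = proj₂ (family-a r b r≢0)
      by-cases : Dec (φ c ≡ 0F) → ∃ λ a → ∃ λ b → ∃ λ k → ∀ e → Mixed c e → Mixed d e → InFamily a b k e
      by-cases (no c≢0)  = with-reference c c≢0 (mixed-refl c) (mixed-sym c d cd) (λ _ ce _ → ce)
      by-cases (yes c≡0) = with-reference d (λ d≡0 → ne (trans c≡0 (sym d≡0))) cd (mixed-refl d) (λ _ _ de → de)

    Generic : Chord → Chord → Set
    Generic c d = Conjugate c d × φ c ≢ φ d

    -- quad is quadratic in its last argument with leading coefficient 2b².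
    leading-zero : ∀ a b c f₁ f₂ f₃ f₄ f₅ f₆ → f₄ ≢ f₅ → f₄ ≢ f₆ → f₅ ≢ f₆ →
      quad a b c f₁ f₂ f₃ f₄ ≡ 0F → quad a b c f₁ f₂ f₃ f₅ ≡ 0F → quad a b c f₁ f₂ f₃ f₆ ≡ 0F → b ≡ 0F
    leading-zero a b c f₁ f₂ f₃ f₄ f₅ f₆ f₄≢f₅ f₄≢f₆ f₅≢f₆ h₄ h₅ h₆ with b ≟ 0F
    ... | yes b≡0 = b≡0
    ... | no b≢0 = cancelˡ (*-nonzero (*-nonzero (*-nonzero (*-nonzero 2≢0 (x≢y⇒x-y≢0 f₄≢f₅)) (x≢y⇒x-y≢0 f₄≢f₆)) (x≢y⇒x-y≢0 f₅≢f₆)) b≢0)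
        (solve 9 (λ a b c f₁ f₂ f₃ f₄ f₅ f₆ →
          E.two :* (f₄ :- f₅) :* (f₄ :- f₆) :* (f₅ :- f₆) :* b :* b ≔ 𝟘
          by (f₅ :- f₆ , (E.quad a b c f₁ f₂ f₃ f₄ ≔ 𝟘)) ∷ (f₆ :- f₄ , (E.quad a b c f₁ f₂ f₃ f₅ ≔ 𝟘))
           ∷ (f₄ :- f₅ , (E.quad a b c f₁ f₂ f₃ f₆ ≔ 𝟘)) ∷ [])
          refl a b c f₁ f₂ f₃ f₄ f₅ f₆ h₄ h₅ h₆)

    rewrite-mids : ∀ {a b k c d} → InFamily a b k c → InFamily a b k d →
      (K : Fin q → Fin q → Fin q → Fin q → Fin q → Fin q → Fin q → Fin q → Fin q) →
      K (φ c) (μ c) (κ c) (τ c) (φ d) (μ d) (κ d) (τ d) ≡ 0F →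
      K (φ c) (midp a b (φ c)) (mids b k (φ c)) (τ c) (φ d) (midp a b (φ d)) (mids b k (φ d)) (τ d) ≡ 0F
    rewrite-mids (e₁ , e₂) (e₃ , e₄) K h rewrite sym e₁ | sym e₂ | sym e₃ | sym e₄ = h

    sumRel-chords : ∀ {a b k} c d → InFamily a b k c → InFamily a b k d → Generic c d →
      sumRel a b k (φ c) (φ d) (sq (τ c)) (sq (τ d)) ≡ 0F
    sumRel-chords {a} {b} {k} c d ic id (h , ne) = sumRel-zero a b k (φ c) (τ c) (φ d) (τ d) ne (τ≢0 c) (τ≢0 d)
      (at conjpp (pp≡0 h)) (at conjpm (pm≡0 h)) (at conjmp (mp≡0 h)) (at conjmm (mm≡0 h))
      where at = rewrite-mids {a} {b} {k} {c} {d} ic id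

    sum-chords : ∀ {a k} c d → InFamily a 0F k c → InFamily a 0F k d → Generic c d →
      (φ c *F (sq (τ c) -F (a *F k))) +F (φ d *F (sq (τ d) -F (a *F k))) ≡ 0F
    sum-chords {a} {k} c d ic id (h , ne) = sum-zero a k (φ c) (τ c) (φ d) (τ d) ne (τ≢0 c) (τ≢0 d)
      (at conjpp (pp≡0 h)) (at conjpm (pm≡0 h)) (at conjmp (mp≡0 h)) (at conjmm (mm≡0 h))
      where at = rewrite-mids {a} {0F} {k} {c} {d} ic id

    τ²≢ak : ∀ c a k → InFamily a 0F k c → a *F (a -F k) ≡ 0F → sq (τ c) -F (a *F k) ≢ 0F
    τ²≢ak c a k (hμ , hκ) ha hτ with a ≟ 0F
    ... | yes a≡0 = *-nonzero (τ≢0 c) (τ≢0 c)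
          (solve 3 (λ a k t → t :* t ≔ 𝟘 by (𝟙 , (E.sq t :- a :* k ≔ 𝟘)) ∷ (k , (a ≔ 𝟘)) ∷ []) refl a k (τ c) hτ a≡0)
    -- Here `μ ≡ aφ` and `κ ≡ k`, so the product of the two offsets from `p = s` is
    -- `(aφ − k)² − τ² (φ − 1)²`. It vanishes when `a ≡ k` and `τ² ≡ ak`.
    ... | no a≢0 = *-nonzero (off₊ c) (off₋ c)
          (solve 6 (λ a k f m l t → ((m :+ t) :- (l :+ f :* t)) :* ((m :- t) :- (l :- f :* t)) ≔ 𝟘
            by ((m :- l) :+ (a :* f :- k) , (m ≔ E.midp a 𝟘 f)) ∷ (:- ((m :- l) :+ (a :* f :- k)) , (l ≔ E.mids 𝟘 k f))
             ∷ (:- ((f :- 𝟙) :* (f :- 𝟙)) , (E.sq t :- a :* k ≔ 𝟘)) ∷ (a :* f :* f :- k , (a :- k ≔ 𝟘)) ∷ [])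
            refl a k (φ c) (μ c) (κ c) (τ c) hμ hκ hτ (cancelˡ a≢0 ha))

    pairwise-sums-zero : ∀ x y z → x +F y ≡ 0F → x +F z ≡ 0F → y +F z ≡ 0F → x ≡ 0F
    pairwise-sums-zero x y z xy xz yz = cancelˡ 2≢0
      (solve 3 (λ x y z → E.two :* x ≔ 𝟘 by (𝟙 , (x :+ y ≔ 𝟘)) ∷ (𝟙 , (x :+ z ≔ 𝟘)) ∷ (:- 𝟙 , (y :+ z ≔ 𝟘)) ∷ []) refl x y z xy xz yz)

    -- The three numbers `φ (τ² − ak)` have pairwise sums zero, so all are zero as 2 is invertible.
    -- At most one slope is zero, and a chord with nonzero slope then violates `τ²≢ak`.
    no-three-centred : ∀ a k c d e → InFamily a 0F k c → InFamily a 0F k d → InFamily a 0F k e →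
      a *F (a -F k) ≡ 0F → Generic c d → Generic c e → Generic d e → ⊥
    no-three-centred a k c d e ic id ie ha cd ce de with φ c ≟ 0F
    ... | no c≢0 = τ²≢ak c a k ic ha (cancelˡ c≢0 (pairwise-sums-zero _ _ _ scd sce sde))
      where
      scd = sum-chords {a} {k} c d ic id cd
      sce = sum-chords {a} {k} c e ic ie ce
      sde = sum-chords {a} {k} d e id ie de
    ... | yes c≡0 = τ²≢ak d a k id ha (cancelˡ (λ d≡0 → proj₂ cd (trans c≡0 (sym d≡0)))
        (pairwise-sums-zero _ _ _ (trans (+-comm _ _) scd) sde sce))
      where
      scd = sum-chords {a} {k} c d ic id cd
      sce = sum-chords {a} {k} c e ic ie ce
      sde = sum-chords {a} {k} d e id ie de

    generic⇒mixed : ∀ c d → Generic c d → Mixed c d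
    generic⇒mixed c d (h , ne) = mixed-conjugate c d ne h

    quad-chords : ∀ a b k c₁ c₂ c₃ c → InFamily a b k c₁ → InFamily a b k c₂ → InFamily a b k c₃ → InFamily a b k c →
      Generic c₁ c₂ → Generic c₁ c₃ → Generic c₂ c₃ → Generic c₁ c → Generic c₂ c → Generic c₃ c →
      quad a b k (φ c₁) (φ c₂) (φ c₃) (φ c) ≡ 0F
    quad-chords a b k c₁ c₂ c₃ c i₁ i₂ i₃ i g₁₂ g₁₃ g₂₃ g₁ g₂ g₃ =
      quad-zero a b k (φ c₁) (φ c₂) (φ c₃) (φ c) (sq (τ c₁)) (sq (τ c₂)) (sq (τ c₃)) (sq (τ c)) (proj₂ g₁₂) (proj₂ g₃)
        (sumRel-chords {a} {b} {k} c₁ c₃ i₁ i₃ g₁₃) (sumRel-chords {a} {b} {k} c₁ c i₁ i g₁)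
        (sumRel-chords {a} {b} {k} c₂ c₃ i₂ i₃ g₂₃) (sumRel-chords {a} {b} {k} c₂ c i₂ i g₂)

    -- With `b ≡ 0F` all terms of `quad` that involve the slopes disappear.
    quad-centred : ∀ a b k f₁ f₂ f₃ f₄ → b ≡ 0F → quad a b k f₁ f₂ f₃ f₄ ≡ 0F → a *F (a -F k) ≡ 0F
    quad-centred = solve 7 (λ a b k f₁ f₂ f₃ f₄ → a :* (a :- k) ≔ 𝟘
      by (:- (E.two :* b :* ((E.sq f₁ :+ f₁ :* f₂ :+ E.sq f₂) :+ (E.sq f₃ :+ f₃ :* f₄ :+ E.sq f₄))
          :+ (E.two :* E.two :+ 𝟙) :* b :* (f₁ :+ f₂) :* (f₃ :+ f₄)
          :+ ((E.two :+ 𝟙) :* a :- k) :* (f₁ :+ f₂ :+ f₃ :+ f₄)) , (b ≔ 𝟘))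
       ∷ (𝟙 , (E.quad a b k f₁ f₂ f₃ f₄ ≔ 𝟘)) ∷ []) refl

    -- `c₁` and `c₂` define the family and fill the first two places of `quad`, `c₃` fills the
    -- third, and `c₄`, `c₅`, `c₆` give the three values of the last argument that kill its leading
    -- coefficient.
    no-six : ∀ cs → length cs ≡ 6 → AllPairs Generic cs → ⊥
    no-six (c₁ ∷ c₂ ∷ c₃ ∷ c₄ ∷ c₅ ∷ c₆ ∷ []) refl
      ((g₁₂ ∷ g₁₃ ∷ g₁₄ ∷ g₁₅ ∷ g₁₆ ∷ []) ∷ (g₂₃ ∷ g₂₄ ∷ g₂₅ ∷ g₂₆ ∷ []) ∷ (g₃₄ ∷ g₃₅ ∷ g₃₆ ∷ []) ∷
       (g₄₅ ∷ g₄₆ ∷ []) ∷ (g₅₆ ∷ []) ∷ [] ∷ [])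
      = within (family c₁ c₂ (proj₂ g₁₂) (generic⇒mixed c₁ c₂ g₁₂))
      where
      within : (∃ λ a → ∃ λ b → ∃ λ k → ∀ e → Mixed c₁ e → Mixed c₂ e → InFamily a b k e) → ⊥
      within (a , b , k , member) =
        no-three-centred a k c₁ c₂ c₃ (centred c₁ i₁) (centred c₂ i₂) (centred c₃ i₃)
          (quad-centred a b k (φ c₁) (φ c₂) (φ c₃) (φ c₄) b≡0 (quad≡0 c₄ g₁₄ g₂₄ g₃₄)) g₁₂ g₁₃ g₂₃
        where
        i₁ : InFamily a b k c₁
        i₁ = member c₁ (mixed-refl c₁) (mixed-sym c₁ c₂ (generic⇒mixed c₁ c₂ g₁₂))
        i₂ : InFamily a b k c₂
        i₂ = member c₂ (generic⇒mixed c₁ c₂ g₁₂) (mixed-refl c₂)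
        in-family : ∀ c → Generic c₁ c → Generic c₂ c → InFamily a b k c
        in-family c h₁ h₂ = member c (generic⇒mixed c₁ c h₁) (generic⇒mixed c₂ c h₂)
        i₃ : InFamily a b k c₃
        i₃ = in-family c₃ g₁₃ g₂₃
        quad≡0 : ∀ c → Generic c₁ c → Generic c₂ c → Generic c₃ c → quad a b k (φ c₁) (φ c₂) (φ c₃) (φ c) ≡ 0F
        quad≡0 c h₁ h₂ h₃ = quad-chords a b k c₁ c₂ c₃ c i₁ i₂ i₃ (in-family c h₁ h₂) g₁₂ g₁₃ g₂₃ h₁ h₂ h₃
        b≡0 : b ≡ 0F
        b≡0 = leading-zero a b k (φ c₁) (φ c₂) (φ c₃) (φ c₄) (φ c₅) (φ c₆) (proj₂ g₄₅) (proj₂ g₄₆) (proj₂ g₅₆)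
          (quad≡0 c₄ g₁₄ g₂₄ g₃₄) (quad≡0 c₅ g₁₅ g₂₅ g₃₅) (quad≡0 c₆ g₁₆ g₂₆ g₃₆)
        centred : ∀ c → InFamily a b k c → InFamily a 0F k c
        centred c = subst (λ x → InFamily a x k c) b≡0

module Points {q : ℕ} (F : FiniteField q) (odd : q % 2 ≡ 1)
  (S : List (Triple q)) (normal : All (Normalized F) S) (unique : Unique S) (size : length S ≡ q + 2) where

  open FiniteField F
  open IsCommutativeRing isCommutativeRing using (*-comm; *-identityˡ; *-identityʳ; zeroˡ; zeroʳ; -‿inverseʳ)
  open Plane F

  -- Tangents and trisecants

  n : V → ℕ
  n L = count S (on? L)

  normal-S : ∀ {s} → s ∈ S → NormalForm s
  normal-S i = normalForm _ (All.lookup normal i)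

  distinct⇒⨯≢0 : ∀ {x y} → x ∈ S → y ∈ S → x ≢ y → x ⨯ y ≢ 0V
  distinct⇒⨯≢0 i j x≢y e = x≢y (normalForm-unique (normal-S i) (normal-S j) e)

  n-cong : ∀ L M → (∀ {s} → s ∈ S → L · s ≡ 0F → M · s ≡ 0F) → (∀ {s} → s ∈ S → M · s ≡ 0F → L · s ≡ 0F) → n L ≡ n M
  n-cong L M f g = ∑-cong S (λ {s} i → same s i)
    where
    same : ∀ s → s ∈ S → 𝟏 (on? L s) ≡ 𝟏 (on? M s)
    same s i with on? L s | on? M s
    ... | yes _ | yes _ = refl
    ... | no _  | no _  = refl
    ... | yes p | no ¬p = contradiction (f i p) ¬p
    ... | no ¬p | yes p = contradiction (g i p) ¬p

  n-• : ∀ k L → k ≢ 0F → n (k • L) ≡ n L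
  n-• k L k≢0 = n-cong (k • L) L (λ {s} _ e → cancelˡ k≢0 (trans (sym (·-•ˡ k L s)) e))
    (λ {s} _ e → trans (·-•ˡ k L s) (trans (cong (k *F_) e) (zeroʳ k)))

  pencil : V → List V
  pencil x = filter (λ L → on? L x) lines

  pencil-unique : ∀ x → Unique (pencil x)
  pencil-unique x = filter⁺ (λ L → on? L x) lines-unique

  ∈-pencil : ∀ {x L} → L ∈ lines → L · x ≡ 0F → L ∈ pencil x
  ∈-pencil {x} i e = ∈-filter⁺ (λ L → on? L x) i e

  pencil-on : ∀ {x L} → L ∈ pencil x → L ∈ lines × L · x ≡ 0F
  pencil-on {x} i = ∈-filter⁻ (λ L → on? L x) {xs = lines} i

  pencil-length : ∀ {x} → x ∈ S → length (pencil x) ≡ suc q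
  pencil-length {x} i = begin
    length (pencil x)                                 ≡⟨ sym (ℕ.*-identityʳ _) ⟩
    length (pencil x) ℕ.* 1                           ≡⟨ sym (∑-const (pencil x) 1) ⟩
    ∑ (pencil x) (λ _ → 1)                            ≡⟨ ∑-filter (λ L → on? L x) lines (λ _ → 1) ⟩
    ∑ lines (λ L → 𝟏 (on? L x) ℕ.* 1)                 ≡⟨ ∑-cong lines (λ _ → ℕ.*-identityʳ _) ⟩
    count lines (λ L → on? L x)                       ≡⟨ pencil-size x (normalForm-≢0 (normal-S i)) ⟩
    suc q ∎
    where open ≡-Reasoning

  -- Counting incidences by points: each of the `q + 1` points other than `x` is on one line of the
  -- pencil, and `x` is on all `q + 1`.
  pencil-sum : ∀ {x} → x ∈ S → ∑ (pencil x) n ≡ length (pencil x) ℕ.* 2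
  pencil-sum {x} i = begin
    ∑ (pencil x) n
      ≡⟨ ∑-filter (λ L → on? L x) lines n ⟩
    ∑ lines (λ L → 𝟏 (on? L x) ℕ.* n L)
      ≡⟨ ∑-cong lines (λ {L} _ → trans (sym (∑-*ˡ S (𝟏 (on? L x)) (λ s → 𝟏 (on? L s)))) (∑-cong S (λ {s} _ → 𝟏-× (on? L x) (on? L s)))) ⟩
    ∑ lines (λ L → ∑ S (λ s → 𝟏 (on? L x ×-dec on? L s)))
      ≡⟨ ∑-swap lines S _ ⟩
    ∑ S (λ s → count lines (λ L → on? L x ×-dec on? L s))
      ≡⟨ ∑-cong S (λ {s} j → joins s j) ⟩
    ∑ S (λ s → 1 ℕ.+ q ℕ.* 𝟏 (s ≟V x))
      ≡⟨ trans (∑-+ S _ _) (cong₂ ℕ._+_ (trans (∑-const S 1) (ℕ.*-identityʳ _))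
           (trans (∑-*ˡ S q _) (trans (cong (q ℕ.*_) (count-≡ _≟V_ unique i)) (ℕ.*-identityʳ q)))) ⟩
    length S ℕ.+ q
      ≡⟨ cong (ℕ._+ q) size ⟩
    (q ℕ.+ 2) ℕ.+ q
      ≡⟨ trans (cong (ℕ._+ q) (ℕ.+-comm q 2)) (cong (2 ℕ.+_) (trans (cong (q ℕ.+_) (sym (ℕ.+-identityʳ q))) (ℕ.*-comm 2 q))) ⟩
    suc q ℕ.* 2
      ≡⟨ cong (ℕ._* 2) (sym (pencil-length i)) ⟩
    length (pencil x) ℕ.* 2 ∎
    where
    open ≡-Reasoning
    joins : ∀ s → s ∈ S → count lines (λ L → on? L x ×-dec on? L s) ≡ 1 ℕ.+ q ℕ.* 𝟏 (s ≟V x)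
    joins s j with s ≟V x
    ... | no s≢x = trans (join-unique x s (distinct⇒⨯≢0 i j (≢-sym s≢x))) (cong suc (sym (ℕ.*-zeroʳ q)))
    ... | yes refl = trans (∑-cong lines (λ {L} _ → twice L)) (trans (pencil-size x (normalForm-≢0 (normal-S i))) (cong suc (sym (ℕ.*-identityʳ q))))
      where
      twice : ∀ L → 𝟏 (on? L x ×-dec on? L x) ≡ 𝟏 (on? L x)
      twice L with on? L x
      ... | yes _ = refl
      ... | no _  = refl

  pencil-positive : ∀ {x} → x ∈ S → ∀ {L} → L ∈ pencil x → 1 ≤ n L
  pencil-positive {x} i {L} j = subst (1 ≤_) (sym (count-remove _≟V_ (on? L) unique i (proj₂ (pencil-on j)))) (s≤s z≤n)

  tangents trisecants : V → ℕ
  tangents x   = count (pencil x) (λ L → n L ℕ.≟ 1)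
  trisecants x = count (pencil x) (λ L → n L ℕ.≟ 3)

  trisecants≤tangents : ∀ {x} → x ∈ S → trisecants x ≤ tangents x
  trisecants≤tangents {x} i = ℕ.+-cancelˡ-≤ (length (pencil x) ℕ.* 2) _ _ (begin
    length (pencil x) ℕ.* 2 ℕ.+ trisecants x
      ≡⟨ trans (cong (ℕ._+ trisecants x) (sym (∑-const (pencil x) 2))) (sym (∑-+ (pencil x) _ _)) ⟩
    ∑ (pencil x) (λ L → 2 ℕ.+ 𝟏 (n L ℕ.≟ 3))
      ≤⟨ ∑-mono (pencil x) (λ {L} j → weigh (n L) (pencil-positive i j)) ⟩
    ∑ (pencil x) (λ L → n L ℕ.+ 𝟏 (n L ℕ.≟ 1))
      ≡⟨ ∑-+ (pencil x) _ _ ⟩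
    ∑ (pencil x) n ℕ.+ tangents x
      ≡⟨ cong (ℕ._+ tangents x) (pencil-sum i) ⟩
    length (pencil x) ℕ.* 2 ℕ.+ tangents x ∎)
    where
    open ℕ.≤-Reasoning
    weigh : ∀ m → 1 ≤ m → 2 ℕ.+ 𝟏 (m ℕ.≟ 3) ≤ m ℕ.+ 𝟏 (m ℕ.≟ 1)
    weigh 1 _ = ℕ.≤-refl
    weigh 2 _ = ℕ.≤-refl
    weigh 3 _ = ℕ.≤-refl
    weigh (suc (suc (suc (suc m)))) _ = s≤s (s≤s z≤n)

  -- The condition ranges over all nonzero coordinate vectors, not only normal forms, so that it
  -- applies directly to a join `x ⨯ y` or to a line given by its slope. The same holds for
  -- `otherwise` in `Good`.
  record AllBisecant (x : V) : Set where
    field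
      member   : x ∈ S
      bisecant : ∀ L → L ≢ 0V → L · x ≡ 0F → n L ≡ 2

  record Good (x : V) : Set where
    field
      member    : x ∈ S
      f g       : V
      f-normal  : NormalForm f
      g-normal  : NormalForm g
      f-on      : f · x ≡ 0F
      g-on      : g · x ≡ 0F
      f-three   : n f ≡ 3
      g-one     : n g ≡ 1
      otherwise : ∀ L → L ≢ 0V → L · x ≡ 0F → n L ≡ 2 ⊎ L ⨯ g ≡ 0V ⊎ L ⨯ f ≡ 0V

  •-on : ∀ k L x → L · x ≡ 0F → (k • L) · x ≡ 0F
  •-on k L x e = trans (·-•ˡ k L x) (trans (cong (k *F_) e) (zeroʳ k))

  allBisecant : ∀ {x} → x ∈ S → tangents x ≡ 0 → AllBisecant x
  allBisecant {x} i t≡0 = record { member = i ; bisecant = λ L ne e → bis L (normalize L ne) e }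
    where
    twos : ∀ {L} → L ∈ pencil x → n L ≡ 2
    twos = all-two n (pencil x) (λ {L} j → ℕ.≤∧≢⇒< (pencil-positive i j) (≢-sym (count-none (pencil x) _ t≡0 j)))
      (ℕ.≤-reflexive (pencil-sum i))
    bis : ∀ L → (∃ λ k → k ≢ 0F × NormalForm (k • L)) → L · x ≡ 0F → n L ≡ 2
    bis L (k , k≢0 , nf) e = trans (sym (n-• k L k≢0)) (twos (∈-pencil (∈-lines nf) (•-on k L x e)))

  ⨯-•-cancel : ∀ k L M → k • L ≡ M → L ⨯ M ≡ 0V
  ⨯-•-cancel k (a , b , c) _ refl = ≡V (parallel b c) (parallel c a) (parallel a b)
    where
    parallel : ∀ u v → (u *F (k *F v)) -F (v *F (k *F u)) ≡ 0F
    parallel u v = solve 3 (λ k u v → u :* (k :* v) :- v :* (k :* u) ≔ 𝟘 by []) refl k u v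

  good : ∀ {x} → x ∈ S → tangents x ≡ 1 → Good x
  good {x} i t≡1 = from-tangent (count-∃ (pencil x) (λ L → n L ℕ.≟ 1) (ℕ.≤-reflexive (sym t≡1)))
    where
    from-tangent : (∃ λ g → g ∈ pencil x × n g ≡ 1) → Good x
    from-tangent (g , ig , ng) = from-trisecant (one-three n′ (pencil x) n′≥2 n′-sum)
      where
      -- Raising the tangent's count by one makes every line of the pencil count at least two, with
      -- a total just one above the minimum. The line that carries the excess is the trisecant.
      n′ : V → ℕ
      n′ L = n L ℕ.+ 𝟏 (L ≟V g)
      no-other : count (pencil x) (without? _≟V_ (λ L → n L ℕ.≟ 1) g) ≡ 0
      no-other = ℕ.suc-injective (trans (sym (count-remove _≟V_ (λ L → n L ℕ.≟ 1) (pencil-unique x) ig ng)) t≡1)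
      n′≥2 : ∀ {L} → L ∈ pencil x → 2 ≤ n′ L
      n′≥2 {L} j with L ≟V g
      ... | yes refl rewrite ng = ℕ.≤-refl
      ... | no L≢g = ℕ.≤-trans (ℕ.≤∧≢⇒< (pencil-positive i j) (λ e → count-none (pencil x) (without? _≟V_ (λ L → n L ℕ.≟ 1) g) no-other j (sym e , L≢g)))
                       (ℕ.m≤m+n _ _)
      n′-sum : ∑ (pencil x) n′ ≡ suc (length (pencil x) ℕ.* 2)
      n′-sum = trans (∑-+ (pencil x) _ _) (trans (cong₂ ℕ._+_ (pencil-sum i) (count-≡ _≟V_ (pencil-unique x) ig)) (ℕ.+-comm _ 1))
      n′-other : ∀ {L} → L ≢ g → n′ L ≡ n L
      n′-other {L} ne = trans (cong (n L ℕ.+_) (𝟏-no (L ≟V g) ne)) (ℕ.+-identityʳ _)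
      from-trisecant : (∃ λ f → f ∈ pencil x × n′ f ≡ 3 × (∀ {L} → L ∈ pencil x → L ≢ f → n′ L ≡ 2)) → Good x
      from-trisecant (f , jf , nf , rest) = record
        { member = i ; f = f ; g = g ; f-normal = lines-normal (proj₁ (pencil-on jf)) ; g-normal = lines-normal (proj₁ (pencil-on ig))
        ; f-on = proj₂ (pencil-on jf) ; g-on = proj₂ (pencil-on ig) ; f-three = trans (sym (n′-other f≢g)) nf ; g-one = ng
        ; otherwise = λ L ne e → classify L (normalize L ne) e }
        where
        f≢g : f ≢ g
        f≢g refl with trans (sym nf) (cong₂ ℕ._+_ ng (𝟏-yes (f ≟V f) refl))
        ... | ()
        classify : ∀ L → (∃ λ k → k ≢ 0F × NormalForm (k • L)) → L · x ≡ 0F → n L ≡ 2 ⊎ L ⨯ g ≡ 0V ⊎ L ⨯ f ≡ 0V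
        classify L (k , k≢0 , nrm) e with (k • L) ≟V g | (k • L) ≟V f
        ... | yes p | _ = inj₂ (inj₁ (⨯-•-cancel k L g p))
        ... | no _ | yes p = inj₂ (inj₂ (⨯-•-cancel k L f p))
        ... | no ≢g | no ≢f = inj₁ (trans (sym (n-• k L k≢0)) (trans (sym (n′-other ≢g)) (rest (∈-pencil (∈-lines nrm) (•-on k L x e)) ≢f)))

  -- Segre's product argument

  char≢2 : 1F +F 1F ≢ 0F
  char≢2 = odd⇒2≢0 odd

  -- Junk value: 1 when a or b vanishes.
  quot : Fin q → Fin q → Fin q
  quot a b = select (¬? (a ≟ 0F) ×-dec ¬? (b ≟ 0F)) (a *F inv b)

  quot-nonzero : ∀ {a b} → a ≢ 0F → b ≢ 0F → quot a b ≡ a *F inv b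
  quot-nonzero {a} {b} a≢0 b≢0 = select-yes (¬? (a ≟ 0F) ×-dec ¬? (b ≟ 0F)) (a *F inv b) (a≢0 , b≢0)

  quot-0ˡ : ∀ {a b} → a ≡ 0F → quot a b ≡ 1F
  quot-0ˡ {a} {b} e = select-no (¬? (a ≟ 0F) ×-dec ¬? (b ≟ 0F)) (a *F inv b) (λ p → proj₁ p e)

  quot-0ʳ : ∀ {a b} → b ≡ 0F → quot a b ≡ 1F
  quot-0ʳ {a} {b} e = select-no (¬? (a ≟ 0F) ×-dec ¬? (b ≟ 0F)) (a *F inv b) (λ p → proj₂ p e)

  pow : Fin q → ℕ → Fin q
  pow ρ zero    = 1F
  pow ρ (suc k) = ρ *F pow ρ k

  ∏-pow : ∀ {A : Set} (as : List A) {P : A → Set} (P? : ∀ a → Dec (P a)) ρ → ∏ as (λ a → select (P? a) ρ) ≡ pow ρ (count as P?)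
  ∏-pow []       P? ρ = refl
  ∏-pow (a ∷ as) P? ρ with P? a
  ... | yes _ = cong (ρ *F_) (∏-pow as P? ρ)
  ... | no _  = trans (*-identityˡ _) (∏-pow as P? ρ)

  -- Such an `s` is seen at slope `ρ` from the common point of `u` and `v`: it lies on `u − ρ v` and
  -- on neither of the two lines.
  hit? : ∀ u v ρ s → Dec ((u · s ≢ 0F × v · s ≢ 0F) × u · s ≡ ρ *F (v · s))
  hit? u v ρ s = (¬? (on? u s) ×-dec ¬? (on? v s)) ×-dec ((u · s) ≟ (ρ *F (v · s)))

  hits : V → V → Fin q → ℕ
  hits u v ρ = count S (hit? u v ρ)

  Q : V → V → Fin q
  Q u v = ∏ S (λ s → quot (u · s) (v · s))

  -- Each point off both lines has exactly one slope, so the product can be grouped by slopes.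
  Q-hits : ∀ u v → Q u v ≡ ∏ (allFin q) (λ ρ → pow ρ (hits u v ρ))
  Q-hits u v = begin
    ∏ S (λ s → quot (u · s) (v · s))
      ≡⟨ ∏-cong S (λ {s} _ → spread s (on? u s) (on? v s)) ⟩
    ∏ S (λ s → ∏ (allFin q) (λ ρ → select (hit? u v ρ s) ρ))
      ≡⟨ ∏-swap S (allFin q) _ ⟩
    ∏ (allFin q) (λ ρ → ∏ S (λ s → select (hit? u v ρ s) ρ))
      ≡⟨ ∏-cong (allFin q) (λ {ρ} _ → ∏-pow S (hit? u v ρ) ρ) ⟩
    ∏ (allFin q) (λ ρ → pow ρ (hits u v ρ)) ∎
    where
    open ≡-Reasoning
    spread : ∀ s → Dec (u · s ≡ 0F) → Dec (v · s ≡ 0F) → quot (u · s) (v · s) ≡ ∏ (allFin q) (λ ρ → select (hit? u v ρ s) ρ)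
    spread s (yes u≡0) _ = trans (quot-0ˡ u≡0) (sym (∏-one (allFin q) (λ {ρ} _ → select-no (hit? u v ρ s) ρ (λ p → proj₁ (proj₁ p) u≡0))))
    spread s (no _) (yes v≡0) = trans (quot-0ʳ v≡0) (sym (∏-one (allFin q) (λ {ρ} _ → select-no (hit? u v ρ s) ρ (λ p → proj₂ (proj₁ p) v≡0))))
    spread s (no u≢0) (no v≢0) = trans (quot-nonzero u≢0 v≢0) (sym (trans
      (∏-single {b = r} (allFin⁺ q) (∈-allFin r) (λ {ρ} _ ρ≢r → select-no (hit? u v ρ s) ρ (λ p → ρ≢r
        (solve 4 (λ a b i r → r ≔ a :* i by (:- i , (a ≔ r :* b)) ∷ (:- r , (b :* i ≔ 𝟙)) ∷ []) refl (u · s) (v · s) _ ρ (proj₂ p) (inv-right v≢0)))))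
      (select-yes (hit? u v r s) r ((u≢0 , v≢0) ,
        solve 3 (λ a b i → a ≔ (a :* i) :* b by (:- a , (b :* i ≔ 𝟙)) ∷ []) refl (u · s) (v · s) _ (inv-right v≢0)))))
      where r = (u · s) *F inv (v · s)

  pow-1 : ∀ ρ → pow ρ 1 ≡ ρ
  pow-1 ρ = *-identityʳ ρ

  -- The product of all slopes is that of F*, except that the tangent slope τ is missing and the trisecant slope σ is doubled.
  Q-slopes : ∀ u v τ σ → τ ≢ 0F → σ ≢ 0F →
    (∀ ρ → ρ ≢ 0F → pow ρ (hits u v ρ) *F select (ρ ≟ τ) ρ ≡ ρ *F select (ρ ≟ σ) ρ) → Q u v *F τ ≡ -F σ
  Q-slopes u v τ σ τ≢0 σ≢0 h = begin
    Q u v *F τ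
      ≡⟨ cong₂ _*F_ (Q-hits u v) (sym (∏-select _≟_ (λ ρ → ρ) (allFin⁺ q) (∈-allFin τ))) ⟩
    ∏ (allFin q) (λ ρ → pow ρ (hits u v ρ)) *F ∏ (allFin q) (λ ρ → select (ρ ≟ τ) ρ)
      ≡⟨ sym (∏-* (allFin q) _ _) ⟩
    ∏ (allFin q) (λ ρ → pow ρ (hits u v ρ) *F select (ρ ≟ τ) ρ)
      ≡⟨ ∏-cong (allFin q) (λ {ρ} _ → pointwise ρ (ρ ≟ 0F)) ⟩
    ∏ (allFin q) (λ ρ → nonzeroOr1 ρ *F select (ρ ≟ σ) ρ)
      ≡⟨ ∏-* (allFin q) _ _ ⟩
    ∏ (allFin q) nonzeroOr1 *F ∏ (allFin q) (λ ρ → select (ρ ≟ σ) ρ)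
      ≡⟨ cong₂ _*F_ (wilson char≢2) (∏-select _≟_ (λ ρ → ρ) (allFin⁺ q) (∈-allFin σ)) ⟩
    (-F 1F) *F σ
      ≡⟨ solve 1 (λ s → (:- 𝟙) :* s ≔ :- s by []) refl σ ⟩
    -F σ ∎
    where
    open ≡-Reasoning
    pointwise : ∀ ρ → Dec (ρ ≡ 0F) → pow ρ (hits u v ρ) *F select (ρ ≟ τ) ρ ≡ nonzeroOr1 ρ *F select (ρ ≟ σ) ρ
    pointwise ρ (no ρ≢0) = trans (h ρ ρ≢0) (cong (_*F select (ρ ≟ σ) ρ) (sym (select-yes (¬? (ρ ≟ 0F)) ρ ρ≢0)))
    -- No point counts as a hit at slope zero, since `u · s` would vanish; both sides are therefore
    -- 1.
    pointwise ρ (yes refl) = cong₂ _*F_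
      (trans (cong (pow ρ) (∑-zero S (λ {s} _ → 𝟏-no (hit? u v ρ s) (λ p → proj₁ (proj₁ p) (trans (proj₂ p) (zeroˡ _))))))
        (sym (select-no (¬? (ρ ≟ 0F)) ρ (λ ne → ne refl))))
      (trans (select-no (ρ ≟ τ) ρ (≢-sym τ≢0)) (sym (select-no (ρ ≟ σ) ρ (≢-sym σ≢0))))

  select-≟1 : ∀ ρ → select (ρ ≟ 1F) ρ ≡ 1F
  select-≟1 ρ with ρ ≟ 1F
  ... | yes e = e
  ... | no _  = refl

  collinear-both : ∀ x y z s → det x y z ≢ 0F → det z x s ≡ 0F → det x y s ≡ 0F → s ⨯ x ≡ 0V
  collinear-both (a , b , c) (d , e , f) (g , h , i) (j , k , l) Δ≢0 p r = ≡V
    (cancelˡ Δ≢0 (solve 12 (λ a b c d e f g h i j k l → let x = (a , b , c) ; y = (d , e , f) ; z = (g , h , i) ; s = (j , k , l) in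
      ((x :⨯ y) :· z) :* (k :* c :- l :* b) ≔ 𝟘 by (e :* c :- f :* b , ((z :⨯ x) :· s ≔ 𝟘)) ∷ (h :* c :- i :* b , ((x :⨯ y) :· s ≔ 𝟘)) ∷ [])
      refl a b c d e f g h i j k l p r))
    (cancelˡ Δ≢0 (solve 12 (λ a b c d e f g h i j k l → let x = (a , b , c) ; y = (d , e , f) ; z = (g , h , i) ; s = (j , k , l) in
      ((x :⨯ y) :· z) :* (l :* a :- j :* c) ≔ 𝟘 by (f :* a :- d :* c , ((z :⨯ x) :· s ≔ 𝟘)) ∷ (i :* a :- g :* c , ((x :⨯ y) :· s ≔ 𝟘)) ∷ [])
      refl a b c d e f g h i j k l p r))
    (cancelˡ Δ≢0 (solve 12 (λ a b c d e f g h i j k l → let x = (a , b , c) ; y = (d , e , f) ; z = (g , h , i) ; s = (j , k , l) in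
      ((x :⨯ y) :· z) :* (j :* b :- k :* a) ≔ 𝟘 by (d :* b :- e :* a , ((z :⨯ x) :· s ≔ 𝟘)) ∷ (g :* b :- h :* a , ((x :⨯ y) :· s ≔ 𝟘)) ∷ [])
      refl a b c d e f g h i j k l p r))

  -- `u` and `v` are the sides of the triangle through `x`; the other lines through `x` are the
  -- `line ρ` with nonzero `ρ`.
  module AtVertex {x y z : V} (x∈S : x ∈ S) (Δ≢0 : det x y z ≢ 0F) where

    u v : V
    u = z ⨯ x
    v = x ⨯ y

    line : Fin q → V
    line ρ = u -V ρ • v

    line-at : ∀ ρ s → line ρ · s ≡ (u · s) -F (ρ *F (v · s))
    line-at ρ s = trans (·--ˡ u (ρ • v) s) (cong (λ t → (u · s) -F t) (·-•ˡ ρ v s))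

    u-y : u · y ≡ det x y z
    u-y = sym (det-rotate z x y)

    line-x : ∀ ρ → line ρ · x ≡ 0F
    line-x ρ = trans (line-at ρ x) (solve 3 (λ a b r → a :- r :* b ≔ 𝟘 by (𝟙 , (a ≔ 𝟘)) ∷ (:- r , (b ≔ 𝟘)) ∷ []) refl (u · x) (v · x) ρ (det-xyy z x) (det-xyx x y))

    line-y : ∀ ρ → line ρ · y ≡ det x y z
    line-y ρ = trans (line-at ρ y) (solve 4 (λ a b r d → a :- r :* b ≔ d by (𝟙 , (a ≔ d)) ∷ (:- r , (b ≔ 𝟘)) ∷ []) refl (u · y) (v · y) ρ (det x y z) u-y (det-xyy x y))

    line-z : ∀ ρ → line ρ · z ≡ -F (ρ *F det x y z)
    line-z ρ = trans (line-at ρ z) (solve 3 (λ a r d → a :- r :* d ≔ :- (r :* d) by (𝟙 , (a ≔ 𝟘)) ∷ []) refl (u · z) ρ (det x y z) (det-xyx z x))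

    line≢0 : ∀ ρ → line ρ ≢ 0V
    line≢0 ρ e = Δ≢0 (trans (sym (line-y ρ)) (trans (cong (_· y) e) (0· y)))

    only-x : ∀ {s} → s ∈ S → u · s ≡ 0F → v · s ≡ 0F → s ≡ x
    only-x i us vs = normalForm-unique (normal-S i) (normal-S x∈S) (collinear-both x y z _ Δ≢0 us vs)

    -- On a line of nonzero slope, a point on one of the two sides is on the other as well and hence
    -- equals `x`; the `suc` accounts for `x`.
    n-line : ∀ ρ → ρ ≢ 0F → n (line ρ) ≡ suc (hits u v ρ)
    n-line ρ ρ≢0 = trans (∑-cong S (λ {s} i → split s i)) (trans (∑-+ S _ _) (cong (ℕ._+ hits u v ρ) (count-≡ _≟V_ unique x∈S)))
      where
      hit⇒on : ∀ s → u · s ≡ ρ *F (v · s) → line ρ · s ≡ 0F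
      hit⇒on s e = trans (line-at ρ s) (trans (cong (_-F (ρ *F (v · s))) e) (-‿inverseʳ _))
      on⇒eq : ∀ s → line ρ · s ≡ 0F → u · s ≡ ρ *F (v · s)
      on⇒eq s e = x-y≡0⇒x≡y (trans (sym (line-at ρ s)) e)
      split : ∀ s → s ∈ S → 𝟏 (on? (line ρ) s) ≡ 𝟏 (s ≟V x) ℕ.+ 𝟏 (hit? u v ρ s)
      split s i = by-cases (s ≟V x) (on? (line ρ) s)
        where
        by-cases : Dec (s ≡ x) → Dec (line ρ · s ≡ 0F) → 𝟏 (on? (line ρ) s) ≡ 𝟏 (s ≟V x) ℕ.+ 𝟏 (hit? u v ρ s)
        by-cases (yes refl) _ = trans (𝟏-yes (on? (line ρ) s) (line-x ρ)) (sym (cong₂ ℕ._+_ (𝟏-yes (s ≟V x) refl)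
          (𝟏-no (hit? u v ρ s) (λ p → proj₁ (proj₁ p) (det-xyy z x)))))
        by-cases (no s≢x) (no ¬on) = trans (𝟏-no (on? (line ρ) s) ¬on) (sym (cong₂ ℕ._+_ (𝟏-no (s ≟V x) s≢x)
          (𝟏-no (hit? u v ρ s) (λ p → ¬on (hit⇒on s (proj₂ p))))))
        by-cases (no s≢x) (yes on) = trans (𝟏-yes (on? (line ρ) s) on) (sym (cong₂ ℕ._+_ (𝟏-no (s ≟V x) s≢x)
          (𝟏-yes (hit? u v ρ s) ((u≢0 , v≢0) , eq))))
          where
          eq = on⇒eq s on
          v≢0 : v · s ≢ 0F
          v≢0 vs = s≢x (only-x i (trans eq (trans (cong (ρ *F_) vs) (zeroʳ ρ))) vs)
          u≢0 : u · s ≢ 0F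
          u≢0 us = v≢0 (cancelˡ ρ≢0 (trans (sym eq) us))

    same-line : ∀ h ρ → h · x ≡ 0F → h · y ≢ 0F → h · z ≡ -F (ρ *F (h · y)) → n (line ρ) ≡ n h
    same-line h ρ hx hy hz = n-cong (line ρ) h
      (λ {s} _ e → cancelˡ Δ≢0 (trans (sym (scaled s)) (trans (cong ((h · y) *F_) e) (zeroʳ _))))
      (λ {s} _ e → cancelˡ hy (trans (scaled s) (trans (cong (det x y z *F_) e) (zeroʳ _))))
      where
      scaled : ∀ s → (h · y) *F (line ρ · s) ≡ det x y z *F (h · s)
      scaled s = trans (cong ((h · y) *F_) (line-at ρ s)) (sym (trans (cramer h x y z s)
        (solve 7 (λ hx hy hz w us vs r → (hx :* w) :+ ((hy :* us) :+ (hz :* vs)) ≔ hy :* (us :- r :* vs)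
          by (w , (hx ≔ 𝟘)) ∷ (vs , (hz ≔ :- (r :* hy))) ∷ []) refl (h · x) (h · y) (h · z) (det y z s) (u · s) (v · s) ρ hx hz)))

    parallel-line : ∀ h ρ → line ρ ⨯ h ≡ 0V → h · z ≡ -F (ρ *F (h · y))
    parallel-line h ρ e = x-y≡0⇒x≡y (cancelˡ Δ≢0
      (solve 6 (λ Ly Lz hy hz d r → d :* (hz :- :- (r :* hy)) ≔ 𝟘
        by (𝟙 , ((Ly :* hz) :- (Lz :* hy) ≔ 𝟘)) ∷ (:- hz , (Ly ≔ d)) ∷ (hy , (Lz ≔ :- (r :* d))) ∷ [])
        refl (line ρ · y) (line ρ · z) (h · y) (h · z) (det x y z) ρ
        (trans (sym (binet (line ρ) h y z)) (trans (cong (_· (y ⨯ z)) e) (0· (y ⨯ z)))) (line-y ρ) (line-z ρ)))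

    slope : V → Fin q
    slope h = -F ((h · z) *F inv (h · y))

    slope-eq : ∀ h → h · y ≢ 0F → h · z ≡ -F (slope h *F (h · y))
    slope-eq h hy = solve 3 (λ a b i → a ≔ :- ((:- (a :* i)) :* b) by (:- a , (b :* i ≔ 𝟙)) ∷ []) refl (h · z) (h · y) _ (inv-right hy)

    slope-unique : ∀ h ρ → h · y ≢ 0F → h · z ≡ -F (ρ *F (h · y)) → ρ ≡ slope h
    slope-unique h ρ hy e = solve 4 (λ a b i r → r ≔ :- (a :* i) by (i , (a ≔ :- (r :* b))) ∷ (:- r , (b :* i ≔ 𝟙)) ∷ [])
      refl (h · z) (h · y) _ ρ e (inv-right hy)

    slope≢0 : ∀ h → h · y ≢ 0F → h · z ≢ 0F → slope h ≢ 0F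
    slope≢0 h hy hz e = hz (trans (slope-eq h hy) (trans (cong (λ t → -F (t *F (h · y))) e) (trans (cong -F_ (zeroˡ _)) -0#≈0#)))

    hits-from : ∀ ρ k → ρ ≢ 0F → n (line ρ) ≡ suc k → hits u v ρ ≡ k
    hits-from ρ k ρ≢0 e = ℕ.suc-injective (trans (sym (n-line ρ ρ≢0)) e)

    Q-allBisecant : AllBisecant x → Q u v ≡ -F 1F
    -- Taking slope 1 for both the missing and the doubled slope changes nothing, so Wilson's
    -- product is left.
    Q-allBisecant h = trans (sym (*-identityʳ _)) (Q-slopes u v 1F 1F (≢-sym 0≢1) (≢-sym 0≢1)
      (λ ρ ρ≢0 → cong (_*F select (ρ ≟ 1F) ρ) (trans (cong (pow ρ) (hits-from ρ 1 ρ≢0 (AllBisecant.bisecant h (line ρ) (line≢0 ρ) (line-x ρ)))) (pow-1 ρ))))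

    module _ (G : Good x) where
      open Good G

      -- For a trisecant that is itself a side of the triangle: it has no nonzero slope, so no slope
      -- is doubled, which the neutral `σ = 1` expresses.
      Q-through-trisecant : g · y ≢ 0F → g · z ≢ 0F → (∀ ρ → ρ ≢ 0F → f · z ≢ -F (ρ *F (f · y))) → Q u v *F (g · z) ≡ g · y
      Q-through-trisecant gy gz no-f = solve 4 (λ Q a b i → Q :* a ≔ b by (:- b , (Q :* (:- (a :* i)) ≔ :- 𝟙)) ∷ (:- (Q :* a) , (b :* i ≔ 𝟙)) ∷ [])
        refl (Q u v) (g · z) (g · y) (inv (g · y)) (Q-slopes u v (slope g) 1F (slope≢0 g gy gz) (≢-sym 0≢1) (λ ρ ρ≢0 → pointwise ρ ρ≢0 (ρ ≟ slope g))) (inv-right gy)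
        where
        pointwise : ∀ ρ → ρ ≢ 0F → Dec (ρ ≡ slope g) → pow ρ (hits u v ρ) *F select (ρ ≟ slope g) ρ ≡ ρ *F select (ρ ≟ 1F) ρ
        pointwise ρ ρ≢0 (yes refl) = trans (cong₂ _*F_ (cong (pow ρ) (hits-from ρ 0 ρ≢0 (trans (same-line g ρ g-on gy (slope-eq g gy)) g-one)))
          (select-yes (ρ ≟ slope g) ρ refl)) (trans (*-comm 1F ρ) (cong (ρ *F_) (sym (select-≟1 ρ))))
        pointwise ρ ρ≢0 (no ne) = cong₂ _*F_ (trans (cong (pow ρ) (hits-from ρ 1 ρ≢0 (two (otherwise (line ρ) (line≢0 ρ) (line-x ρ))))) (pow-1 ρ))
          (trans (select-no (ρ ≟ slope g) ρ ne) (sym (select-≟1 ρ)))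
          where
          two : n (line ρ) ≡ 2 ⊎ line ρ ⨯ g ≡ 0V ⊎ line ρ ⨯ f ≡ 0V → n (line ρ) ≡ 2
          two (inj₁ e)        = e
          two (inj₂ (inj₁ e)) = contradiction (slope-unique g ρ gy (parallel-line g ρ e)) ne
          two (inj₂ (inj₂ e)) = contradiction (parallel-line f ρ e) (no-f ρ ρ≢0)

      Q-generic : g · y ≢ 0F → g · z ≢ 0F → f · y ≢ 0F → f · z ≢ 0F → Q u v *F ((g · z) *F (f · y)) ≡ -F ((f · z) *F (g · y))
      Q-generic gy gz fy fz = solve 7 (λ Q a b i c d j → Q :* (a :* d) ≔ :- (c :* b)
          by (:- (b :* d) , (Q :* (:- (a :* i)) ≔ :- (:- (c :* j)))) ∷ (:- (Q :* a :* d) , (b :* i ≔ 𝟙)) ∷ (:- (c :* b) , (d :* j ≔ 𝟙)) ∷ [])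
        refl (Q u v) (g · z) (g · y) (inv (g · y)) (f · z) (f · y) (inv (f · y))
        (Q-slopes u v (slope g) (slope f) (slope≢0 g gy gz) (slope≢0 f fy fz) (λ ρ ρ≢0 → pointwise ρ ρ≢0 (ρ ≟ slope g) (ρ ≟ slope f)))
        (inv-right gy) (inv-right fy)
        where
        on-g : ∀ ρ → ρ ≡ slope g → n (line ρ) ≡ 1
        on-g ρ refl = trans (same-line g ρ g-on gy (slope-eq g gy)) g-one
        on-f : ∀ ρ → ρ ≡ slope f → n (line ρ) ≡ 3
        on-f ρ refl = trans (same-line f ρ f-on fy (slope-eq f fy)) f-three
        pointwise : ∀ ρ → ρ ≢ 0F → Dec (ρ ≡ slope g) → Dec (ρ ≡ slope f) →
          pow ρ (hits u v ρ) *F select (ρ ≟ slope g) ρ ≡ ρ *F select (ρ ≟ slope f) ρ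
        pointwise ρ ρ≢0 (yes e) (yes e′) = contradiction (trans (sym (on-g ρ e)) (on-f ρ e′)) λ ()
        pointwise ρ ρ≢0 (yes e) (no ne) = trans (cong₂ _*F_ (cong (pow ρ) (hits-from ρ 0 ρ≢0 (on-g ρ e)))
          (select-yes (ρ ≟ slope g) ρ e)) (trans (*-comm 1F ρ) (cong (ρ *F_) (sym (select-no (ρ ≟ slope f) ρ ne))))
        pointwise ρ ρ≢0 (no ne) (yes e) = trans (cong₂ _*F_ (trans (cong (pow ρ) (hits-from ρ 2 ρ≢0 (on-f ρ e))) (cong (ρ *F_) (pow-1 ρ)))
          (select-no (ρ ≟ slope g) ρ ne)) (trans (*-identityʳ _) (cong (ρ *F_) (sym (select-yes (ρ ≟ slope f) ρ e))))
        pointwise ρ ρ≢0 (no ne) (no ne′) = cong₂ _*F_ (trans (cong (pow ρ) (hits-from ρ 1 ρ≢0 (two (otherwise (line ρ) (line≢0 ρ) (line-x ρ))))) (pow-1 ρ))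
          (trans (select-no (ρ ≟ slope g) ρ ne) (sym (select-no (ρ ≟ slope f) ρ ne′)))
          where
          two : n (line ρ) ≡ 2 ⊎ line ρ ⨯ g ≡ 0V ⊎ line ρ ⨯ f ≡ 0V → n (line ρ) ≡ 2
          two (inj₁ e)        = e
          two (inj₂ (inj₁ e)) = contradiction (slope-unique g ρ gy (parallel-line g ρ e)) ne
          two (inj₂ (inj₂ e)) = contradiction (slope-unique f ρ fy (parallel-line f ρ e)) ne′

  quot-cycle : ∀ {a b c} → a ≢ 0F → b ≢ 0F → c ≢ 0F → quot a b *F (quot b c *F quot c a) ≡ 1F
  quot-cycle {a} {b} {c} a≢0 b≢0 c≢0 = trans (cong₂ _*F_ (quot-nonzero a≢0 b≢0) (cong₂ _*F_ (quot-nonzero b≢0 c≢0) (quot-nonzero c≢0 a≢0)))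
    (solve 6 (λ a b c i j k → (a :* j) :* ((b :* k) :* (c :* i)) ≔ 𝟙
      by (b :* j :* c :* k , (a :* i ≔ 𝟙)) ∷ (c :* k , (b :* j ≔ 𝟙)) ∷ (𝟙 , (c :* k ≔ 𝟙)) ∷ [])
      refl a b c (inv a) (inv b) (inv c) (inv-right a≢0) (inv-right b≢0) (inv-right c≢0))

  Bisecant : V → V → Set
  Bisecant x y = ∀ {s} → s ∈ S → det x y s ≡ 0F → s ≡ x ⊎ s ≡ y

  module Triangle (x y z : V) where

    X Y Z : V → Fin q
    X s = (y ⨯ z) · s
    Y s = (z ⨯ x) · s
    Z s = (x ⨯ y) · s

    -- The three ratios telescope to 1 off the sides. At the vertices each `quot` has its junk
    -- value, so only further points on a side can contribute.
    term : V → Fin q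
    term s = quot (Y s) (Z s) *F (quot (Z s) (X s) *F quot (X s) (Y s))

    product : Q (z ⨯ x) (x ⨯ y) *F (Q (x ⨯ y) (y ⨯ z) *F Q (y ⨯ z) (z ⨯ x)) ≡ ∏ S term
    product = sym (trans (∏-* S _ _) (cong (Q (z ⨯ x) (x ⨯ y) *F_) (∏-* S _ _)))

    ones : ∀ {a b c : Fin q} → a ≡ 1F → b ≡ 1F → c ≡ 1F → a *F (b *F c) ≡ 1F
    ones refl refl refl = trans (*-identityˡ _) (*-identityˡ _)

    term-x : term x ≡ 1F
    term-x = ones (quot-0ˡ (det-xyy z x)) (quot-0ˡ (det-xyx x y)) (quot-0ʳ (det-xyy z x))

    term-y : term y ≡ 1F
    term-y = ones (quot-0ʳ (det-xyy x y)) (quot-0ˡ (det-xyy x y)) (quot-0ˡ (det-xyx y z))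

    term-z : term z ≡ 1F
    term-z = ones (quot-0ˡ (det-xyx z x)) (quot-0ʳ (det-xyy y z)) (quot-0ˡ (det-xyy y z))

    term-off : Bisecant y z → Bisecant z x → ∀ {s} → s ∈ S → Z s ≢ 0F → term s ≡ 1F
    term-off yz zx {s} i Zs = by-cases ((X s) ≟ 0F) ((Y s) ≟ 0F)
      where
      by-cases : Dec (X s ≡ 0F) → Dec (Y s ≡ 0F) → term s ≡ 1F
      by-cases (yes e) _ with yz i e
      ... | inj₁ refl = term-y
      ... | inj₂ refl = term-z
      by-cases (no _) (yes e) with zx i e
      ... | inj₁ refl = term-z
      ... | inj₂ refl = term-x
      by-cases (no Xs) (no Ys) = quot-cycle Ys Zs Xs

    bisecant-product : Bisecant x y → Bisecant y z → Bisecant z x →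
      Q (z ⨯ x) (x ⨯ y) *F (Q (x ⨯ y) (y ⨯ z) *F Q (y ⨯ z) (z ⨯ x)) ≡ 1F
    bisecant-product xy yz zx = trans product (∏-one S (λ {s} i → each s i ((Z s) ≟ 0F)))
      where
      each : ∀ s → s ∈ S → Dec (Z s ≡ 0F) → term s ≡ 1F
      each s i (no Zs) = term-off yz zx i Zs
      each s i (yes e) with xy i e
      ... | inj₁ refl = term-x
      ... | inj₂ refl = term-y

    -- The third point `w` on the side `x y` is the only one whose ratios do not telescope: two of
    -- them are junk and `X w / Y w` remains.
    trisecant-product : ∀ w → w ∈ S → w ≢ x → w ≢ y → w ≢ z → Z w ≡ 0F →
      (∀ {s} → s ∈ S → det x y s ≡ 0F → s ≡ x ⊎ s ≡ y ⊎ s ≡ w) → Bisecant y z → Bisecant z x →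
      (Q (z ⨯ x) (x ⨯ y) *F (Q (x ⨯ y) (y ⨯ z) *F Q (y ⨯ z) (z ⨯ x))) *F Y w ≡ X w
    trisecant-product w w∈S w≢x w≢y w≢z Zw xy yz zx = trans (cong (_*F Y w) (trans product
        (trans (∏-single {b = w} unique w∈S (λ {s} i s≢w → each s i s≢w ((Z s) ≟ 0F)))
          (cong₂ _*F_ (quot-0ʳ Zw) (cong₂ _*F_ (quot-0ˡ Zw) (quot-nonzero Xw Yw))))))
      (solve 3 (λ a b i → (𝟙 :* (𝟙 :* (a :* i))) :* b ≔ a by (a , (b :* i ≔ 𝟙)) ∷ []) refl (X w) (Y w) (inv (Y w)) (inv-right Yw))
      where
      Xw : X w ≢ 0F
      Xw e with yz w∈S e
      ... | inj₁ p = w≢y p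
      ... | inj₂ p = w≢z p
      Yw : Y w ≢ 0F
      Yw e with zx w∈S e
      ... | inj₁ p = w≢z p
      ... | inj₂ p = w≢x p
      each : ∀ s → s ∈ S → s ≢ w → Dec (Z s ≡ 0F) → term s ≡ 1F
      each s i s≢w (no Zs) = term-off yz zx i Zs
      each s i s≢w (yes e) with xy i e
      ... | inj₁ refl = term-x
      ... | inj₂ (inj₁ refl) = term-y
      ... | inj₂ (inj₂ p) = contradiction p s≢w

  bisecant : ∀ {x y} → x ∈ S → y ∈ S → x ≢ y → n (x ⨯ y) ≡ 2 → Bisecant x y
  bisecant {x} {y} i j x≢y two = count-2 _≟V_ (on? (x ⨯ y)) unique i j (det-xyx x y) (det-xyy x y) x≢y two

  noncollinear : ∀ {x y z} → Bisecant x y → z ∈ S → z ≢ x → z ≢ y → det x y z ≢ 0F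
  noncollinear xy k z≢x z≢y e with xy k e
  ... | inj₁ p = z≢x p
  ... | inj₂ p = z≢y p

  -- All sides are bisecants, so the three slope products multiply to 1, while each of them equals
  -- -1.
  no-three-allBisecant : ∀ {x y z} → AllBisecant x → AllBisecant y → AllBisecant z → x ≢ y → y ≢ z → z ≢ x → ⊥
  no-three-allBisecant {x} {y} {z} hx hy hz x≢y y≢z z≢x = char≢2
    (solve 3 (λ a b c → 𝟙 :+ 𝟙 ≔ 𝟘 by (:- 𝟙 , (a :* (b :* c) ≔ 𝟙)) ∷ (b :* c , (a ≔ :- 𝟙)) ∷ (:- c , (b ≔ :- 𝟙)) ∷ (𝟙 , (c ≔ :- 𝟙)) ∷ [])
      refl _ _ _ (Triangle.bisecant-product x y z (side hx (mem hy) x≢y) (side hy (mem hz) y≢z) (side hz (mem hx) z≢x))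
      (AtVertex.Q-allBisecant {x} {y} {z} (mem hx) Δ hx)
      (AtVertex.Q-allBisecant {y} {z} {x} (mem hy) (λ e → Δ (trans (sym (det-rotate x y z)) e)) hy)
      (AtVertex.Q-allBisecant {z} {x} {y} (mem hz) (λ e → Δ (trans (det-rotate z x y) e)) hz))
    where
    mem : ∀ {s} → AllBisecant s → s ∈ S
    mem = AllBisecant.member
    side : ∀ {s t} → AllBisecant s → t ∈ S → s ≢ t → Bisecant s t
    side {s} {t} h j s≢t = bisecant (mem h) j s≢t (AllBisecant.bisecant h (s ⨯ t) (distinct⇒⨯≢0 (mem h) j s≢t) (det-xyx s t))
    Δ : det x y z ≢ 0F
    Δ = noncollinear (side hx (mem hy) x≢y) (mem hz) z≢x (≢-sym y≢z)

  proportional-on : ∀ L M s → L ⨯ M ≡ 0V → L ≢ 0V → L · s ≡ 0F → M · s ≡ 0F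
  proportional-on (a , b , c) (l , m , o) (x , y , z) e ne Ls with a ≟ 0F | b ≟ 0F | c ≟ 0F
  ... | no a≢0 | _ | _ = cancelˡ a≢0 (solve 9 (λ a b c l m o x y z → a :* ((l , m , o) :· (x , y , z)) ≔ 𝟘
        by (l , ((a , b , c) :· (x , y , z) ≔ 𝟘)) ∷ (y , (a :* m :- b :* l ≔ 𝟘)) ∷ (:- z , (c :* l :- a :* o ≔ 𝟘)) ∷ [])
        refl a b c l m o x y z Ls (cong (λ v → proj₂ (proj₂ v)) e) (cong (λ v → proj₁ (proj₂ v)) e))
  ... | yes _ | no b≢0 | _ = cancelˡ b≢0 (solve 9 (λ a b c l m o x y z → b :* ((l , m , o) :· (x , y , z)) ≔ 𝟘
        by (m , ((a , b , c) :· (x , y , z) ≔ 𝟘)) ∷ (:- x , (a :* m :- b :* l ≔ 𝟘)) ∷ (z , (b :* o :- c :* m ≔ 𝟘)) ∷ [])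
        refl a b c l m o x y z Ls (cong (λ v → proj₂ (proj₂ v)) e) (cong proj₁ e))
  ... | yes _ | yes _ | no c≢0 = cancelˡ c≢0 (solve 9 (λ a b c l m o x y z → c :* ((l , m , o) :· (x , y , z)) ≔ 𝟘
        by (o , ((a , b , c) :· (x , y , z) ≔ 𝟘)) ∷ (x , (c :* l :- a :* o ≔ 𝟘)) ∷ (:- y , (b :* o :- c :* m ≔ 𝟘)) ∷ [])
        refl a b c l m o x y z Ls (cong (λ v → proj₁ (proj₂ v)) e) (cong proj₁ e))
  ... | yes refl | yes refl | yes refl = contradiction refl ne

  tangent-off : ∀ {x} (G : Good x) {s} → s ∈ S → s ≢ x → Good.g G · s ≢ 0F
  tangent-off {x} G {s} i s≢x e = count-none S (without? _≟V_ (on? g) x)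
    (ℕ.suc-injective (trans (sym (count-remove _≟V_ (on? g) unique member g-on)) g-one)) i (e , s≢x)
    where open Good G

  good-bisecant : ∀ {x} (G : Good x) {y} → y ∈ S → y ≢ x → Good.f G · y ≢ 0F → Bisecant x y
  good-bisecant {x} G {y} j y≢x fy = bisecant member j (≢-sym y≢x) (two (otherwise (x ⨯ y) xy≢0 (det-xyx x y)))
    where
    open Good G
    xy≢0 = distinct⇒⨯≢0 member j (≢-sym y≢x)
    two : n (x ⨯ y) ≡ 2 ⊎ (x ⨯ y) ⨯ g ≡ 0V ⊎ (x ⨯ y) ⨯ f ≡ 0V → n (x ⨯ y) ≡ 2
    two (inj₁ e) = e
    two (inj₂ (inj₁ e)) = contradiction (proportional-on (x ⨯ y) g y e xy≢0 (det-xyy x y)) (tangent-off G j y≢x)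
    two (inj₂ (inj₂ e)) = contradiction (proportional-on (x ⨯ y) f y e xy≢0 (det-xyy x y)) fy

  module _ {x y z : V} (Gx : Good x) (Gy : Good y) (Gz : Good z) (x≢y : x ≢ y) (y≢z : y ≢ z) (z≢x : z ≢ x) where
    private
      module x = Good Gx
      module y = Good Gy
      module z = Good Gz

    -- The three slope products multiply to 1, and each vertex contributes one sign.
    segre-generic : x.f · y ≢ 0F → x.f · z ≢ 0F → y.f · z ≢ 0F → y.f · x ≢ 0F → z.f · x ≢ 0F → z.f · y ≢ 0F →
      ((x.g · z) *F (x.f · y)) *F (((y.g · x) *F (y.f · z)) *F ((z.g · y) *F (z.f · x))) ≡
      -F (((x.f · z) *F (x.g · y)) *F (((y.f · x) *F (y.g · z)) *F ((z.f · y) *F (z.g · x))))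
    segre-generic fxy fxz fyz fyx fzx fzy =
      solve 9 (λ a b c p₁ r₁ p₂ r₂ p₃ r₃ → p₁ :* (p₂ :* p₃) ≔ :- (r₁ :* (r₂ :* r₃))
        by (:- (p₁ :* (p₂ :* p₃)) , (a :* (b :* c) ≔ 𝟙)) ∷ (b :* c :* p₂ :* p₃ , (a :* p₁ ≔ :- r₁))
         ∷ (:- (c :* r₁ :* p₃) , (b :* p₂ ≔ :- r₂)) ∷ (r₁ :* r₂ , (c :* p₃ ≔ :- r₃)) ∷ [])
        refl (Q (z ⨯ x) (x ⨯ y)) (Q (x ⨯ y) (y ⨯ z)) (Q (y ⨯ z) (z ⨯ x)) _ _ _ _ _ _
        (Triangle.bisecant-product x y z xy yz zx)
        (AtVertex.Q-generic {x} {y} {z} x.member Δ Gx (tangent-off Gx y.member (≢-sym x≢y)) (tangent-off Gx z.member z≢x) fxy fxz)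
        (AtVertex.Q-generic {y} {z} {x} y.member Δ′ Gy (tangent-off Gy z.member (≢-sym y≢z)) (tangent-off Gy x.member x≢y) fyz fyx)
        (AtVertex.Q-generic {z} {x} {y} z.member Δ″ Gz (tangent-off Gz x.member (≢-sym z≢x)) (tangent-off Gz y.member y≢z) fzx fzy)
      where
      xy = good-bisecant Gx y.member (≢-sym x≢y) fxy
      yz = good-bisecant Gy z.member (≢-sym y≢z) fyz
      zx = good-bisecant Gz x.member (≢-sym z≢x) fzx
      Δ : det x y z ≢ 0F
      Δ = noncollinear xy z.member z≢x (≢-sym y≢z)
      Δ′ : det y z x ≢ 0F
      Δ′ e = Δ (trans (sym (det-rotate x y z)) e)
      Δ″ : det z x y ≢ 0F
      Δ″ e = Δ (trans (det-rotate z x y) e)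

    -- At `x` and `y` the trisecant is the side `x y`, so only `z` contributes a doubled slope and a
    -- sign; the third point `w` supplies the determinants.
    segre-trisecant : ∀ w → w ∈ S → w ≢ x → w ≢ y → w ≢ z → det x y w ≡ 0F →
      (∀ {s} → s ∈ S → det x y s ≡ 0F → s ≡ x ⊎ s ≡ y ⊎ s ≡ w) →
      x.f · y ≡ 0F → y.f · x ≡ 0F → x.f · z ≢ 0F → y.f · z ≢ 0F → z.f · x ≢ 0F → z.f · y ≢ 0F →
      det y z w *F ((x.g · z) *F ((y.g · x) *F ((z.g · y) *F (z.f · x)))) ≡
      -F (det z x w *F ((x.g · y) *F ((y.g · z) *F ((z.f · y) *F (z.g · x)))))
    segre-trisecant w w∈S w≢x w≢y w≢z xyw side fxy fyx fxz fyz fzx fzy =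
      solve 11 (λ a b c X Y p₁ r₁ p₂ r₂ p₃ r₃ → X :* (p₁ :* (p₂ :* p₃)) ≔ :- (Y :* (r₁ :* (r₂ :* r₃)))
        by (:- (p₁ :* (p₂ :* p₃)) , ((a :* (b :* c)) :* Y ≔ X)) ∷ (b :* c :* p₂ :* p₃ :* Y , (a :* p₁ ≔ r₁))
         ∷ (c :* r₁ :* p₃ :* Y , (b :* p₂ ≔ r₂)) ∷ (r₁ :* r₂ :* Y , (c :* p₃ ≔ :- r₃)) ∷ [])
        refl (Q (z ⨯ x) (x ⨯ y)) (Q (x ⨯ y) (y ⨯ z)) (Q (y ⨯ z) (z ⨯ x)) _ _ _ _ _ _ _ _
        (Triangle.trisecant-product x y z w w∈S w≢x w≢y w≢z xyw side yz zx)
        (AtVertex.Q-through-trisecant {x} {y} {z} x.member Δ Gx (tangent-off Gx y.member (≢-sym x≢y)) (tangent-off Gx z.member z≢x)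
          (λ ρ _ e → fxz (trans e (trans (cong (λ t → -F (ρ *F t)) fxy) (trans (cong -F_ (zeroʳ ρ)) -0#≈0#)))))
        (AtVertex.Q-through-trisecant {y} {z} {x} y.member Δ′ Gy (tangent-off Gy z.member (≢-sym y≢z)) (tangent-off Gy x.member x≢y)
          (λ ρ ρ≢0 e → *-nonzero ρ≢0 fyz (solve 2 (λ a b → a ≔ 𝟘 by (𝟙 , (b ≔ :- a)) ∷ (:- 𝟙 , (b ≔ 𝟘)) ∷ []) refl _ _ e fyx)))
        (AtVertex.Q-generic {z} {x} {y} z.member Δ″ Gz (tangent-off Gz x.member (≢-sym z≢x)) (tangent-off Gz y.member y≢z) fzx fzy)
      where
      yz = good-bisecant Gy z.member (≢-sym y≢z) fyz
      zx = good-bisecant Gz x.member (≢-sym z≢x) fzx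
      Δ″ : det z x y ≢ 0F
      Δ″ = noncollinear zx y.member y≢z (≢-sym x≢y)
      Δ : det x y z ≢ 0F
      Δ e = Δ″ (trans (sym (det-rotate z x y)) e)
      Δ′ : det y z x ≢ 0F
      Δ′ e = Δ (trans (sym (det-rotate x y z)) e)

  open Chords char≢2 hiding (two)

  -- If the trisecant at z has direction (d₁ , d₂) then the tangent at z has direction (z₁ d₁ , − z₂ d₂).
  affineConj-zero : ∀ z₁ z₂ d₁ d₂ t₁ t₂ e₁ e₂ k l m o {Af Bf Ag Bg Af′ Bf′ Ag′ Bg′} →
    z₂ ≢ 0F → t₂ ≢ 0F → d₂ ≢ 0F → e₂ ≢ 0F → k ≢ 0F → l ≢ 0F → m ≢ 0F → o ≢ 0F →
    Af ≡ -F (k *F d₂) → Bf ≡ k *F d₁ → Ag ≡ m *F (z₂ *F d₂) → Bg ≡ m *F (z₁ *F d₁) →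
    Af′ ≡ -F (l *F e₂) → Bf′ ≡ l *F e₁ → Ag′ ≡ o *F (t₂ *F e₂) → Bg′ ≡ o *F (t₁ *F e₁) →
    (t₂ *F (Ag *F Af′)) *F (((Af *F (t₁ -F z₁)) +F (Bf *F (t₂ -F z₂))) *F ((Ag′ *F (t₁ -F z₁)) +F (Bg′ *F (t₂ -F z₂)))) ≡
    -F ((z₂ *F (Af *F Ag′)) *F (((Ag *F (t₁ -F z₁)) +F (Bg *F (t₂ -F z₂))) *F ((Af′ *F (t₁ -F z₁)) +F (Bf′ *F (t₂ -F z₂))))) →
    affineConj z₁ z₂ d₁ d₂ t₁ t₂ e₁ e₂ ≡ 0F
  affineConj-zero z₁ z₂ d₁ d₂ t₁ t₂ e₁ e₂ k l m o z₂≢0 t₂≢0 d₂≢0 e₂≢0 k≢0 l≢0 m≢0 o≢0 refl refl refl refl refl refl refl refl h =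
    cancelˡ (*-nonzero (*-nonzero (*-nonzero z₂≢0 t₂≢0) (*-nonzero d₂≢0 e₂≢0)) (*-nonzero (*-nonzero k≢0 l≢0) (*-nonzero m≢0 o≢0)))
      (solve 12 (λ z₁ z₂ d₁ d₂ t₁ t₂ e₁ e₂ k l m o →
        let Af = :- (k :* d₂) ; Bf = k :* d₁ ; Ag = m :* (z₂ :* d₂) ; Bg = m :* (z₁ :* d₁)
            Af′ = :- (l :* e₂) ; Bf′ = l :* e₁ ; Ag′ = o :* (t₂ :* e₂) ; Bg′ = o :* (t₁ :* e₁) in
        (((z₂ :* t₂) :* (d₂ :* e₂)) :* ((k :* l) :* (m :* o))) :* E.affineConj z₁ z₂ d₁ d₂ t₁ t₂ e₁ e₂ ≔ 𝟘
        by (:- 𝟙 , ((t₂ :* (Ag :* Af′)) :* (((Af :* (t₁ :- z₁)) :+ (Bf :* (t₂ :- z₂))) :* ((Ag′ :* (t₁ :- z₁)) :+ (Bg′ :* (t₂ :- z₂)))) ≔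
          :- ((z₂ :* (Af :* Ag′)) :* (((Ag :* (t₁ :- z₁)) :+ (Bg :* (t₂ :- z₂))) :* ((Af′ :* (t₁ :- z₁)) :+ (Bf′ :* (t₂ :- z₂))))))) ∷ [])
        refl z₁ z₂ d₁ d₂ t₁ t₂ e₁ e₂ k l m o h)

  ⨯-sym : ∀ a b → a ⨯ b ≡ 0V → b ⨯ a ≡ 0V
  ⨯-sym (a , b , c) (x , y , z) e = ≡V (flip b z c y (cong proj₁ e)) (flip c x a z (cong (λ v → proj₁ (proj₂ v)) e)) (flip a y b x (cong (λ v → proj₂ (proj₂ v)) e))
    where
    flip : ∀ i j k l → (i *F j) -F (k *F l) ≡ 0F → (l *F k) -F (j *F i) ≡ 0F
    flip = solve 4 (λ i j k l → l :* k :- j :* i ≔ 𝟘 by (:- 𝟙 , (i :* j :- k :* l ≔ 𝟘)) ∷ []) refl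

  good-trisecant : ∀ {x} (G : Good x) L → NormalForm L → L · x ≡ 0F → n L ≡ 3 → L ≡ Good.f G
  good-trisecant {x} G L nf Lx three = identify (otherwise L (normalForm-≢0 nf) Lx)
    where
    open Good G
    identify : n L ≡ 2 ⊎ L ⨯ g ≡ 0V ⊎ L ⨯ f ≡ 0V → L ≡ f
    identify (inj₁ two) = contradiction (trans (sym three) two) λ ()
    identify (inj₂ (inj₁ e)) = contradiction (trans (sym three) (trans (cong n (normalForm-unique nf g-normal e)) g-one)) λ ()
    identify (inj₂ (inj₂ e)) = normalForm-unique nf f-normal e

  -- A good point is on only one trisecant, so the trisecant of `z` could pass through `x` only by
  -- being that of `x`.
  avoids : ∀ {x z} (G : Good x) (H : Good z) → Good.f H ≢ Good.f G → Good.f H · x ≢ 0F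
  avoids G H ne e = ne (good-trisecant G (Good.f H) (Good.f-normal H) e (Good.f-three H))

  -- Affine coordinates with the trisecant at infinity and the tangents at `x` and `y` as axes

  module Frame {x y w : V} (Gx : Good x) (Gy : Good y) (x≢y : x ≢ y) (same : Good.f Gy ≡ Good.f Gx)
    (w∈S : w ∈ S) (w≢x : w ≢ x) (w≢y : w ≢ y) (w-on : Good.f Gx · w ≡ 0F)
    (only : ∀ {s} → s ∈ S → Good.f Gx · s ≡ 0F → s ≡ x ⊎ s ≡ y ⊎ s ≡ w) where

    private
      module x = Good Gx
      module y = Good Gy

    f₁ : V
    f₁ = x.f

    y-on : f₁ · y ≡ 0F
    y-on = trans (cong (_· y) (sym same)) y.f-on

    xy≢0 : x ⨯ y ≢ 0V
    xy≢0 = distinct⇒⨯≢0 x.member y.member x≢y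

    f₁⨯xy : f₁ ⨯ (x ⨯ y) ≡ 0V
    f₁⨯xy = ⨯-⨯′ f₁ x y x.f-on y-on
      where
      ⨯-⨯′ : ∀ L x y → L · x ≡ 0F → L · y ≡ 0F → L ⨯ (x ⨯ y) ≡ 0V
      ⨯-⨯′ L x y p r = trans (cong (L ⨯_) (sym (≡V (*-identityˡ _) (*-identityˡ _) (*-identityˡ _)))) (⨯-⨯ 1F L x y p r)

    on⇒det : ∀ s → f₁ · s ≡ 0F → det x y s ≡ 0F
    on⇒det s = proportional-on f₁ (x ⨯ y) s f₁⨯xy (normalForm-≢0 x.f-normal)

    det⇒on : ∀ s → det x y s ≡ 0F → f₁ · s ≡ 0F
    det⇒on s = proportional-on (x ⨯ y) f₁ s (⨯-sym f₁ (x ⨯ y) f₁⨯xy) xy≢0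

    gxw gyw gxy gyx : Fin q
    gxw = x.g · w
    gyw = y.g · w
    gxy = x.g · y
    gyx = y.g · x

    gxw≢0 : gxw ≢ 0F
    gxw≢0 = tangent-off Gx w∈S w≢x
    gyw≢0 : gyw ≢ 0F
    gyw≢0 = tangent-off Gy w∈S w≢y
    gxy≢0 : gxy ≢ 0F
    gxy≢0 = tangent-off Gx y.member (≢-sym x≢y)
    gyx≢0 : gyx ≢ 0F
    gyx≢0 = tangent-off Gy x.member x≢y

    -- Coordinates with x = (1 , 0 , 0), y = (0 , 1 , 0), w = (1 , 1 , 0), up to scaling, in which y.g, x.g
    -- and f₁ are the coordinate lines; A h and B h are the values of the form h at the first two basis points.
    ξ υ : V → Fin q
    ξ s = ((y.g · s) *F inv gyw) *F inv (f₁ · s)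
    υ s = ((x.g · s) *F inv gxw) *F inv (f₁ · s)

    A B : V → Fin q
    A h = ((h · x) *F gyw) *F inv gyx
    B h = ((h · y) *F gxw) *F inv gxy

    -- On `f₁` the points `x` and `y` form a basis in which `y.g` and `x.g` are, up to scale, the
    -- coordinates. Applying `cramer` to `h`, `y.g` and `x.g` eliminates the determinants.
    span : ∀ {z} → f₁ · z ≢ 0F → ∀ h u → f₁ · u ≡ 0F →
      (h · u) *F (gyx *F gxy) ≡ (((h · x) *F (y.g · u)) *F gxy) +F (((h · y) *F (x.g · u)) *F gyx)
    span {z} Zz h u Zu = x-y≡0⇒x≡y (cancelˡ (λ e → Zz (det⇒on z e))
      (solve 13 (λ d hu gyx gxy hx gyu hy gxu hz yz zx gyz gxz →
        d :* (hu :* (gyx :* gxy) :- ((hx :* gyu :* gxy) :+ (hy :* gxu :* gyx))) ≔ 𝟘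
        by (gyx :* gxy , (d :* hu ≔ hx :* yz :+ (hy :* zx :+ hz :* 𝟘)))
         ∷ (:- (hx :* gxy) , (d :* gyu ≔ gyx :* yz :+ (𝟘 :* zx :+ gyz :* 𝟘)))
         ∷ (:- (hy :* gyx) , (d :* gxu ≔ 𝟘 :* yz :+ (gxy :* zx :+ gxz :* 𝟘))) ∷ [])
        refl (det x y z) (h · u) gyx gxy (h · x) (y.g · u) (h · y) (x.g · u) (h · z) (det y z u) (det z x u) (y.g · z) (x.g · z)
        (trans (cramer h x y z u) (cong (λ t → ((h · x) *F det y z u) +F (((h · y) *F det z x u) +F ((h · z) *F t))) xyu))
        (trans (cramer y.g x y z u) (cong₂ (λ t r → (gyx *F det y z u) +F ((r *F det z x u) +F ((y.g · z) *F t))) xyu y.g-on))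
        (trans (cramer x.g x y z u) (cong₂ (λ t r → (r *F det y z u) +F ((gxy *F det z x u) +F ((x.g · z) *F t))) xyu x.g-on))))
      where xyu = on⇒det u Zu

    -- `h / f₁` is an affine function with gradient `(A h , B h)`. Scaled to `f₁`-value 1, the
    -- points `t` and `s` differ by a vector on `f₁`, where `span` applies.
    chord-value : ∀ h s t → f₁ · s ≢ 0F → f₁ · t ≢ 0F → h · s ≡ 0F →
      (h · t) *F inv (f₁ · t) ≡ (A h *F (ξ t -F ξ s)) +F (B h *F (υ t -F υ s))
    chord-value h s t Zs Zt hs =
      solve 17 (λ ht it hx hy gyt gys gxt gxs is gyw iyw gyx iyx gxw ixw gxy ixy →
        let U = it :* gyt :- is :* gys ; V = it :* gxt :- is :* gxs ; W = it :* ht in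
        ht :* it ≔ (((hx :* gyw) :* iyx) :* (((gyt :* iyw) :* it) :- ((gys :* iyw) :* is))) :+ (((hy :* gxw) :* ixy) :* (((gxt :* ixw) :* it) :- ((gxs :* ixw) :* is)))
        by (iyx :* ixy , (W :* (gyx :* gxy) ≔ ((hx :* U) :* gxy) :+ ((hy :* V) :* gyx)))
         ∷ (hy :* V :* ixy :- W :* gxy :* ixy , (gyx :* iyx ≔ 𝟙)) ∷ (hx :* U :* iyx :- W , (gxy :* ixy ≔ 𝟙))
         ∷ (:- (hx :* U :* iyx) , (gyw :* iyw ≔ 𝟙)) ∷ (:- (hy :* V :* ixy) , (gxw :* ixw ≔ 𝟙)) ∷ [])
        refl (h · t) (inv (f₁ · t)) (h · x) (h · y) (y.g · t) (y.g · s) (x.g · t) (x.g · s) (inv (f₁ · s))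
        gyw (inv gyw) gyx (inv gyx) gxw (inv gxw) gxy (inv gxy)
        (trans (cong (_*F (gyx *F gxy)) (sym hu)) (trans (span Zs h u f₁u)
          (cong₂ (λ a b → (((h · x) *F a) *F gxy) +F (((h · y) *F b) *F gyx)) (at y.g) (at x.g))))
        (inv-right gyx≢0) (inv-right gxy≢0) (inv-right gyw≢0) (inv-right gxw≢0)
      where
      u = (inv (f₁ · t) • t) -V (inv (f₁ · s) • s)
      at : ∀ l → l · u ≡ (inv (f₁ · t) *F (l · t)) -F (inv (f₁ · s) *F (l · s))
      at l = trans (·--ʳ l _ _) (cong₂ _-F_ (·-•ʳ (inv (f₁ · t)) l t) (·-•ʳ (inv (f₁ · s)) l s))
      f₁u : f₁ · u ≡ 0F
      f₁u = trans (at f₁) (solve 4 (λ a i b j → i :* a :- j :* b ≔ 𝟘 by (𝟙 , (a :* i ≔ 𝟙)) ∷ (:- 𝟙 , (b :* j ≔ 𝟙)) ∷ []) refl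
        (f₁ · t) (inv (f₁ · t)) (f₁ · s) (inv (f₁ · s)) (inv-right Zt) (inv-right Zs))
      hu : h · u ≡ inv (f₁ · t) *F (h · t)
      hu = trans (at h) (solve 3 (λ a j b → a :- j :* b ≔ a by (:- j , (b ≔ 𝟘)) ∷ []) refl (inv (f₁ · t) *F (h · t)) (inv (f₁ · s)) (h · s) hs)

    -- The direction of `w` is `(1 , 1)`.
    base-value : ∀ {z} → f₁ · z ≢ 0F → ∀ h → h · w ≡ A h +F B h
    base-value Zz h = solve 9 (λ hw hx hy gyw gxw gyx iyx gxy ixy → hw ≔ ((hx :* gyw) :* iyx) :+ ((hy :* gxw) :* ixy)
        by (iyx :* ixy , (hw :* (gyx :* gxy) ≔ ((hx :* gyw) :* gxy) :+ ((hy :* gxw) :* gyx)))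
         ∷ (:- (hw :* gxy :* ixy) :+ hy :* gxw :* ixy , (gyx :* iyx ≔ 𝟙)) ∷ (:- hw :+ hx :* gyw :* iyx , (gxy :* ixy ≔ 𝟙)) ∷ [])
      refl (h · w) (h · x) (h · y) gyw gxw gyx (inv gyx) gxy (inv gxy) (span Zz h w w-on) (inv-right gyx≢0) (inv-right gxy≢0)

    A≢0 : ∀ h → h · x ≢ 0F → A h ≢ 0F
    A≢0 h hx = *-nonzero (*-nonzero hx gyw≢0) (inv-nonzero gyx≢0)

    B≢0 : ∀ h → h · y ≢ 0F → B h ≢ 0F
    B≢0 h hy = *-nonzero (*-nonzero hy gxw≢0) (inv-nonzero gxy≢0)

    off : ∀ {z} (Gz : Good z) → Good.f Gz ≢ f₁ → f₁ · z ≢ 0F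
    off Gz ne = avoids Gz Gx (≢-sym ne)

    off⇒≢x : ∀ {z} → f₁ · z ≢ 0F → z ≢ x
    off⇒≢x Zz refl = Zz x.f-on

    off⇒≢y : ∀ {z} → f₁ · z ≢ 0F → z ≢ y
    off⇒≢y Zz refl = Zz y-on

    off⇒≢w : ∀ {z} → f₁ · z ≢ 0F → z ≢ w
    off⇒≢w Zz refl = Zz w-on

    υ≢0 : ∀ {z} → z ∈ S → f₁ · z ≢ 0F → υ z ≢ 0F
    υ≢0 i Zz = *-nonzero (*-nonzero (tangent-off Gx i (off⇒≢x Zz)) (inv-nonzero gxw≢0)) (inv-nonzero Zz)

    -- This is `segre-trisecant` for `x`, `y`, `z`, after `cramer` has replaced the determinants
    -- with `w` by tangent values at `w`.
    tangent-direction : ∀ {z} (Gz : Good z) → Good.f Gz ≢ f₁ →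
      υ z *F (B (Good.g Gz) *F A (Good.f Gz)) ≡ -F (ξ z *F (B (Good.f Gz) *F A (Good.g Gz)))
    tangent-direction {z} Gz ne =
      solve 13 (λ gxz ixw iz gzy gxw ixy fzx gyw iyx gyz iyw fzy gzx →
        ((gxz :* ixw) :* iz) :* (((gzy :* gxw) :* ixy) :* ((fzx :* gyw) :* iyx)) ≔
        :- (((gyz :* iyw) :* iz) :* (((fzy :* gxw) :* ixy) :* ((gzx :* gyw) :* iyx)))
        by (iz :* ixy :* iyx , (gyw :* (gxz :* (gzy :* fzx)) ≔ :- (gxw :* (gyz :* (fzy :* gzx)))))
         ∷ (gyw :* gxz :* gzy :* fzx :* iz :* ixy :* iyx , (gxw :* ixw ≔ 𝟙))
         ∷ (gxw :* gyz :* fzy :* gzx :* iz :* ixy :* iyx , (gyw :* iyw ≔ 𝟙)) ∷ [])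
        refl (x.g · z) (inv gxw) (inv (f₁ · z)) (z.g · y) gxw (inv gxy) (z.f · x) gyw (inv gyx) (y.g · z) (inv gyw) (z.f · y) (z.g · x)
        reduced (inv-right gxw≢0) (inv-right gyw≢0)
      where
      module z = Good Gz
      Zz = off Gz ne
      Δ≢0 : det x y z ≢ 0F
      Δ≢0 e = Zz (det⇒on z e)
      fzy : z.f · y ≢ 0F
      fzy = avoids Gy Gz (λ e → ne (trans e same))
      w-det = on⇒det w w-on
      reduced : gyw *F ((x.g · z) *F ((z.g · y) *F (z.f · x))) ≡ -F (gxw *F ((y.g · z) *F ((z.f · y) *F (z.g · x))))
      reduced = x-y≡0⇒x≡y (cancelˡ Δ≢0
        (solve 13 (λ d gyw gxw gyx gxy yzw zxw gxz gzy fzx gyz fzy gzx →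
          d :* ((gyw :* (gxz :* (gzy :* fzx))) :- (:- (gxw :* (gyz :* (fzy :* gzx))))) ≔ 𝟘
          by (gxz :* gzy :* fzx , (d :* gyw ≔ gyx :* yzw :+ (𝟘 :* zxw :+ gyz :* 𝟘)))
           ∷ (gyz :* fzy :* gzx , (d :* gxw ≔ 𝟘 :* yzw :+ (gxy :* zxw :+ gxz :* 𝟘)))
           ∷ (𝟙 , (yzw :* (gxz :* (gyx :* (gzy :* fzx))) ≔ :- (zxw :* (gxy :* (gyz :* (fzy :* gzx)))))) ∷ [])
          refl (det x y z) gyw gxw gyx gxy (det y z w) (det z x w) (x.g · z) (z.g · y) (z.f · x) (y.g · z) (z.f · y) (z.g · x)
          (trans (cramer y.g x y z w) (cong₂ (λ t r → (gyx *F det y z w) +F ((r *F det z x w) +F ((y.g · z) *F t))) w-det y.g-on))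
          (trans (cramer x.g x y z w) (cong₂ (λ t r → (r *F det y z w) +F ((gxy *F det z x w) +F ((x.g · z) *F t))) w-det x.g-on))
          (segre-trisecant Gx Gy Gz x≢y (≢-sym (off⇒≢y Zz)) (off⇒≢x Zz) w w∈S w≢x w≢y (≢-sym (off⇒≢w Zz)) w-det
            (λ i e → only i (det⇒on _ e)) y-on (trans (cong (_· x) same) x.f-on) Zz (λ e → Zz (trans (cong (_· z) (sym same)) e))
            (avoids Gx Gz ne) fzy)))

    -- This is `segre-generic` for the triangle `x`, `z`, `t`: the tangent at `x` gives `υ`, the
    -- values of `f₁` are divided out, and the remaining values come from `chord-value`.
    segre-base : ∀ {z t} (Gz : Good z) (Gt : Good t) → Good.f Gz ≢ f₁ → Good.f Gt ≢ f₁ → Good.f Gz ≢ Good.f Gt →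
      let fz = Good.f Gz ; gz = Good.g Gz ; ft = Good.f Gt ; gt = Good.g Gt ; v₁ = ξ t -F ξ z ; v₂ = υ t -F υ z in
      (υ t *F (A gz *F A ft)) *F (((A fz *F v₁) +F (B fz *F v₂)) *F ((A gt *F v₁) +F (B gt *F v₂))) ≡
      -F ((υ z *F (A fz *F A gt)) *F (((A gz *F v₁) +F (B gz *F v₂)) *F ((A ft *F v₁) +F (B ft *F v₂))))
    segre-base {z} {t} Gz Gt nz nt zt =
      trans (cong (λ a → (υ t *F (A z.g *F A t.f)) *F a) (cong₂ _*F_ (sym fzt) gtz))
        (trans scaled (cong (λ a → -F ((υ z *F (A z.f *F A t.g)) *F a)) (cong₂ _*F_ gzt ftz)))
      where
      module z = Good Gz
      module t = Good Gt
      Zz = off Gz nz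
      Zt = off Gt nt
      z≢t : z ≢ t
      z≢t refl = zt (good-trisecant Gt z.f z.f-normal z.f-on z.f-three)
      backwards : ∀ h → h · t ≡ 0F → (A h *F (ξ t -F ξ z)) +F (B h *F (υ t -F υ z)) ≡ -F ((h · z) *F inv (f₁ · z))
      backwards h ht = trans (solve 6 (λ a b p r s u → (a :* (p :- r)) :+ (b :* (s :- u)) ≔ :- ((a :* (r :- p)) :+ (b :* (u :- s))) by [])
        refl (A h) (B h) (ξ t) (ξ z) (υ t) (υ z)) (cong -F_ (sym (chord-value h t z Zt Zz ht)))
      fzt = chord-value z.f z t Zz Zt z.f-on
      gzt = chord-value z.g z t Zz Zt z.g-on
      gtz = backwards t.g t.g-on
      ftz = sym (backwards t.f t.f-on)
      scaled : (υ t *F (A z.g *F A t.f)) *F (((z.f · t) *F inv (f₁ · t)) *F (-F ((t.g · z) *F inv (f₁ · z)))) ≡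
        -F ((υ z *F (A z.f *F A t.g)) *F (((z.g · t) *F inv (f₁ · t)) *F (-F ((t.f · z) *F inv (f₁ · z)))))
      scaled = solve 17 (λ gxt gxz ixw Zz iz Zt it gzx ftx fzx gtx gyw iyx fzt gtz gzt ftz →
          let K = ixw :* (gyw :* iyx) :* (gyw :* iyx) :* it :* iz
              P = gxt :* gzx :* fzt :* gtz :* ftx ; R = gxz :* fzx :* gzt :* ftz :* gtx in
          (((gxt :* ixw) :* it) :* (((gzx :* gyw) :* iyx) :* ((ftx :* gyw) :* iyx))) :* ((fzt :* it) :* (:- (gtz :* iz))) ≔
          :- ((((gxz :* ixw) :* iz) :* (((fzx :* gyw) :* iyx) :* ((gtx :* gyw) :* iyx))) :* ((gzt :* it) :* (:- (ftz :* iz))))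
          by (:- (K :* it :* iz) , ((gxt :* Zz) :* ((gzx :* fzt) :* (gtz :* ftx)) ≔ :- ((Zt :* gxz) :* ((fzx :* gzt) :* (ftz :* gtx)))))
           ∷ (K :* P :* it , (Zz :* iz ≔ 𝟙)) ∷ (K :* R :* iz , (Zt :* it ≔ 𝟙)) ∷ [])
        refl (x.g · t) (x.g · z) (inv gxw) (f₁ · z) (inv (f₁ · z)) (f₁ · t) (inv (f₁ · t)) (z.g · x) (t.f · x) (z.f · x) (t.g · x)
        gyw (inv gyx) (z.f · t) (t.g · z) (z.g · t) (t.f · z)
        (segre-generic Gx Gz Gt (≢-sym (off⇒≢x Zz)) z≢t (off⇒≢x Zt) Zz Zt
          (avoids Gt Gz zt) (avoids Gx Gz nz) (avoids Gx Gt nt) (avoids Gz Gt (≢-sym zt)))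
        (inv-right Zz) (inv-right Zt)

    -- Directions determine the forms of the two lines only up to the scalars `k` and `m`, which
    -- later cancel. The trisecant at `z` has direction `(d₁ , d₂)`.
    record Directed {z : V} (Gz : Good z) (d₁ d₂ : Fin q) : Set where
      field
        new : Good.f Gz ≢ f₁
        k m : Fin q
        k≢0 : k ≢ 0F
        m≢0 : m ≢ 0F
        Af  : A (Good.f Gz) ≡ -F (k *F d₂)
        Bf  : B (Good.f Gz) ≡ k *F d₁
        Ag  : A (Good.g Gz) ≡ m *F (υ z *F d₂)
        Bg  : B (Good.g Gz) ≡ m *F (ξ z *F d₁)

    directed-conj : ∀ {z t} (Gz : Good z) (Gt : Good t) {d₁ d₂ e₁ e₂} → Directed Gz d₁ d₂ → Directed Gt e₁ e₂ → d₂ ≢ 0F → e₂ ≢ 0F →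
      Good.f Gz ≢ Good.f Gt → affineConj (ξ z) (υ z) d₁ d₂ (ξ t) (υ t) e₁ e₂ ≡ 0F
    directed-conj {z} {t} Gz Gt {d₁} {d₂} {e₁} {e₂} Dz Dt d₂≢0 e₂≢0 zt =
      affineConj-zero (ξ z) (υ z) d₁ d₂ (ξ t) (υ t) e₁ e₂ Dz.k Dt.k Dz.m Dt.m
        (υ≢0 (Good.member Gz) (off Gz Dz.new)) (υ≢0 (Good.member Gt) (off Gt Dt.new)) d₂≢0 e₂≢0 Dz.k≢0 Dt.k≢0 Dz.m≢0 Dt.m≢0
        Dz.Af Dz.Bf Dz.Ag Dz.Bg Dt.Af Dt.Bf Dt.Ag Dt.Bg (segre-base Gz Gt Dz.new Dt.new zt)
      where
      module Dz = Directed Dz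
      module Dt = Directed Dt

    directed : ∀ {z} (Gz : Good z) d₁ d₂ → Good.f Gz ≢ f₁ → d₁ ≢ 0F → d₂ ≢ 0F →
      (A (Good.f Gz) *F d₁) +F (B (Good.f Gz) *F d₂) ≡ 0F → Directed Gz d₁ d₂
    directed {z} Gz d₁ d₂ ne d₁≢0 d₂≢0 along = record
      { new = ne
      ; k = k ; m = m
      ; k≢0 = *-nonzero Bf≢0 (inv-nonzero d₁≢0)
      ; m≢0 = *-nonzero (A≢0 z.g (tangent-off Gz x.member (≢-sym (off⇒≢x Zz)))) (inv-nonzero υd≢0)
      ; Af = solve 5 (λ a b d e i → a ≔ :- ((b :* i) :* e) by (i , ((a :* d) :+ (b :* e) ≔ 𝟘)) ∷ (:- a , (d :* i ≔ 𝟙)) ∷ [])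
          refl (A z.f) (B z.f) d₁ d₂ (inv d₁) along (inv-right d₁≢0)
      ; Bf = solve 3 (λ b d i → b ≔ (b :* i) :* d by (:- b , (d :* i ≔ 𝟙)) ∷ []) refl (B z.f) d₁ (inv d₁) (inv-right d₁≢0)
      ; Ag = solve 3 (λ a u j → a ≔ (a :* j) :* u by (:- a , (u :* j ≔ 𝟙)) ∷ []) refl (A z.g) (υ z *F d₂) (inv (υ z *F d₂)) (inv-right υd≢0)
      ; Bg = cancel-Af
      }
      where
      module z = Good Gz
      Zz = off Gz ne
      υd≢0 : υ z *F d₂ ≢ 0F
      υd≢0 = *-nonzero (υ≢0 z.member Zz) d₂≢0
      Bf≢0 : B z.f ≢ 0F
      Bf≢0 = B≢0 z.f (avoids Gy Gz (λ e → ne (trans e same)))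
      k = B z.f *F inv d₁
      m = A z.g *F inv (υ z *F d₂)
      cancel-Af : B z.g ≡ m *F (ξ z *F d₁)
      cancel-Af = x-y≡0⇒x≡y (cancelˡ Bf≢0
        (solve 9 (λ af bf ag bg d e j u x → bf :* (bg :- ((ag :* j) :* (x :* d))) ≔ 𝟘
          by (:- (bf :* bg) , ((u :* e) :* j ≔ 𝟙)) ∷ (u :* bg :* j , ((af :* d) :+ (bf :* e) ≔ 𝟘)) ∷ (:- (j :* d) , (u :* (bg :* af) ≔ :- (x :* (bf :* ag)))) ∷ [])
          refl (A z.f) (B z.f) (A z.g) (B z.g) d₁ d₂ (inv (υ z *F d₂)) (υ z) (ξ z) (inv-right υd≢0) along (tangent-direction Gz ne)))

  -- Trisecants as chords

  ½ : Fin q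
  ½ = inv (1F +F 1F)

  ½+½ : (1F +F 1F) *F ½ ≡ 1F
  ½+½ = inv-right char≢2

  conj-cong : ∀ {φ zp zs ψ wp ws zp′ zs′ wp′ ws′} → zp′ ≡ zp → zs′ ≡ zs → wp′ ≡ wp → ws′ ≡ ws →
    conj φ zp zs ψ wp ws ≡ 0F → conj φ zp′ zs′ ψ wp′ ws′ ≡ 0F
  conj-cong refl refl refl refl h = h

  -- In `p = ξ − υ` and `s = ξ + υ` the direction `(d₁ , d₂)` has slope `(d₁ + d₂) / (d₁ − d₂)`;
  -- clearing the two denominators turns `conj` into `8 affineConj`.
  conj-rotate : ∀ φ ψ z₁ z₂ d₁ d₂ t₁ t₂ e₁ e₂ → d₁ -F d₂ ≢ 0F → e₁ -F e₂ ≢ 0F →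
    φ *F (d₁ -F d₂) ≡ d₁ +F d₂ → ψ *F (e₁ -F e₂) ≡ e₁ +F e₂ → affineConj z₁ z₂ d₁ d₂ t₁ t₂ e₁ e₂ ≡ 0F →
    conj φ (z₁ -F z₂) (z₁ +F z₂) ψ (t₁ -F t₂) (t₁ +F t₂) ≡ 0F
  conj-rotate φ ψ z₁ z₂ d₁ d₂ t₁ t₂ e₁ e₂ dp≢0 ep≢0 hφ hψ h = cancelˡ (*-nonzero dp≢0 ep≢0)
    (solve 10 (λ φ ψ z₁ z₂ d₁ d₂ t₁ t₂ e₁ e₂ →
      -- `conj` has degree one in each slope, so its coefficients are found from its values at 0 and
      -- 1; `R b` is `(d₁ − d₂) C φ b` with `φ` eliminated.
      let C = λ a b → E.conj a (z₁ :- z₂) (z₁ :+ z₂) b (t₁ :- t₂) (t₁ :+ t₂)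
          R = λ b → (d₁ :+ d₂) :* (C 𝟙 b :- C 𝟘 b) :+ (d₁ :- d₂) :* C 𝟘 b in
      ((d₁ :- d₂) :* (e₁ :- e₂)) :* C φ ψ ≔ 𝟘
      by ((e₁ :- e₂) :* (C 𝟙 ψ :- C 𝟘 ψ) , (φ :* (d₁ :- d₂) ≔ d₁ :+ d₂)) ∷ (R 𝟙 :- R 𝟘 , (ψ :* (e₁ :- e₂) ≔ e₁ :+ e₂))
       ∷ (E.two :* E.two :* E.two , (E.affineConj z₁ z₂ d₁ d₂ t₁ t₂ e₁ e₂ ≔ 𝟘)) ∷ [])
      refl φ ψ z₁ z₂ d₁ d₂ t₁ t₂ e₁ e₂ hφ hψ h)

  module Arms {x y w : V} (Gx : Good x) (Gy : Good y) (x≢y : x ≢ y) (same : Good.f Gy ≡ Good.f Gx)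
    (w∈S : w ∈ S) (w≢x : w ≢ x) (w≢y : w ≢ y) (w-on : Good.f Gx · w ≡ 0F)
    (only : ∀ {s} → s ∈ S → Good.f Gx · s ≡ 0F → s ≡ x ⊎ s ≡ y ⊎ s ≡ w) where

    open Frame Gx Gy x≢y same w∈S w≢x w≢y w-on only

    record Arm : Set where
      field
        a b    : V
        Ga     : Good a
        Gb     : Good b
        a≢b    : a ≢ b
        common : Good.f Gb ≡ Good.f Ga
        new    : Good.f Ga ≢ f₁
        off-w  : Good.f Ga · w ≢ 0F

      line : V
      line = Good.f Ga

      new-b : Good.f Gb ≢ f₁
      new-b e = new (trans (sym common) e)

      Za : f₁ · a ≢ 0F
      Za = off Ga new
      Zb : f₁ · b ≢ 0F
      Zb = off Gb new-b

      d₁ d₂ : Fin q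
      d₁ = ξ a -F ξ b
      d₂ = υ a -F υ b

      along : (A line *F d₁) +F (B line *F d₂) ≡ 0F
      along = trans (sym (chord-value line b a Zb Za (trans (cong (_· b) (sym common)) (Good.f-on Gb))))
        (trans (cong (_*F inv (f₁ · a)) (Good.f-on Ga)) (zeroˡ _))

      -- Otherwise `a` and `b` would have equal coordinates, and the tangent at `b` would contain
      -- `a`.
      apart-points : d₁ ≡ 0F → d₂ ≡ 0F → ⊥
      apart-points d₁≡0 d₂≡0 = *-nonzero (tangent-off Gb (Good.member Ga) a≢b) (inv-nonzero Za)
        (trans (chord-value (Good.g Gb) b a Zb Za (Good.g-on Gb))
          (solve 4 (λ p r d e → (p :* d) :+ (r :* e) ≔ 𝟘 by (p , (d ≔ 𝟘)) ∷ (r , (e ≔ 𝟘)) ∷ []) refl (A (Good.g Gb)) (B (Good.g Gb)) d₁ d₂ d₁≡0 d₂≡0))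

      d₁≢0 : d₁ ≢ 0F
      d₁≢0 e = apart-points e (cancelˡ (B≢0 line (avoids Gy Ga (λ p → new (trans p same))))
        (solve 4 (λ p r d e → r :* e ≔ 𝟘 by (𝟙 , ((p :* d) :+ (r :* e) ≔ 𝟘)) ∷ (:- p , (d ≔ 𝟘)) ∷ []) refl (A line) (B line) d₁ d₂ along e))
      d₂≢0 : d₂ ≢ 0F
      d₂≢0 e = apart-points (cancelˡ (A≢0 line (avoids Gx Ga new))
        (solve 4 (λ p r d e → p :* d ≔ 𝟘 by (𝟙 , ((p :* d) :+ (r :* e) ≔ 𝟘)) ∷ (:- r , (e ≔ 𝟘)) ∷ []) refl (A line) (B line) d₁ d₂ along e)) e

      Da : Directed Ga d₁ d₂
      Da = directed Ga d₁ d₂ new d₁≢0 d₂≢0 along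
      Db : Directed Gb d₁ d₂
      Db = directed Gb d₁ d₂ new-b d₁≢0 d₂≢0 (trans (cong (λ l → (A l *F d₁) +F (B l *F d₂)) common) along)

      -- Equal components would be the direction of `w`, which the line misses.
      dp≢0 : d₁ -F d₂ ≢ 0F
      dp≢0 e = off-w (trans (base-value Za line) (trans (cong₂ _+F_ (Directed.Af Da) (Directed.Bf Da))
        (solve 3 (λ k d e → (:- (k :* e)) :+ (k :* d) ≔ 𝟘 by (k , (d :- e ≔ 𝟘)) ∷ []) refl (Directed.k Da) d₁ d₂ e)))

      φ₀ : Fin q
      φ₀ = (d₁ +F d₂) *F inv (d₁ -F d₂)

      φ₀-eq : φ₀ *F (d₁ -F d₂) ≡ d₁ +F d₂
      φ₀-eq = solve 3 (λ s d i → (s :* i) :* d ≔ s by (s , (d :* i ≔ 𝟙)) ∷ []) refl (d₁ +F d₂) (d₁ -F d₂) _ (inv-right dp≢0)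

      pa sa pb sb : Fin q
      pa = ξ a -F υ a
      sa = ξ a +F υ a
      pb = ξ b -F υ b
      sb = ξ b +F υ b

      μ₀ κ₀ τ₀ : Fin q
      μ₀ = ½ *F (pa +F pb)
      κ₀ = ½ *F (sa +F sb)
      τ₀ = ½ *F (pa -F pb)

      μ+τ : μ₀ +F τ₀ ≡ pa
      μ+τ = solve 3 (λ p r h → h :* (p :+ r) :+ h :* (p :- r) ≔ p by (p , (E.two :* h ≔ 𝟙)) ∷ []) refl pa pb ½ ½+½
      μ-τ : μ₀ -F τ₀ ≡ pb
      μ-τ = solve 3 (λ p r h → h :* (p :+ r) :- h :* (p :- r) ≔ r by (r , (E.two :* h ≔ 𝟙)) ∷ []) refl pa pb ½ ½+½

      φτ : φ₀ *F τ₀ ≡ ½ *F (sa -F sb)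
      φτ = solve 6 (λ φ h x y u v → φ :* (h :* ((x :- y) :- (u :- v))) ≔ h :* ((x :+ y) :- (u :+ v))
          by (h , (φ :* ((x :- u) :- (y :- v)) ≔ (x :- u) :+ (y :- v))) ∷ [])
        refl φ₀ ½ (ξ a) (υ a) (ξ b) (υ b) φ₀-eq

      κ+φτ : κ₀ +F (φ₀ *F τ₀) ≡ sa
      κ+φτ = trans (cong (κ₀ +F_) φτ) (solve 3 (λ p r h → h :* (p :+ r) :+ h :* (p :- r) ≔ p by (p , (E.two :* h ≔ 𝟙)) ∷ []) refl sa sb ½ ½+½)
      κ-φτ : κ₀ -F (φ₀ *F τ₀) ≡ sb
      κ-φτ = trans (cong (λ t → κ₀ -F t) φτ) (solve 3 (λ p r h → h :* (p :+ r) :- h :* (p :- r) ≔ r by (r , (E.two :* h ≔ 𝟙)) ∷ []) refl sa sb ½ ½+½)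

      p-s≢0 : ∀ {z} → z ∈ S → f₁ · z ≢ 0F → (ξ z -F υ z) -F (ξ z +F υ z) ≢ 0F
      p-s≢0 {z} i Zz e = *-nonzero char≢2 (υ≢0 i Zz)
        (solve 2 (λ x u → E.two :* u ≔ 𝟘 by (:- 𝟙 , ((x :- u) :- (x :+ u) ≔ 𝟘)) ∷ []) refl (ξ z) (υ z) e)

      chord : Chord
      chord = record
        { φ = φ₀ ; μ = μ₀ ; κ = κ₀ ; τ = τ₀
        ; τ≢0 = *-nonzero (inv-nonzero char≢2) (λ e → dp≢0
            (solve 4 (λ x y u v → (x :- u) :- (y :- v) ≔ 𝟘 by (𝟙 , ((x :- y) :- (u :- v) ≔ 𝟘)) ∷ []) refl (ξ a) (υ a) (ξ b) (υ b) e))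
        ; off₊ = λ e → p-s≢0 (Good.member Ga) Za (trans (sym (cong₂ _-F_ μ+τ κ+φτ)) e)
        ; off₋ = λ e → p-s≢0 (Good.member Gb) Zb (trans (sym (cong₂ _-F_ μ-τ κ-φτ)) e)
        }

    conjugate : ∀ (r r′ : Arm) → Arm.line r ≢ Arm.line r′ → Conjugate (Arm.chord r) (Arm.chord r′)
    conjugate r r′ ne = record
      { pp≡0 = conj-cong r.μ+τ r.κ+φτ r′.μ+τ r′.κ+φτ (rotate (directed-conj r.Ga r′.Ga r.Da r′.Da r.d₂≢0 r′.d₂≢0 ne))
      ; pm≡0 = conj-cong r.μ+τ r.κ+φτ r′.μ-τ r′.κ-φτ (rotate (directed-conj r.Ga r′.Gb r.Da r′.Db r.d₂≢0 r′.d₂≢0 (λ e → ne (trans e r′.common))))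
      ; mp≡0 = conj-cong r.μ-τ r.κ-φτ r′.μ+τ r′.κ+φτ (rotate (directed-conj r.Gb r′.Ga r.Db r′.Da r.d₂≢0 r′.d₂≢0 (λ e → ne (trans (sym r.common) e))))
      ; mm≡0 = conj-cong r.μ-τ r.κ-φτ r′.μ-τ r′.κ-φτ (rotate (directed-conj r.Gb r′.Gb r.Db r′.Db r.d₂≢0 r′.d₂≢0
          (λ e → ne (trans (sym r.common) (trans e r′.common)))))
      ; apart = λ e → separate (trans (sym (cong₂ _-F_ (cong₂ _-F_ r.κ+φτ r′.κ+φτ) (cong (r′.φ₀ *F_) (cong₂ _-F_ r.μ+τ r′.μ+τ)))) e)
      }
      where
      module r = Arm r
      module r′ = Arm r′
      rotate : ∀ {z₁ z₂ t₁ t₂} → affineConj z₁ z₂ r.d₁ r.d₂ t₁ t₂ r′.d₁ r′.d₂ ≡ 0F →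
        conj r.φ₀ (z₁ -F z₂) (z₁ +F z₂) r′.φ₀ (t₁ -F t₂) (t₁ +F t₂) ≡ 0F
      rotate {z₁} {z₂} {t₁} {t₂} = conj-rotate r.φ₀ r′.φ₀ z₁ z₂ r.d₁ r.d₂ t₁ t₂ r′.d₁ r′.d₂ r.dp≢0 r′.dp≢0 r.φ₀-eq r′.φ₀-eq
      -- Vanishing would put the good point `r.a` on `r′.line`, which is not its own trisecant.
      separate : (r.sa -F r′.sa) -F (r′.φ₀ *F (r.pa -F r′.pa)) ≢ 0F
      separate e = *-nonzero (avoids r.Ga r′.Ga (≢-sym ne)) (inv-nonzero r.Za)
        (cancelˡ char≢2
          (solve 11 (λ h Af Bf k d₁ d₂ φ x y u v → E.two :* h ≔ 𝟘
            by (E.two , (h ≔ (Af :* (x :- u)) :+ (Bf :* (y :- v))))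
             ∷ (E.two :* (x :- u) , (Af ≔ :- (k :* d₂))) ∷ (E.two :* (y :- v) , (Bf ≔ k :* d₁))
             ∷ (k :* (d₁ :- d₂) , (((x :+ y) :- (u :+ v)) :- φ :* ((x :- y) :- (u :- v)) ≔ 𝟘))
             ∷ (k :* ((x :- y) :- (u :- v)) , (φ :* (d₁ :- d₂) ≔ d₁ :+ d₂)) ∷ [])
            refl _ (A r′.line) (B r′.line) (Directed.k r′.Da) r′.d₁ r′.d₂ r′.φ₀ (ξ r.a) (υ r.a) (ξ r′.a) (υ r′.a)
            (chord-value r′.line r′.a r.a r′.Za r.Za (Good.f-on r′.Ga)) (Directed.Af r′.Da) (Directed.Bf r′.Da) e r′.φ₀-eq))

  -- The bound on the number of chords

  module ArmBound {x y w : V} (Gx : Good x) (Gy : Good y) (x≢y : x ≢ y) (same : Good.f Gy ≡ Good.f Gx)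
    (w∈S : w ∈ S) (w≢x : w ≢ x) (w≢y : w ≢ y) (w-on : Good.f Gx · w ≡ 0F)
    (only : ∀ {s} → s ∈ S → Good.f Gx · s ≡ 0F → s ≡ x ⊎ s ≡ y ⊎ s ≡ w) where

    open Arms Gx Gy x≢y same w∈S w≢x w≢y w-on only

    slope : Arm → Fin q
    slope r = Chord.φ (Arm.chord r)

    Distinct : Arm → Arm → Set
    Distinct r s = Arm.line r ≢ Arm.line s

    -- After the first chord parallel to `r` there is no second one, by `no-three-parallel`, so at
    -- most one chord is lost.
    drop-parallel : ∀ r rs → AllPairs Distinct (r ∷ rs) → ∃ λ rs′ → AllPairs Distinct rs′ ×
      All (λ s → slope r ≢ slope s) rs′ × (∀ {s} → s ∈ rs′ → s ∈ rs) × length rs ≤ suc (length rs′)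
    drop-parallel r [] _ = [] , [] , [] , (λ ()) , z≤n
    drop-parallel r (s ∷ rs) ((rs≢ ∷ r≢) ∷ s≢ ∷ u) with slope r ≟ slope s
    ... | yes e = rs , u , All.tabulate (λ {t} i e′ → no-three-parallel (Arm.chord r) (Arm.chord s) (Arm.chord t) e e′
                    (conjugate r s rs≢) (conjugate r t (All.lookup r≢ i)) (conjugate s t (All.lookup s≢ i))) , there , ℕ.≤-refl
    ... | no ne with drop-parallel r rs (r≢ ∷ u)
    ...   | rs′ , u′ , sl , sub , len = s ∷ rs′ , All.tabulate (λ i → All.lookup s≢ (sub i)) ∷ u′ , ne ∷ sl ,
            (λ { (here e) → here e ; (there i) → there (sub i) }) , s≤s len

    -- Greedy choice: each chosen chord uses up itself and at most one parallel chord, and the last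
    -- one needs no partner, hence the `suc`.
    choose-slopes : ∀ k rs → AllPairs Distinct rs → k ℕ.* 2 ≤ suc (length rs) → ∃ λ rs′ → length rs′ ≡ k ×
      AllPairs (λ r s → Distinct r s × slope r ≢ slope s) rs′ × (∀ {s} → s ∈ rs′ → s ∈ rs)
    choose-slopes zero rs u le = [] , refl , [] , λ ()
    choose-slopes (suc k) [] u (s≤s ())
    choose-slopes (suc k) (r ∷ rs) u@(r≢ ∷ _) (s≤s (s≤s le)) with drop-parallel r rs u
    ... | rs₁ , u₁ , sl , sub₁ , len with choose-slopes k rs₁ u₁ (ℕ.≤-trans le len)
    ...   | rs₂ , len₂ , u₂ , sub₂ = r ∷ rs₂ , cong suc len₂ ,
            All.tabulate (λ i → All.lookup r≢ (sub₁ (sub₂ i)) , All.lookup sl (sub₂ i)) ∷ u₂ ,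
            λ { (here e) → here e ; (there i) → there (sub₁ (sub₂ i)) }

    arms-bound : ∀ rs → AllPairs Distinct rs → length rs ≤ 10
    -- Eleven chords would suffice for six slopes, since `6 * 2 ≤ suc 11`.
    arms-bound rs u = ℕ.≮⇒≥ λ lt → too-many (choose-slopes 6 rs u (s≤s lt))
      where
      too-many : (∃ λ rs′ → length rs′ ≡ 6 × AllPairs (λ r s → Distinct r s × slope r ≢ slope s) rs′ × (∀ {s} → s ∈ rs′ → s ∈ rs)) → ⊥
      too-many (rs′ , len , u′ , _) = no-six (map Arm.chord rs′) (trans (length-map Arm.chord rs′) len)
        (AllPairs.map⁺ (AllPairs.map (λ {r} {s} (ne , sl) → conjugate r s ne , sl) u′))

  -- Trisecants with at least two good points

  good? : ∀ s → Dec (tangents s ≡ 1)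
  good? s = tangents s ℕ.≟ 1

  goods : V → ℕ
  goods L = count S (λ s → on? L s ×-dec good? s)

  rich? : ∀ L → Dec (n L ≡ 3 × 2 ≤ goods L)
  rich? L = (n L ℕ.≟ 3) ×-dec (2 ℕ.≤? goods L)

  bad? : ∀ P L → Dec ((n L ≡ 3 × 2 ≤ goods L) × L · P ≢ 0F)
  bad? P L = rich? L ×-dec ¬? (on? L P)

  length-filter≡count : ∀ {A : Set} {P : A → Set} (P? : ∀ a → Dec (P a)) as → length (filter P? as) ≡ count as P?
  length-filter≡count P? [] = refl
  length-filter≡count P? (a ∷ as) with P? a
  ... | yes _ = cong suc (length-filter≡count P? as)
  ... | no _  = length-filter≡count P? as

  record GoodPair (L : V) : Set where
    field
      a b : V
      Ga  : Good a
      Gb  : Good b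
      a≢b : a ≢ b
      La  : L ≡ Good.f Ga
      Lb  : L ≡ Good.f Gb

  goodPair : ∀ {L} → L ∈ lines → n L ≡ 3 → 2 ≤ goods L → GoodPair L
  goodPair {L} i three two = pair (count-≥2 _≟V_ (λ s → on? L s ×-dec good? s) unique two)
    where
    pair : (∃ λ a → ∃ λ b → a ∈ S × b ∈ S × (L · a ≡ 0F × tangents a ≡ 1) × (L · b ≡ 0F × tangents b ≡ 1) × a ≢ b) → GoodPair L
    pair (a , b , ja , jb , (La , ta) , (Lb , tb) , a≢b) = record
      { a = a ; b = b ; Ga = good ja ta ; Gb = good jb tb ; a≢b = a≢b
      ; La = good-trisecant (good ja ta) L (lines-normal i) La three ; Lb = good-trisecant (good jb tb) L (lines-normal i) Lb three }

  bad-bound : ∀ {L a b w} (Ga : Good a) (Gb : Good b) → a ≢ b → L ≡ Good.f Ga → L ≡ Good.f Gb →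
    w ∈ S → L · w ≡ 0F → w ≢ a → w ≢ b → (∀ {s} → s ∈ S → L · s ≡ 0F → s ≡ a ⊎ s ≡ b ⊎ s ≡ w) →
    count lines (bad? w) ≤ 10
  bad-bound {a = a} {b} {w} Ga Gb a≢b refl Lb w∈S Lw w≢a w≢b only =
    subst (_≤ 10) (trans (sym (length-map Arm.line rs)) (trans (cong length lines-of-rs) (length-filter≡count (bad? w) lines)))
      (arms-bound rs (AllPairs.map⁻ (subst Unique (sym lines-of-rs) (filter⁺ (bad? w) lines-unique))))
    where
    open Arms Ga Gb a≢b (sym Lb) w∈S w≢a w≢b Lw only using (Arm; module Arm)
    open ArmBound Ga Gb a≢b (sym Lb) w∈S w≢a w≢b Lw only using (arms-bound)
    arm : ∀ {M} → GoodPair M → M · w ≢ 0F → ∃ λ r → Arm.line r ≡ M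
    arm p Mw = record
      { a = p.a ; b = p.b ; Ga = p.Ga ; Gb = p.Gb ; a≢b = p.a≢b ; common = trans (sym p.Lb) p.La
      ; new = λ e → Mw (trans (cong (_· w) (trans p.La e)) Lw)
      ; off-w = λ e → Mw (trans (cong (_· w) p.La) e) } , sym p.La
      where module p = GoodPair p
    build : ∀ Ls → (∀ {M} → M ∈ Ls → M ∈ lines × (n M ≡ 3 × 2 ≤ goods M) × M · w ≢ 0F) → ∃ λ rs → map Arm.line rs ≡ Ls
    build [] h = [] , refl
    build (M ∷ Ls) h = extend (h (here refl)) (build Ls (λ j → h (there j)))
      where
      extend : (M ∈ lines × (n M ≡ 3 × 2 ≤ goods M) × M · w ≢ 0F) → (∃ λ rs → map Arm.line rs ≡ Ls) → ∃ λ rs → map Arm.line rs ≡ M ∷ Ls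
      extend (j , (three , two) , Mw) (rs , es) = proj₁ r ∷ rs , cong₂ _∷_ (proj₂ r) es
        where r = arm (goodPair j three two) Mw
    arms : ∃ λ rs → map Arm.line rs ≡ filter (bad? w) lines
    arms = build (filter (bad? w) lines) (∈-filter⁻ (bad? w) {xs = lines})
    rs = proj₁ arms
    lines-of-rs = proj₂ arms

  -- If a trisecant has two good points, its third point serves as `P` and its good points set up
  -- the coordinates; if none has, there is nothing to bound and any point of `S` will do.
  few-bad : ∃ λ P → P ∈ S × count lines (bad? P) ≤ 10
  few-bad = by-cases (count lines rich? ℕ.≟ 0)
    where
    some-point : ∀ (s : List V) → length s ≡ q ℕ.+ 2 → ∃ λ P → P ∈ s
    some-point (P ∷ _) _ = P , here refl
    some-point [] e = contradiction (trans e (ℕ.+-comm q 2)) λ ()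

    from-pair : ∀ {L} → n L ≡ 3 → GoodPair L → ∃ λ P → P ∈ S × count lines (bad? P) ≤ 10
    from-pair {L} three p = third (count-3 _≟V_ (on? L) unique (Good.member Ga) (Good.member Gb)
        (trans (cong (_· a) La) (Good.f-on Ga)) (trans (cong (_· b) Lb) (Good.f-on Gb)) a≢b three)
      where
      open GoodPair p
      third : (∃ λ w → w ∈ S × L · w ≡ 0F × w ≢ a × w ≢ b × (∀ {s} → s ∈ S → L · s ≡ 0F → s ≡ a ⊎ s ≡ b ⊎ s ≡ w)) →
        ∃ λ P → P ∈ S × count lines (bad? P) ≤ 10
      third (w , w∈S , Lw , w≢a , w≢b , only) = w , w∈S , bad-bound Ga Gb a≢b La Lb w∈S Lw w≢a w≢b only

    from-line : (∃ λ L → L ∈ lines × n L ≡ 3 × 2 ≤ goods L) → ∃ λ P → P ∈ S × count lines (bad? P) ≤ 10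
    from-line (L , i , three , two) = from-pair three (goodPair i three two)

    from-point : (∃ λ P → P ∈ S) → count lines rich? ≡ 0 → ∃ λ P → P ∈ S × count lines (bad? P) ≤ 10
    from-point (P , i) none = P , i , subst (_≤ 10)
      (sym (∑-zero lines (λ {L} j → 𝟏-no (bad? P L) (λ r → count-none lines rich? none j (proj₁ r))))) z≤n

    by-cases : Dec (count lines rich? ≡ 0) → ∃ λ P → P ∈ S × count lines (bad? P) ≤ 10
    by-cases (yes none) = from-point (some-point S size) none
    by-cases (no some)  = from-line (count-∃ lines rich? (ℕ.n≢0⇒n>0 some))

  -- Counting odd secants

  ∑-*ʳ : ∀ {A : Set} (as : List A) f k → ∑ as (λ a → f a ℕ.* k) ≡ ∑ as f ℕ.* k
  ∑-*ʳ as f k = trans (∑-cong as (λ {a} _ → ℕ.*-comm (f a) k)) (trans (∑-*ˡ as k f) (ℕ.*-comm k _))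

  few-allBisecant : count S (λ s → tangents s ℕ.≟ 0) ≤ 2
  few-allBisecant = ℕ.≮⇒≥ λ lt → two lt (count-≥2 _≟V_ zero? unique (ℕ.≤-trans (ℕ.n≤1+n 2) lt))
    where
    zero? : ∀ s → Dec (tangents s ≡ 0)
    zero? s = tangents s ℕ.≟ 0
    two : 3 ≤ count S zero? → (∃ λ a → ∃ λ b → a ∈ S × b ∈ S × tangents a ≡ 0 × tangents b ≡ 0 × a ≢ b) → ⊥
    two lt (a , b , i , j , ta , tb , a≢b) = three (count-∃ S (without? _≟V_ (without? _≟V_ zero? a) b)
        (ℕ.+-cancelˡ-≤ 2 _ _ (subst (3 ≤_) (count-remove₂ _≟V_ zero? unique i j ta tb a≢b) lt)))
      where
      three : (∃ λ c → c ∈ S × (tangents c ≡ 0 × c ≢ a) × c ≢ b) → ⊥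
      three (c , k , (tc , c≢a) , c≢b) =
        no-three-allBisecant (allBisecant i ta) (allBisecant j tb) (allBisecant k tc) a≢b (≢-sym c≢b) c≢a

  N₃ : ℕ
  N₃ = count lines (λ L → n L ℕ.≟ 3)

  -- Double counting of the incident pairs of a point with `P?` and a line with `R?`.
  incidences : ∀ {P : V → Set} (P? : ∀ s → Dec (P s)) {R : V → Set} (R? : ∀ L → Dec (R L)) →
    ∑ lines (λ L → count S (λ s → on? L s ×-dec P? s) ℕ.* 𝟏 (R? L)) ≡ ∑ S (λ s → 𝟏 (P? s) ℕ.* count (pencil s) R?)
  incidences P? R? = begin
    ∑ lines (λ L → ∑ S (λ s → 𝟏 (on? L s ×-dec P? s)) ℕ.* 𝟏 (R? L))
      ≡⟨ ∑-cong lines (λ {L} _ → sym (∑-*ʳ S (λ s → 𝟏 (on? L s ×-dec P? s)) (𝟏 (R? L)))) ⟩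
    ∑ lines (λ L → ∑ S (λ s → 𝟏 (on? L s ×-dec P? s) ℕ.* 𝟏 (R? L)))
      ≡⟨ ∑-swap lines S _ ⟩
    ∑ S (λ s → ∑ lines (λ L → 𝟏 (on? L s ×-dec P? s) ℕ.* 𝟏 (R? L)))
      ≡⟨ ∑-cong S (λ {s} _ → at s) ⟩
    ∑ S (λ s → 𝟏 (P? s) ℕ.* count (pencil s) R?) ∎
    where
    open ≡-Reasoning
    rearrange : ∀ s L → 𝟏 (on? L s ×-dec P? s) ℕ.* 𝟏 (R? L) ≡ 𝟏 (P? s) ℕ.* (𝟏 (on? L s) ℕ.* 𝟏 (R? L))
    rearrange s L = trans (cong (ℕ._* 𝟏 (R? L)) (trans (sym (𝟏-× (on? L s) (P? s))) (ℕ.*-comm (𝟏 (on? L s)) (𝟏 (P? s)))))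
      (ℕ.*-assoc (𝟏 (P? s)) (𝟏 (on? L s)) (𝟏 (R? L)))
    at : ∀ s → ∑ lines (λ L → 𝟏 (on? L s ×-dec P? s) ℕ.* 𝟏 (R? L)) ≡ 𝟏 (P? s) ℕ.* count (pencil s) R?
    at s = trans (∑-cong lines (λ {L} _ → rearrange s L)) (trans (∑-*ˡ lines (𝟏 (P? s)) (λ L → 𝟏 (on? L s) ℕ.* 𝟏 (R? L)))
      (cong (𝟏 (P? s) ℕ.*_) (sym (∑-filter (λ L → on? L s) lines (λ L → 𝟏 (R? L))))))

  tangent-lines : ∑ S tangents ≡ count lines (λ L → n L ℕ.≟ 1)
  tangent-lines = begin
    ∑ S tangents                                                        ≡⟨ ∑-cong S (λ _ → sym (ℕ.*-identityˡ _)) ⟩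
    ∑ S (λ s → 1 ℕ.* tangents s)                                        ≡⟨ sym (incidences (λ _ → yes tt) (λ L → n L ℕ.≟ 1)) ⟩
    ∑ lines (λ L → count S (λ s → on? L s ×-dec yes tt) ℕ.* 𝟏 (n L ℕ.≟ 1)) ≡⟨ ∑-cong lines (λ {L} _ → cong (ℕ._* 𝟏 (n L ℕ.≟ 1)) (∑-cong S (λ {s} _ → drop (on? L s)))) ⟩
    ∑ lines (λ L → n L ℕ.* 𝟏 (n L ℕ.≟ 1))                               ≡⟨ ∑-cong lines (λ {L} _ → once (n L)) ⟩
    count lines (λ L → n L ℕ.≟ 1) ∎
    where
    open ≡-Reasoning
    drop : ∀ {P : Set} (d : Dec P) → 𝟏 (d ×-dec yes tt) ≡ 𝟏 d
    drop (yes _) = refl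
    drop (no _)  = refl
    once : ∀ m → m ℕ.* 𝟏 (m ℕ.≟ 1) ≡ 𝟏 (m ℕ.≟ 1)
    once m with m ℕ.≟ 1
    ... | yes refl = refl
    ... | no _     = ℕ.*-zeroʳ m

  odd-lines : ∑ S tangents ℕ.+ N₃ ≤ oddSecants F S
  odd-lines = begin
    ∑ S tangents ℕ.+ N₃
      ≡⟨ trans (cong (ℕ._+ N₃) tangent-lines) (sym (∑-+ lines _ _)) ⟩
    ∑ lines (λ L → 𝟏 (n L ℕ.≟ 1) ℕ.+ 𝟏 (n L ℕ.≟ 3))
      ≤⟨ ∑-mono lines (λ {L} _ → subst (λ m → 𝟏 (n L ℕ.≟ 1) ℕ.+ 𝟏 (n L ℕ.≟ 3) ≤ 𝟏 (oddB F m Bool.≟ true)) (n≡ L) (parity (n L))) ⟩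
    count lines (λ L → oddB F (countB F (incidentB F L) S) Bool.≟ true)
      ≡⟨ sym (countB≡count _ lines _ (λ _ e → e) (λ _ e → e)) ⟩
    oddSecants F S ∎
    where
    open ℕ.≤-Reasoning
    parity : ∀ m → 𝟏 (m ℕ.≟ 1) ℕ.+ 𝟏 (m ℕ.≟ 3) ≤ 𝟏 (oddB F m Bool.≟ true)
    parity 0 = z≤n
    parity 1 = ℕ.≤-refl
    parity 2 = z≤n
    parity 3 = ℕ.≤-refl
    parity (suc (suc (suc (suc m)))) = z≤n
    n≡ : ∀ L → n L ≡ countB F (incidentB F L) S
    n≡ L = sym (countB≡count (incidentB F L) S (on? L) (λ s → to s) (λ s → from s))
      where
      to : ∀ s → incidentB F L s ≡ true → L · s ≡ 0F
      to s e with (L · s) ≟ 0F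
      ... | yes p = p
      from : ∀ s → L · s ≡ 0F → incidentB F L s ≡ true
      from s p with (L · s) ≟ 0F
      ... | yes _ = refl
      ... | no ¬p = contradiction p ¬p

  good-trisecants : ∀ {x} → x ∈ S → tangents x ≡ 1 → 1 ≤ trisecants x
  good-trisecants {x} i t = from-good (good i t)
    where
    from-good : Good x → 1 ≤ trisecants x
    from-good G = subst (1 ≤_) (sym (count-remove _≟V_ (λ L → n L ℕ.≟ 3) (pencil-unique x)
      (∈-pencil (∈-lines (Good.f-normal G)) (Good.f-on G)) (Good.f-three G))) (s≤s z≤n)

  -- Each good point s ≢ P charges 1 to its trisecant.  A trisecant is overcharged only if it is bad, by at
  -- most 2, or if it passes through P, by at most 1, and then a tangent at P is available.
  module Counting (P : V) (P∈S : P ∈ S) (bound : count lines (bad? P) ≤ 10) where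

    good′? : ∀ s → Dec (tangents s ≡ 1 × s ≢ P)
    good′? s = good? s ×-dec ¬? (s ≟V P)

    goods′ : V → ℕ
    goods′ L = count S (λ s → on? L s ×-dec good′? s)

    count-mono : ∀ {A : Set} (as : List A) {Q R : A → Set} (Q? : ∀ a → Dec (Q a)) (R? : ∀ a → Dec (R a)) → (∀ {a} → Q a → R a) → count as Q? ≤ count as R?
    count-mono as Q? R? h = ∑-mono as (λ {a} _ → each a)
      where
      each : ∀ a → 𝟏 (Q? a) ≤ 𝟏 (R? a)
      each a with Q? a | R? a
      ... | no _  | _      = z≤n
      ... | yes _ | yes _  = ℕ.≤-refl
      ... | yes p | no ¬r  = contradiction (h p) ¬r

    line-charge : ∀ L → goods′ L ℕ.* 𝟏 (n L ℕ.≟ 3) ≤ 𝟏 (n L ℕ.≟ 3) ℕ.+ (𝟏 (on? L P) ℕ.* 𝟏 (n L ℕ.≟ 3) ℕ.+ 2 ℕ.* 𝟏 (bad? P L))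
    line-charge L = by-cases (n L ℕ.≟ 3) (on? L P) (2 ℕ.≤? goods L)
      where
      Goal = goods′ L ℕ.* 𝟏 (n L ℕ.≟ 3) ≤ 𝟏 (n L ℕ.≟ 3) ℕ.+ (𝟏 (on? L P) ℕ.* 𝟏 (n L ℕ.≟ 3) ℕ.+ 2 ℕ.* 𝟏 (bad? P L))
      values : ∀ {a b c d} → 𝟏 (n L ℕ.≟ 3) ≡ a → 𝟏 (on? L P) ≡ b → 𝟏 (bad? P L) ≡ c → goods′ L ≤ d → d ℕ.* a ≤ a ℕ.+ (b ℕ.* a ℕ.+ 2 ℕ.* c) → Goal
      values refl refl refl le h = ℕ.≤-trans (ℕ.*-monoˡ-≤ _ le) h
      at-most-n : goods′ L ≤ n L
      at-most-n = count-mono S (λ s → on? L s ×-dec good′? s) (on? L) proj₁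
      by-cases : Dec (n L ≡ 3) → Dec (L · P ≡ 0F) → Dec (2 ≤ goods L) → Goal
      by-cases (no ne) _ _ = ℕ.≤-trans (ℕ.≤-reflexive (trans (cong (goods′ L ℕ.*_) (𝟏-no (n L ℕ.≟ 3) ne)) (ℕ.*-zeroʳ (goods′ L)))) z≤n
      by-cases (yes e) (yes LP) _ = values (𝟏-yes (n L ℕ.≟ 3) e) (𝟏-yes (on? L P) LP) refl
        (ℕ.≤-trans (count-mono S (λ s → on? L s ×-dec good′? s) (without? _≟V_ (on? L) P) (λ p → proj₁ p , proj₂ (proj₂ p)))
          (ℕ.≤-reflexive (ℕ.suc-injective (trans (sym (count-remove _≟V_ (on? L) unique P∈S LP)) e))))
        (s≤s (s≤s z≤n))
      by-cases (yes e) (no ¬LP) (yes rich) = values (𝟏-yes (n L ℕ.≟ 3) e) (𝟏-no (on? L P) ¬LP) (𝟏-yes (bad? P L) ((e , rich) , ¬LP))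
        (ℕ.≤-trans at-most-n (ℕ.≤-reflexive e)) ℕ.≤-refl
      by-cases (yes e) (no ¬LP) (no poor) = values (𝟏-yes (n L ℕ.≟ 3) e) (𝟏-no (on? L P) ¬LP) (𝟏-no (bad? P L) (λ p → poor (proj₂ (proj₁ p))))
        (ℕ.≤-trans (count-mono S (λ s → on? L s ×-dec good′? s) (λ s → on? L s ×-dec good? s) (λ p → proj₁ p , proj₁ (proj₂ p)))
          (ℕ.≤-pred (ℕ.≰⇒> poor))) ℕ.≤-refl

    G′ : ℕ
    G′ = count S good′?

    good-charge : G′ ≤ N₃ ℕ.+ (trisecants P ℕ.+ 20)
    good-charge = begin
      ∑ S (λ s → 𝟏 (good′? s))
        ≤⟨ ∑-mono S (λ {s} i → each s i (good′? s)) ⟩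
      ∑ S (λ s → 𝟏 (good′? s) ℕ.* trisecants s)
        ≡⟨ sym (incidences good′? (λ L → n L ℕ.≟ 3)) ⟩
      ∑ lines (λ L → goods′ L ℕ.* 𝟏 (n L ℕ.≟ 3))
        ≤⟨ ∑-mono lines (λ {L} _ → line-charge L) ⟩
      ∑ lines (λ L → 𝟏 (n L ℕ.≟ 3) ℕ.+ (𝟏 (on? L P) ℕ.* 𝟏 (n L ℕ.≟ 3) ℕ.+ 2 ℕ.* 𝟏 (bad? P L)))
        ≡⟨ trans (∑-+ lines _ _) (cong (N₃ ℕ.+_) (trans (∑-+ lines _ _) (cong₂ ℕ._+_
             (sym (∑-filter (λ L → on? L P) lines (λ L → 𝟏 (n L ℕ.≟ 3)))) (∑-*ˡ lines 2 (λ L → 𝟏 (bad? P L)))))) ⟩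
      N₃ ℕ.+ (trisecants P ℕ.+ 2 ℕ.* count lines (bad? P))
        ≤⟨ ℕ.+-monoʳ-≤ N₃ (ℕ.+-monoʳ-≤ (trisecants P) (ℕ.*-monoʳ-≤ 2 bound)) ⟩
      N₃ ℕ.+ (trisecants P ℕ.+ 20) ∎
      where
      open ℕ.≤-Reasoning
      each : ∀ s → s ∈ S → (d : Dec (tangents s ≡ 1 × s ≢ P)) → 𝟏 d ≤ 𝟏 d ℕ.* trisecants s
      each s i (no _)  = z≤n
      each s i (yes p) = subst (1 ≤_) (sym (ℕ.+-identityʳ _)) (good-trisecants i (proj₁ p))

    -- Two tangents, or one tangent and goodness, pay the 2. A point without tangents gets 2 for
    -- free, and so does `P`, whose tangents are then free to pay for its trisecants.
    point-charge : ∀ {s} → s ∈ S →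
      2 ℕ.+ 𝟏 (s ≟V P) ℕ.* trisecants s ≤ (tangents s ℕ.+ 𝟏 (good′? s)) ℕ.+ (2 ℕ.* 𝟏 (s ≟V P) ℕ.+ 2 ℕ.* 𝟏 (tangents s ℕ.≟ 0))
    point-charge {s} i = by-cases (s ≟V P) (tangents s ℕ.≟ 0) (tangents s ℕ.≟ 1)
      where
      Goal = 2 ℕ.+ 𝟏 (s ≟V P) ℕ.* trisecants s ≤ (tangents s ℕ.+ 𝟏 (good′? s)) ℕ.+ (2 ℕ.* 𝟏 (s ≟V P) ℕ.+ 2 ℕ.* 𝟏 (tangents s ℕ.≟ 0))
      values : ∀ {a b c} → 𝟏 (s ≟V P) ≡ a → 𝟏 (good′? s) ≡ b → 𝟏 (tangents s ℕ.≟ 0) ≡ c →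
        2 ℕ.+ a ℕ.* trisecants s ≤ (tangents s ℕ.+ b) ℕ.+ (2 ℕ.* a ℕ.+ 2 ℕ.* c) → Goal
      values refl refl refl h = h
      by-cases : Dec (s ≡ P) → Dec (tangents s ≡ 0) → Dec (tangents s ≡ 1) → Goal
      by-cases (yes e) _ _ = values (𝟏-yes (s ≟V P) e) refl refl (begin
        2 ℕ.+ 1 ℕ.* trisecants s   ≡⟨ trans (cong (2 ℕ.+_) (ℕ.*-identityˡ (trisecants s))) (ℕ.+-comm 2 (trisecants s)) ⟩
        trisecants s ℕ.+ 2         ≤⟨ ℕ.+-mono-≤ (ℕ.≤-trans (trisecants≤tangents i) (ℕ.m≤m+n _ _)) (ℕ.m≤m+n 2 _) ⟩
        _ ∎)
        where open ℕ.≤-Reasoning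
      by-cases (no ne) (yes t≡0) _ = values (𝟏-no (s ≟V P) ne) refl (𝟏-yes (tangents s ℕ.≟ 0) t≡0) (ℕ.m≤n+m 2 (tangents s ℕ.+ 𝟏 (good′? s)))
      by-cases (no ne) (no _) (yes t≡1) = values (𝟏-no (s ≟V P) ne) (𝟏-yes (good′? s) (t≡1 , ne)) refl
        (ℕ.≤-trans (ℕ.≤-reflexive (cong (ℕ._+ 1) (sym t≡1))) (ℕ.m≤m+n _ _))
      by-cases (no ne) (no t≢0) (no t≢1) = values (𝟏-no (s ≟V P) ne) refl refl
        (ℕ.≤-trans (ℕ.≤∧≢⇒< (ℕ.n≢0⇒n>0 t≢0) (≢-sym t≢1)) (ℕ.≤-trans (ℕ.m≤m+n _ _) (ℕ.m≤m+n _ _)))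

    points-charge : (q ℕ.+ 2) ℕ.* 2 ℕ.+ trisecants P ≤ (∑ S tangents ℕ.+ G′) ℕ.+ 6
    points-charge = begin
      (q ℕ.+ 2) ℕ.* 2 ℕ.+ trisecants P
        ≡⟨ cong₂ ℕ._+_ (trans (cong (ℕ._* 2) (sym size)) (sym (∑-const S 2)))
             (sym (trans (∑-single unique P∈S (λ {s} _ ne → cong (ℕ._* trisecants s) (𝟏-no (s ≟V P) ne)))
               (trans (cong (ℕ._* trisecants P) (𝟏-yes (P ≟V P) refl)) (ℕ.*-identityˡ _)))) ⟩
      ∑ S (λ _ → 2) ℕ.+ ∑ S (λ s → 𝟏 (s ≟V P) ℕ.* trisecants s)
        ≡⟨ sym (∑-+ S _ _) ⟩
      ∑ S (λ s → 2 ℕ.+ 𝟏 (s ≟V P) ℕ.* trisecants s)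
        ≤⟨ ∑-mono S point-charge ⟩
      ∑ S (λ s → (tangents s ℕ.+ 𝟏 (good′? s)) ℕ.+ (2 ℕ.* 𝟏 (s ≟V P) ℕ.+ 2 ℕ.* 𝟏 (tangents s ℕ.≟ 0)))
        ≡⟨ trans (∑-+ S _ _) (cong₂ ℕ._+_ (∑-+ S _ _) (trans (∑-+ S _ _) (cong₂ ℕ._+_
             (trans (∑-*ˡ S 2 _) (cong (2 ℕ.*_) (count-≡ _≟V_ unique P∈S))) (∑-*ˡ S 2 (λ s → 𝟏 (tangents s ℕ.≟ 0)))))) ⟩
      -- The free amounts are 2 for `P` and 2 for each of at most two points without tangents, 6 in
      -- total.
      (∑ S tangents ℕ.+ G′) ℕ.+ (2 ℕ.+ 2 ℕ.* count S (λ s → tangents s ℕ.≟ 0))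
        ≤⟨ ℕ.+-monoʳ-≤ (∑ S tangents ℕ.+ G′) (ℕ.+-monoʳ-≤ 2 (ℕ.*-monoʳ-≤ 2 few-allBisecant)) ⟩
      (∑ S tangents ℕ.+ G′) ℕ.+ 6 ∎
      where open ℕ.≤-Reasoning

    -- `trisecants P` occurs on both sides and cancels, so the trisecants through `P` cost nothing.
    conclusion : 2 ℕ.* q ≤ oddSecants F S ℕ.+ 22
    conclusion = ℕ.+-cancelʳ-≤ (4 ℕ.+ trisecants P) _ _ (begin
      2 ℕ.* q ℕ.+ (4 ℕ.+ trisecants P)
        ≡⟨ +-*-Solver.solve 2 (λ q t → +-*-Solver.con 2 +-*-Solver.:* q +-*-Solver.:+ (+-*-Solver.con 4 +-*-Solver.:+ t) +-*-Solver.:= (q +-*-Solver.:+ +-*-Solver.con 2) +-*-Solver.:* +-*-Solver.con 2 +-*-Solver.:+ t) refl q (trisecants P) ⟩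
      (q ℕ.+ 2) ℕ.* 2 ℕ.+ trisecants P
        ≤⟨ points-charge ⟩
      (∑ S tangents ℕ.+ G′) ℕ.+ 6
        ≤⟨ ℕ.+-monoˡ-≤ 6 (ℕ.+-monoʳ-≤ (∑ S tangents) good-charge) ⟩
      (∑ S tangents ℕ.+ (N₃ ℕ.+ (trisecants P ℕ.+ 20))) ℕ.+ 6
        ≡⟨ +-*-Solver.solve 3 (λ a b t → (a +-*-Solver.:+ (b +-*-Solver.:+ (t +-*-Solver.:+ +-*-Solver.con 20))) +-*-Solver.:+ +-*-Solver.con 6 +-*-Solver.:= ((a +-*-Solver.:+ b) +-*-Solver.:+ +-*-Solver.con 22) +-*-Solver.:+ (+-*-Solver.con 4 +-*-Solver.:+ t)) refl (∑ S tangents) N₃ (trisecants P) ⟩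
      ((∑ S tangents ℕ.+ N₃) ℕ.+ 22) ℕ.+ (4 ℕ.+ trisecants P)
        ≤⟨ ℕ.+-monoˡ-≤ (4 ℕ.+ trisecants P) (ℕ.+-monoˡ-≤ 22 odd-lines) ⟩
      (oddSecants F S ℕ.+ 22) ℕ.+ (4 ℕ.+ trisecants P) ∎)
      where open ℕ.≤-Reasoning

  many-odd-secants : 2 ℕ.* q ≤ oddSecants F S ℕ.+ 22
  many-odd-secants = from-bound few-bad
    where
    from-bound : (∃ λ P → P ∈ S × count lines (bad? P) ≤ 10) → 2 ℕ.* q ≤ oddSecants F S ℕ.+ 22
    from-bound (P , P∈S , bound) = Counting.conclusion P P∈S bound

theorem1 : ∃ λ (c : ℕ) → ∀ (q : ℕ) (F : FiniteField q) → q % 2 ≡ 1 →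
    (S : List (Triple q)) → All (Normalized F) S → Unique S → length S ≡ q + 2 →
    2 * q ≤ oddSecants F S + c
theorem1 = 22 , λ q F odd S normal unique size → Points.many-odd-secants F odd S normal unique size
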